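{- A set $A$ of strings belongs to $\mathrm{AEXPTIME(poly)}$ if and only if there exist a polynomial $f$ and a polynomial-time alternating oracle Turing machine $M$ such that for every input $x$ of length $n$, $$x\in A \iff Q_1A_1\,Q_2A_2\cdots Q_{f(n)}A_{f(n)}\ \big(M \text{ accepts } x \text{ with oracle } (A_1,\dots,A_{f(n)})\big),$$ where each $Q_i\in\{\exists,\forall\}$, the quantifiers alternate (i.e. $Q_{i+1}\in\{\exists,\forall\}\setminus\{Q_i\}$), and the $A_i$ range over sets of strings.
   Context: $\mathrm{AEXPTIME(poly)}$ is the class of problems decidable by an alternating Turing machine running in time $2^{p(n)}$ for some polynomial $p$ with polynomially many alternations. For sets $A_1,\dots,A_k$, $(A_1,\dots,A_k)$ denotes their disjoint union $\{(i,y): y\in A_i,\ 1\le i\le k\}$ (suitably encoded as strings), used as a single oracle. -}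

module Defs where

open import Data.Nat using (ℕ; zero; suc; _+_; _*_; _^_; _≤_; _⊔_; pred)
open import Data.Bool using (Bool; true; false; if_then_else_; _∧_; _∨_)
open import Data.Fin using (Fin; zero; suc)
open import Data.List using (List; []; _∷_; map; foldr)
open import Data.Maybe using (Maybe; just; nothing)
open import Data.Product using (Σ; _×_; _,_)

Str : Set
Str = List Bool

Lang : Set
Lang = Str → Bool

Poly : Set
Poly = List ℕ

eval : Poly → ℕ → ℕ
eval []       n = 0
eval (c ∷ cs) n = c + n * eval cs n

-- Alternating oracle Turing machines
--
-- Two tapes (each one-way infinite to the right): a work tape, which
-- initially holds the input, and an oracle (query) tape.  Tape alphabet
-- Fin (3 + g): zero = blank, 1 = bit 0, 2 = bit 1, the rest extra symbols.

data Quant : Set where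
  ∃Q ∀Q : Quant

data Kind : Set where
  quant  : Quant → Kind
  query  : Kind
  accept : Kind
  reject : Kind

data Move : Set where
  L S R : Move

Sym : ℕ → Set
Sym g = Fin (3 + g)

blank : ∀ {g} → Sym g
blank = zero

encBit : ∀ {g} → Bool → Sym g
encBit false = suc zero
encBit true  = suc (suc zero)

record AOTM : Set where
  field
    nQ    : ℕ
    g     : ℕ
    kind  : Fin nQ → Kind
    start : Fin nQ
    qyes  : Fin nQ
    qno   : Fin nQ
    -- transitions of branching states: reading (work symbol, oracle-tape symbol),
    -- a list of possible (new state, work write, work move, oracle write, oracle move)
    δ     : Fin nQ → Sym g → Sym g → List (Fin nQ × Sym g × Move × Sym g × Move)

readT : ∀ {g} → List (Sym g) → ℕ → Sym g
readT []       _       = blank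
readT (x ∷ xs) zero    = x
readT (x ∷ xs) (suc n) = readT xs n

writeT : ∀ {g} → List (Sym g) → ℕ → Sym g → List (Sym g)
writeT []       zero    s = s ∷ []
writeT []       (suc n) s = blank ∷ writeT [] n s
writeT (x ∷ xs) zero    s = s ∷ xs
writeT (x ∷ xs) (suc n) s = x ∷ writeT xs n s

moveH : Move → ℕ → ℕ
moveH L n = pred n
moveH S n = n
moveH R n = suc n

decodeT : ∀ {g} → List (Sym g) → Str
decodeT []                       = []
decodeT (suc zero ∷ xs)          = false ∷ decodeT xs
decodeT (suc (suc zero) ∷ xs)    = true ∷ decodeT xs
decodeT (_ ∷ xs)                 = []

anyL : ∀ {A : Set} → (A → Bool) → List A → Bool
anyL p = foldr (λ a b → p a ∨ b) false

allL : ∀ {A : Set} → (A → Bool) → List A → Bool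
allL p = foldr (λ a b → p a ∧ b) true

maxL : List ℕ → ℕ
maxL = foldr _⊔_ 0

switch : Maybe Quant → Quant → ℕ
switch (just ∃Q) ∀Q = 1
switch (just ∀Q) ∃Q = 1
switch _         _  = 0

module Run (M : AOTM) where
  open AOTM M

  record Config : Set where
    constructor cfg
    field
      state : Fin nQ
      work  : List (Sym g)
      wpos  : ℕ
      otape : List (Sym g)
      opos  : ℕ

  open Config

  initial : Str → Config
  initial x = cfg start (map encBit x) 0 [] 0

  succs : Config → List Config
  succs c = map step (δ (state c) (readT (work c) (wpos c)) (readT (otape c) (opos c)))
    where
    step : Fin nQ × Sym g × Move × Sym g × Move → Config
    step (q , a , m , b , m′) =
      cfg q (writeT (work c) (wpos c) a) (moveH m (wpos c))
            (writeT (otape c) (opos c) b) (moveH m′ (opos c))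

  answer : Lang → Config → Config
  answer O c = cfg (if O (decodeT (otape c)) then qyes else qno)
                   (work c) (wpos c) [] 0

  acc : Lang → ℕ → Config → Bool
  acc O t c with kind (state c)
  ... | accept = true
  ... | reject = false
  acc O zero    c | _       = false
  acc O (suc t) c | quant ∃Q = anyL (acc O t) (succs c)
  acc O (suc t) c | quant ∀Q = allL (acc O t) (succs c)
  acc O (suc t) c | query    = acc O t (answer O c)

  halts : Lang → ℕ → Config → Bool
  halts O t c with kind (state c)
  ... | accept = true
  ... | reject = true
  halts O zero    c | quant _ = false
  halts O zero    c | query   = false
  halts O (suc t) c | quant _ = allL (halts O t) (succs c)
  halts O (suc t) c | query   = halts O t (answer O c)

  alts : Lang → ℕ → Maybe Quant → Config → ℕ
  alts O zero    prev c = 0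
  alts O (suc t) prev c with kind (state c)
  ... | quant q = switch prev q + maxL (map (alts O t (just q)) (succs c))
  ... | query   = alts O t prev (answer O c)
  ... | accept  = 0
  ... | reject  = 0

  accepts : Lang → ℕ → Str → Bool
  accepts O t x = acc O t (initial x)

-- the empty oracle: a plain alternating TM is an AOTM run with no oracle
emptyOracle : Lang
emptyOracle _ = false

open import Data.List using (length)
open import Relation.Binary.PropositionalEquality using (_≡_)

AEXPTIMEpoly : Lang → Set
AEXPTIMEpoly A =
  Σ AOTM λ M → Σ Poly λ p → Σ Poly λ q →
    ∀ (x : Str) →
      let open Run M
          t = 2 ^ eval p (length x)
      in (halts emptyOracle t (initial x) ≡ true)
       × (alts emptyOracle t nothing (initial x) ≤ eval q (length x))
       × (A x ≡ accepts emptyOracle t x)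

PolyTimeAOTM : AOTM → Poly → Set
PolyTimeAOTM M p = ∀ (O : Lang) (x : Str) →
  Run.halts M O (eval p (length x)) (Run.initial M x) ≡ true

-- The disjoint union (A₁,…,A_k) as a single oracle.
-- Encoding of the pair (i , y) with 1 ≤ i ≤ k:  1^i 0 y.
-- Strings not of this form (or with i out of range) are not in the oracle.

lookupL : List Lang → ℕ → Str → Bool
lookupL []       _       y = false
lookupL (B ∷ Bs) zero    y = B y
lookupL (B ∷ Bs) (suc i) y = lookupL Bs i y

tupleAux : List Lang → ℕ → Str → Bool
tupleAux Bs i []           = false
tupleAux Bs i (true ∷ s)   = tupleAux Bs (suc i) s
tupleAux Bs zero (false ∷ y)    = false
tupleAux Bs (suc i) (false ∷ y) = lookupL Bs i y

tupleOracle : List Lang → Lang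
tupleOracle Bs = tupleAux Bs 0

dual : Quant → Quant
dual ∃Q = ∀Q
dual ∀Q = ∃Q

QPrefix : Quant → ℕ → (List Lang → Set) → Set
QPrefix q  zero    P = P []
QPrefix ∃Q (suc k) P = Σ Lang λ B → QPrefix ∀Q k (λ Bs → P (B ∷ Bs))
QPrefix ∀Q (suc k) P = (B : Lang) → QPrefix ∃Q k (λ Bs → P (B ∷ Bs))

{-# OPTIONS --safe #-}

-- From left to right, the choices of each player of an exponential-time machine, as a function
-- of time, become one oracle per alternation, so that the run is determined by these oracles.
-- A last existential oracle lists facts about this run: the symbol at each depth of the stacks
-- to the left and right of each head, and the state, at each time, the times and depths being
-- bit strings of length N. The facts are the least model of Horn clauses relating neighbouring
-- strings, and rejection is excluded by one more clause. A polynomial-time machine guesses the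
-- strings universally, then a clause, then existentially a literal of it, and asks one query.
-- Depths are counted modulo 2^N; the error made at the wrap-around moves towards the heads by
-- one cell per step and does not arrive in time.
--
-- From right to left, only strings of polynomial length are queried, so the players write
-- tables of exponential length in turn, and the oracle machine is run with its own
-- alternations, which are few as its time is polynomial. Queries are looked up
-- deterministically: guessing and verifying the answers would not do, since the machine is
-- only known to halt on consistent answers.
module Submission where

open import Defs
open import Data.Nat using (ℕ; zero; suc; _+_; _*_; _^_; _≤_; _<_; _∸_; z≤n; s≤s)
import Data.Nat.Properties as ℕ
open import Data.Nat.Tactic.RingSolver using (solve-∀)
open import Data.Bool using (Bool; true; false; if_then_else_; _∧_; _∨_; not)
import Data.Bool.Properties as Bool
open import Data.Fin using (Fin; zero; suc; toℕ; inject₁)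
import Data.Fin.Properties as Fin
open import Data.List using (List; []; _∷_; map; foldr; length; _++_; _ʳ++_; replicate; cartesianProduct; allFin; lookup; reverse)
open import Data.List.Properties using (map-∘; map-id; map-cong; length-++; ++-assoc; ++-identityʳ; length-map; length-replicate; map-++; map-ʳ++; ʳ++-defn; ʳ++-ʳ++; ++-ʳ++; length-ʳ++; reverse-involutive; reverse-map; length-reverse)
open import Data.List.Membership.Propositional using (_∈_)
open import Data.List.Membership.Propositional.Properties using (∈-map⁺; ∈-++⁺ˡ; ∈-++⁺ʳ; ∈-++⁻; ∈-map⁻; ∈-cartesianProduct⁺; ∈-allFin)
open import Data.List.Relation.Unary.Any using (here; there; index)
open import Data.List.Relation.Unary.Any.Properties using (lookup-index)
open import Data.List.Relation.Binary.Pointwise using (Pointwise; []; _∷_)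
open import Data.Maybe using (Maybe; just; nothing)
open import Data.Product using (Σ; _×_; _,_; proj₁; proj₂)
open import Data.Sum using (_⊎_; inj₁; inj₂)
open import Data.Unit using (⊤; tt)
open import Data.Empty using (⊥; ⊥-elim)
open import Function using (_∘_; id; const)
open import Function.Bundles using (_⇔_; mk⇔; Equivalence)
open import Relation.Binary.Definitions using (tri<; tri≈; tri>)
open import Relation.Nullary using (yes; no; Reflects; ofʸ; ofⁿ; does)
open import Relation.Binary.PropositionalEquality using (_≡_; _≢_; refl; sym; trans; cong; cong₂; subst; subst₂)

-- Functions of time suffice as strategies because only one player moves within a stage. Once the
-- earlier oracles are fixed, the winning player faces a single run until the next alternation, so a
-- sequence of transitions is a complete plan, whereas the loser's oracle merely selects one of
-- several good runs. The value of the machine decides who has such a strategy; the equivalence in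
-- the other direction holds because two opposed strategies would have to meet in one list of
-- oracles. The number of stages is made even, so that the prefix ending with a universal oracle can
-- be followed by the existential oracle of facts. That oracle need not be the least model. It only
-- has to satisfy the clauses, hence contains the least model and cannot hide a rejection. The
-- remaining work is to build actual machines. Both directions need tape blocks of polynomial
-- length, so one common construction expands polynomials by Horner's scheme on the query tape. Runs
-- are derivations that carry time, alternations and value together, and bisimulations move them
-- between convenient machines and those of the model.

-- Finite types with explicit enumerations

record Finite (A : Set) : Set where
  field
    elems    : List A
    complete : ∀ a → a ∈ elems

  size : ℕ
  size = length elems

  code : A → Fin size
  code a = index (complete a)

  decode : Fin size → A
  decode = lookup elems

  -- Enumerations may repeat elements, so only this half of a bijection is available. It suffices:
  -- compiled machines decode every state and symbol before acting on it.
  decode-code : ∀ a → decode (code a) ≡ a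
  decode-code a = sym (lookup-index (complete a))

open Finite

fin-Bool : Finite Bool
fin-Bool = record
  { elems    = true ∷ false ∷ []
  ; complete = λ { true → here refl ; false → there (here refl) } }

fin-Fin : ∀ n → Finite (Fin n)
fin-Fin n = record { elems = allFin n ; complete = ∈-allFin }

fin-Quant : Finite Quant
fin-Quant = record
  { elems    = ∃Q ∷ ∀Q ∷ []
  ; complete = λ { ∃Q → here refl ; ∀Q → there (here refl) } }

fin-Move : Finite Move
fin-Move = record
  { elems    = L ∷ S ∷ R ∷ []
  ; complete = λ { L → here refl ; S → there (here refl) ; R → there (there (here refl)) } }

_fin×_ : ∀ {A B : Set} → Finite A → Finite B → Finite (A × B)
a fin× b = record
  { elems    = cartesianProduct (elems a) (elems b)
  ; complete = λ (x , y) → ∈-cartesianProduct⁺ (complete a x) (complete b y) }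

infixr 2 _fin×_ _fin⊎_

_fin⊎_ : ∀ {A B : Set} → Finite A → Finite B → Finite (A ⊎ B)
a fin⊎ b = record
  { elems    = map inj₁ (elems a) ++ map inj₂ (elems b)
  ; complete = λ { (inj₁ x) → ∈-++⁺ˡ (∈-map⁺ inj₁ (complete a x))
                 ; (inj₂ y) → ∈-++⁺ʳ (map inj₁ (elems a)) (∈-map⁺ inj₂ (complete b y)) } }

fin-Maybe : ∀ {A : Set} → Finite A → Finite (Maybe A)
fin-Maybe a = record
  { elems    = nothing ∷ map just (elems a)
  ; complete = λ { nothing → here refl ; (just x) → there (∈-map⁺ just (complete a x)) } }

fin-⊤ : Finite ⊤
fin-⊤ = record { elems = tt ∷ [] ; complete = λ _ → here refl }

fin-retract : ∀ {A B : Set} → Finite A → (f : A → B) (g : B → A) → (∀ b → f (g b) ≡ b) → Finite B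
fin-retract a f g fg = record
  { elems    = map f (elems a)
  ; complete = λ b → subst (_∈ map f (elems a)) (fg b) (∈-map⁺ f (complete a (g b))) }

≤-split : ∀ {a b c} → b ≡ a + c → a ≤ b
≤-split {a} {c = c} refl = ℕ.m≤m+n a c

reflects-map : ∀ {P Q : Set} {v} → (P → Q) → (Q → P) → Reflects P v → Reflects Q v
reflects-map f g (ofʸ p)  = ofʸ (f p)
reflects-map f g (ofⁿ ¬p) = ofⁿ (¬p ∘ g)

reflects-true : ∀ {P : Set} {v} → Reflects P v → (v ≡ true) ⇔ P
reflects-true (ofʸ p)  = mk⇔ (λ _ → p) (λ _ → refl)
reflects-true (ofⁿ ¬p) = mk⇔ (λ ()) (λ p → ⊥-elim (¬p p))

reflects-≡true : ∀ v → Reflects (v ≡ true) v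
reflects-≡true true  = ofʸ refl
reflects-≡true false = ofⁿ λ ()

-- Runs of alternating systems

record Sys : Set₁ where
  field
    Conf   : Set
    kindOf : Conf → Kind
    next   : Conf → List Conf
    reply  : Conf → Conf

foldQ : Quant → List Bool → Bool
foldQ ∃Q = foldr _∨_ false
foldQ ∀Q = foldr _∧_ true

module _ (Y : Sys) where
  open Sys Y

  -- From c the system halts within t steps, with at most k further alternations if the
  -- last branching state had quantifier p, and its value is v.
  data Ev : ℕ → ℕ → Maybe Quant → Conf → Bool → Set where
    ev-accept : ∀ {t k p c} → kindOf c ≡ accept → Ev t k p c true
    ev-reject : ∀ {t k p c} → kindOf c ≡ reject → Ev t k p c false
    ev-query  : ∀ {t k p c v} → kindOf c ≡ query → Ev t k p (reply c) v → Ev (suc t) k p c v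
    ev-branch : ∀ {t j k p c v bs} q → kindOf c ≡ quant q → switch p q + j ≤ k →
                Pointwise (Ev t j (just q)) (next c) bs → foldQ q bs ≡ v → Ev (suc t) k p c v

  -- The value is hidden behind the proposition that it decides, so that branching nodes compose as
  -- bounded quantifiers instead of folds of booleans.
  EvP : ℕ → ℕ → Maybe Quant → Conf → Set → Set
  EvP t k p c P = Σ Bool λ v → Ev t k p c v × Reflects P v

  -- Deterministic work is done in branching states with one successor. Keeping the quantifier fixed
  -- makes it free of alternations, and `done` at every `n` makes the index an upper bound on the
  -- time.
  data Reach (q : Quant) : ℕ → Conf → Conf → Set where
    done : ∀ {n c} → Reach q n c c
    step : ∀ {n c c′ d} → kindOf c ≡ quant q → next c ≡ c′ ∷ [] → Reach q n c′ d → Reach q (suc n) c d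

switch-self : ∀ q → switch (just q) q ≡ 0
switch-self ∃Q = refl
switch-self ∀Q = refl

switch≤1 : ∀ p q → switch p q ≤ 1
switch≤1 nothing   ∃Q = z≤n
switch≤1 nothing   ∀Q = z≤n
switch≤1 (just ∃Q) ∃Q = z≤n
switch≤1 (just ∃Q) ∀Q = s≤s z≤n
switch≤1 (just ∀Q) ∃Q = s≤s z≤n
switch≤1 (just ∀Q) ∀Q = z≤n

module _ {Y : Sys} where
  open Sys Y

  ev-mono : ∀ {t t′ k k′ p c v} → t ≤ t′ → k ≤ k′ → Ev Y t k p c v → Ev Y t′ k′ p c v
  evs-mono : ∀ {t t′ k k′ p cs vs} → t ≤ t′ → k ≤ k′ →
             Pointwise (Ev Y t k p) cs vs → Pointwise (Ev Y t′ k′ p) cs vs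
  ev-mono t≤ k≤ (ev-accept e)       = ev-accept e
  ev-mono t≤ k≤ (ev-reject e)       = ev-reject e
  ev-mono (s≤s t≤) k≤ (ev-query e r) = ev-query e (ev-mono t≤ k≤ r)
  ev-mono (s≤s t≤) k≤ (ev-branch q e j≤ rs f) =
    ev-branch q e (ℕ.≤-trans j≤ k≤) (evs-mono t≤ ℕ.≤-refl rs) f
  evs-mono t≤ k≤ []       = []
  evs-mono t≤ k≤ (r ∷ rs) = ev-mono t≤ k≤ r ∷ evs-mono t≤ k≤ rs

  -- Only the first branching node looks at the previous quantifier, and a different one there costs
  -- at most one alternation.
  ev-prev : ∀ {t k p p′ c v} → Ev Y t k p c v → Ev Y t (suc k) p′ c v
  ev-prev (ev-accept e)   = ev-accept e
  ev-prev (ev-reject e)   = ev-reject e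
  ev-prev (ev-query e r)  = ev-query e (ev-prev r)
  ev-prev {p = p} {p′} (ev-branch {j = j} q e j≤ rs f) =
    ev-branch q e (ℕ.+-mono-≤ (switch≤1 p′ q) (ℕ.≤-trans (ℕ.m≤n+m j (switch p q)) j≤)) rs f

  evp-mono : ∀ {t t′ k k′ p c P} → t ≤ t′ → k ≤ k′ → EvP Y t k p c P → EvP Y t′ k′ p c P
  evp-mono t≤ k≤ (v , r , x) = v , ev-mono t≤ k≤ r , x

  evp-prev : ∀ {t k p p′ c P} → EvP Y t k p c P → EvP Y t (suc k) p′ c P
  evp-prev (v , r , x) = v , ev-prev r , x

  evp-map : ∀ {t k p c P Q} → (P → Q) → (Q → P) → EvP Y t k p c P → EvP Y t k p c Q
  evp-map f g (v , r , x) = v , r , reflects-map f g x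

  fold-single : ∀ q b → foldQ q (b ∷ []) ≡ b
  fold-single ∃Q = Bool.∨-identityʳ
  fold-single ∀Q = Bool.∧-identityʳ

  ev-step : ∀ {t k q c c′ v} → kindOf c ≡ quant q → next c ≡ c′ ∷ [] →
            Ev Y t k (just q) c′ v → Ev Y (suc t) k (just q) c v
  ev-step {k = k} {q} {v = v} e s r =
    ev-branch q e (ℕ.≤-reflexive (cong (_+ k) (switch-self q)))
      (subst (λ cs → Pointwise (Ev Y _ k (just q)) cs (v ∷ [])) (sym s) (r ∷ [])) (fold-single q v)

  reach-ev : ∀ {n t k q c d v} → Reach Y q n c d → Ev Y t k (just q) d v → Ev Y (n + t) k (just q) c v
  reach-ev done r         = ev-mono (ℕ.m≤n+m _ _) ℕ.≤-refl r
  reach-ev (step e s g) r = ev-step e s (reach-ev g r)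

  reach-evp : ∀ {n t k q c d P} → Reach Y q n c d → EvP Y t k (just q) d P → EvP Y (n + t) k (just q) c P
  reach-evp g (v , r , x) = v , reach-ev g r , x

  reach-mono : ∀ {n m q c d} → n ≤ m → Reach Y q n c d → Reach Y q m c d
  reach-mono n≤m done                 = done
  reach-mono (s≤s n≤m) (step e s g)   = step e s (reach-mono n≤m g)

  reach-cong : ∀ {n m q c c′ d d′} → n ≡ m → c ≡ c′ → d ≡ d′ → Reach Y q n c d → Reach Y q m c′ d′
  reach-cong refl refl refl g = g

  infixr 5 _⨟_
  _⨟_ : ∀ {n m q c d e} → Reach Y q n c d → Reach Y q m d e → Reach Y q (n + m) c e
  done ⨟ h         = reach-mono (ℕ.m≤n+m _ _) h
  step e s g ⨟ h   = step e s (g ⨟ h)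

  evp-accept : ∀ {t k p c} → kindOf c ≡ accept → EvP Y t k p c ⊤
  evp-accept e = true , ev-accept e , ofʸ tt

  evp-reject : ∀ {t k p c} → kindOf c ≡ reject → EvP Y t k p c ⊥
  evp-reject e = false , ev-reject e , ofⁿ id

  evp-query : ∀ {t k p c P} → kindOf c ≡ query → EvP Y t k p (reply c) P → EvP Y (suc t) k p c P
  evp-query e (v , r , x) = v , ev-query e r , x

  module _ {E : Set} (f : E → Conf) (P : E → Set) {t j : ℕ} where

    private
      alls : ∀ q es → (∀ e → e ∈ es → EvP Y t j (just q) (f e) (P e)) →
             Σ (List Bool) λ bs → Pointwise (Ev Y t j (just q)) (map f es) bs × Pointwise (Reflects ∘ P) es bs
      alls q []       h = [] , [] , []
      alls q (e ∷ es) h with h e (here refl) | alls q es (λ d i → h d (there i))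
      ... | v , r , x | bs , rs , xs = v ∷ bs , r ∷ rs , x ∷ xs

      all-reflects : ∀ {es bs} → Pointwise (Reflects ∘ P) es bs → Reflects (∀ e → e ∈ es → P e) (foldQ ∀Q bs)
      all-reflects [] = ofʸ λ _ ()
      all-reflects (ofⁿ ¬p ∷ xs) = ofⁿ λ h → ¬p (h _ (here refl))
      all-reflects (ofʸ p ∷ xs) = reflects-map
        (λ { h e (here refl) → p ; h e (there i) → h e i }) (λ h e i → h e (there i)) (all-reflects xs)

      any-reflects : ∀ {es bs} → Pointwise (Reflects ∘ P) es bs → Reflects (Σ E λ e → e ∈ es × P e) (foldQ ∃Q bs)
      any-reflects [] = ofⁿ λ ()
      any-reflects (ofʸ p ∷ xs) = ofʸ (_ , here refl , p)
      any-reflects (ofⁿ ¬p ∷ xs) = reflects-map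
        (λ (e , i , p) → e , there i , p)
        (λ { (e , here refl , p) → ⊥-elim (¬p p) ; (e , there i , p) → e , i , p }) (any-reflects xs)

    evp-all : ∀ {k p c es} → kindOf c ≡ quant ∀Q → next c ≡ map f es → switch p ∀Q + j ≤ k →
              (∀ e → e ∈ es → EvP Y t j (just ∀Q) (f e) (P e)) → EvP Y (suc t) k p c (∀ e → e ∈ es → P e)
    evp-all {es = es} e s j≤ h with alls ∀Q es h
    ... | bs , rs , xs =
      _ , ev-branch ∀Q e j≤ (subst (λ cs → Pointwise _ cs bs) (sym s) rs) refl , all-reflects xs

    evp-ex : ∀ {k p c es} → kindOf c ≡ quant ∃Q → next c ≡ map f es → switch p ∃Q + j ≤ k →
             (∀ e → e ∈ es → EvP Y t j (just ∃Q) (f e) (P e)) → EvP Y (suc t) k p c (Σ E λ e → e ∈ es × P e)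
    evp-ex {es = es} e s j≤ h with alls ∃Q es h
    ... | bs , rs , xs =
      _ , ev-branch ∃Q e j≤ (subst (λ cs → Pointwise _ cs bs) (sym s) rs) refl , any-reflects xs

-- Bisimulations and the evaluator of the model

record Bisim (Y Z : Sys) (_~_ : Sys.Conf Y → Sys.Conf Z → Set) : Set where
  field
    ~kind  : ∀ {c d} → c ~ d → Sys.kindOf Y c ≡ Sys.kindOf Z d
    ~next  : ∀ {c d} → c ~ d → Pointwise _~_ (Sys.next Y c) (Sys.next Z d)
    ~reply : ∀ {c d} → c ~ d → Sys.reply Y c ~ Sys.reply Z d

module _ {Y Z : Sys} {_~_ : Sys.Conf Y → Sys.Conf Z → Set} (B : Bisim Y Z _~_) where
  open Bisim B

  -- Successor lists are matched position by position, so time, alternations and value carry over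
  -- unchanged.
  forward : ∀ {t k p c d v} → c ~ d → Ev Y t k p c v → Ev Z t k p d v
  forwards : ∀ {t k p cs ds vs} → Pointwise _~_ cs ds → Pointwise (Ev Y t k p) cs vs → Pointwise (Ev Z t k p) ds vs
  forward r (ev-accept e)     = ev-accept (trans (sym (~kind r)) e)
  forward r (ev-reject e)     = ev-reject (trans (sym (~kind r)) e)
  forward r (ev-query e g)    = ev-query (trans (sym (~kind r)) e) (forward (~reply r) g)
  forward r (ev-branch q e j≤ gs f) =
    ev-branch q (trans (sym (~kind r)) e) j≤ (forwards (~next r) gs) f
  forwards []       []       = []
  forwards (r ∷ rs) (g ∷ gs) = forward r g ∷ forwards rs gs

  backward : ∀ {t k p c d v} → c ~ d → Ev Z t k p d v → Ev Y t k p c v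
  backwards : ∀ {t k p cs ds vs} → Pointwise _~_ cs ds → Pointwise (Ev Z t k p) ds vs → Pointwise (Ev Y t k p) cs vs
  backward r (ev-accept e)     = ev-accept (trans (~kind r) e)
  backward r (ev-reject e)     = ev-reject (trans (~kind r) e)
  backward r (ev-query e g)    = ev-query (trans (~kind r) e) (backward (~reply r) g)
  backward r (ev-branch q e j≤ gs f) =
    ev-branch q (trans (~kind r) e) j≤ (backwards (~next r) gs) f
  backwards []       []       = []
  backwards (r ∷ rs) (g ∷ gs) = backward r g ∷ backwards rs gs

module _ (M : AOTM) (O : Lang) where
  open AOTM M
  open Run M

  concrete : Sys
  concrete = record { Conf = Config ; kindOf = kind ∘ Config.state ; next = succs ; reply = answer O }

  ev⇒halts : ∀ {t k p c v} → Ev concrete t k p c v → halts O t c ≡ true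
  evs⇒halts : ∀ {t k p cs vs} → Pointwise (Ev concrete t k p) cs vs → allL (halts O t) cs ≡ true
  ev⇒halts {zero}  (ev-accept e) rewrite e = refl
  ev⇒halts {suc t} (ev-accept e) rewrite e = refl
  ev⇒halts {zero}  (ev-reject e) rewrite e = refl
  ev⇒halts {suc t} (ev-reject e) rewrite e = refl
  ev⇒halts (ev-query e r) rewrite e = ev⇒halts r
  ev⇒halts (ev-branch q e _ rs _) rewrite e = evs⇒halts rs
  evs⇒halts [] = refl
  evs⇒halts (r ∷ rs) rewrite ev⇒halts r = evs⇒halts rs

  ev⇒acc : ∀ {t k p c v} → Ev concrete t k p c v → acc O t c ≡ v
  evs⇒any : ∀ {t k p cs vs} → Pointwise (Ev concrete t k p) cs vs → anyL (acc O t) cs ≡ foldQ ∃Q vs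
  evs⇒all : ∀ {t k p cs vs} → Pointwise (Ev concrete t k p) cs vs → allL (acc O t) cs ≡ foldQ ∀Q vs
  ev⇒acc {zero}  (ev-accept e) rewrite e = refl
  ev⇒acc {suc t} (ev-accept e) rewrite e = refl
  ev⇒acc {zero}  (ev-reject e) rewrite e = refl
  ev⇒acc {suc t} (ev-reject e) rewrite e = refl
  ev⇒acc (ev-query e r) rewrite e = ev⇒acc r
  ev⇒acc (ev-branch ∃Q e _ rs f) rewrite e = trans (evs⇒any rs) f
  ev⇒acc (ev-branch ∀Q e _ rs f) rewrite e = trans (evs⇒all rs) f
  evs⇒any [] = refl
  evs⇒any (r ∷ rs) = cong₂ _∨_ (ev⇒acc r) (evs⇒any rs)
  evs⇒all [] = refl
  evs⇒all (r ∷ rs) = cong₂ _∧_ (ev⇒acc r) (evs⇒all rs)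

  ev⇒alts : ∀ {t k p c v} → Ev concrete t k p c v → alts O t p c ≤ k
  evs⇒alts : ∀ {t k q cs vs} → Pointwise (Ev concrete t k (just q)) cs vs → maxL (map (alts O t (just q)) cs) ≤ k
  ev⇒alts {zero} _ = z≤n
  ev⇒alts {suc t} (ev-accept e) rewrite e = z≤n
  ev⇒alts {suc t} (ev-reject e) rewrite e = z≤n
  ev⇒alts (ev-query e r) rewrite e = ev⇒alts r
  ev⇒alts {p = p} (ev-branch q e j≤ rs _) rewrite e =
    ℕ.≤-trans (ℕ.+-monoʳ-≤ (switch p q) (evs⇒alts rs)) j≤
  evs⇒alts [] = z≤n
  evs⇒alts (r ∷ rs) = ℕ.⊔-lub (ev⇒alts r) (evs⇒alts rs)

  private
    ∧-split : ∀ {a b} → a ∧ b ≡ true → a ≡ true × b ≡ true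
    ∧-split {true} {true} refl = refl , refl

  -- With no fuel left `alts` is 0 without looking at the state. This is harmless, since `halts`
  -- then admits accepting and rejecting states only.
  halts⇒ev : ∀ t {k p} c → halts O t c ≡ true → alts O t p c ≤ k → Ev concrete t k p c (acc O t c)
  halts⇒evs : ∀ t {k q} cs → allL (halts O t) cs ≡ true → maxL (map (alts O t (just q)) cs) ≤ k →
              Pointwise (Ev concrete t k (just q)) cs (map (acc O t) cs)
  halts⇒ev zero c h a with kind (Config.state c) in e
  ... | accept = ev-accept e
  ... | reject = ev-reject e
  halts⇒ev (suc t) c h a with kind (Config.state c) in e
  ... | accept = ev-accept e
  ... | reject = ev-reject e
  ... | query  = ev-query e (halts⇒ev t (answer O c) h a)
  ... | quant ∃Q = ev-branch ∃Q e a (halts⇒evs t (succs c) h ℕ.≤-refl) (fold-map (succs c))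
    where
    fold-map : ∀ cs → foldQ ∃Q (map (acc O t) cs) ≡ anyL (acc O t) cs
    fold-map []       = refl
    fold-map (x ∷ cs) = cong (acc O t x ∨_) (fold-map cs)
  ... | quant ∀Q = ev-branch ∀Q e a (halts⇒evs t (succs c) h ℕ.≤-refl) (fold-map (succs c))
    where
    fold-map : ∀ cs → foldQ ∀Q (map (acc O t) cs) ≡ allL (acc O t) cs
    fold-map []       = refl
    fold-map (x ∷ cs) = cong (acc O t x ∧_) (fold-map cs)
  halts⇒evs t []       h a = []
  halts⇒evs t {q = q} (c ∷ cs) h a =
    halts⇒ev t c (proj₁ (∧-split h)) (ℕ.≤-trans (ℕ.m≤m⊔n (alts O t (just q) c) _) a) ∷
    halts⇒evs t cs (proj₂ (∧-split {halts O t c} h)) (ℕ.≤-trans (ℕ.m≤n⊔m (alts O t (just q) c) _) a)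

-- Zipper tapes: l ◂ r holds the cells left of the head, nearest first, and the cells from
-- the head on.

infix 4.5 _◂_
data Tape (A : Set) : Set where
  _◂_ : (l r : List A) → Tape A

tl : ∀ {A : Set} → List A → List A
tl []       = []
tl (_ ∷ as) = as

put : ∀ {A : Set} → A → Move → Tape A → Tape A
-- A left move at the left end stays there, as `pred 0` does in `moveH`.
put a L ([] ◂ r)    = [] ◂ a ∷ tl r
put a L (b ∷ l ◂ r) = l ◂ b ∷ a ∷ tl r
put a S (l ◂ r)     = l ◂ a ∷ tl r
put a R (l ◂ r)     = a ∷ l ◂ tl r

pos : ∀ {A : Set} → Tape A → ℕ
pos (l ◂ r) = length l

full : ∀ {A : Set} → Tape A → List A
full (l ◂ r) = l ʳ++ r

rdOr : ∀ {A : Set} → A → List A → ℕ → A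
rdOr d []       _       = d
rdOr d (a ∷ as) zero    = a
rdOr d (a ∷ as) (suc i) = rdOr d as i

decodeBy : ∀ {A : Set} → (A → Maybe Bool) → List A → Str
decodeBy f [] = []
decodeBy f (a ∷ as) with f a
... | just b  = b ∷ decodeBy f as
... | nothing = []

record Zip (St A : Set) : Set where
  constructor zc
  field
    stz : St
    wk  : Tape A
    ot  : Tape A

record Machine : Set₁ where
  field
    St A  : Set
    blk   : A
    bitOf : A → Maybe Bool
    kindM : St → Kind
    st₀ qy qn : St
    δM    : St → A → A → List (St × A × Move × A × Move)

  rd : List A → ℕ → A
  rd = rdOr blk

  hd : List A → A
  hd as = rd as 0

  read : Tape A → A
  read (l ◂ r) = hd r

  ZConf : Set
  ZConf = Zip St A

  Trans : Set
  Trans = St × A × Move × A × Move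

  zstep : ZConf → Trans → ZConf
  zstep (zc _ w o) (s , a , m , b , m′) = zc s (put a m w) (put b m′ o)

  znext : ZConf → List ZConf
  znext z@(zc s w o) = map (zstep z) (δM s (read w) (read o))

  zreply : Lang → ZConf → ZConf
  zreply O (zc s w o) = zc (if O (decodeBy bitOf (full o)) then qy else qn) w ([] ◂ [])

  zsys : Lang → Sys
  zsys O = record { Conf = ZConf ; kindOf = kindM ∘ Zip.stz ; next = znext ; reply = zreply O }

module _ {A : Set} where

  rd-beyond : ∀ (d : A) (l r : List A) i → rdOr d (l ʳ++ r) (length l + i) ≡ rdOr d r i
  rd-beyond d []      r i = refl
  rd-beyond d (a ∷ l) r i =
    trans (cong (rdOr d (l ʳ++ (a ∷ r))) (sym (ℕ.+-suc (length l) i))) (rd-beyond d l (a ∷ r) (suc i))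

  rd-head : ∀ (d : A) (l r : List A) → rdOr d (l ʳ++ r) (length l) ≡ rdOr d r 0
  rd-head d l r = trans (cong (rdOr d (l ʳ++ r)) (sym (ℕ.+-identityʳ (length l)))) (rd-beyond d l r 0)

  rd-tl : ∀ (d : A) r i → rdOr d (tl r) i ≡ rdOr d r (suc i)
  rd-tl d []      i = refl
  rd-tl d (_ ∷ _) i = refl

  rd-ʳ++-cong : ∀ (d : A) l {r r′} → (∀ i → rdOr d r i ≡ rdOr d r′ i) → ∀ i → rdOr d (l ʳ++ r) i ≡ rdOr d (l ʳ++ r′) i
  rd-ʳ++-cong d []      h i = h i
  rd-ʳ++-cong d (a ∷ l) h   = rd-ʳ++-cong d l λ { zero → refl ; (suc i) → h i }

  full-put : ∀ (a : A) m l r → full (put a m (l ◂ r)) ≡ l ʳ++ (a ∷ tl r)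
  full-put a L []      r = refl
  full-put a L (b ∷ l) r = refl
  full-put a S l       r = refl
  full-put a R l       r = refl

  pos-put : ∀ (a : A) m t → pos (put a m t) ≡ moveH m (pos t)
  pos-put a L ([] ◂ r)    = refl
  pos-put a L (b ∷ l ◂ r) = refl
  pos-put a S (l ◂ r)     = refl
  pos-put a R (l ◂ r)     = refl

-- Machines over arbitrary types inside the model

_≈T_ : ∀ {g} → List (Sym g) → List (Sym g) → Set
xs ≈T ys = ∀ i → readT xs i ≡ readT ys i

writeT-cong : ∀ {g} {xs ys : List (Sym g)} n s → xs ≈T ys → writeT xs n s ≈T writeT ys n s
writeT-cong {xs = []}     {[]}     n       s h i = refl
writeT-cong {xs = []}     {y ∷ ys} zero    s h zero    = refl
writeT-cong {xs = []}     {y ∷ ys} zero    s h (suc i) = h (suc i)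
writeT-cong {xs = []}     {y ∷ ys} (suc n) s h zero    = h 0
writeT-cong {xs = []}     {y ∷ ys} (suc n) s h (suc i) = writeT-cong {xs = []} {ys} n s (h ∘ suc) i
writeT-cong {xs = x ∷ xs} {[]}     zero    s h zero    = refl
writeT-cong {xs = x ∷ xs} {[]}     zero    s h (suc i) = h (suc i)
writeT-cong {xs = x ∷ xs} {[]}     (suc n) s h zero    = h 0
writeT-cong {xs = x ∷ xs} {[]}     (suc n) s h (suc i) = writeT-cong {xs = xs} {[]} n s (h ∘ suc) i
writeT-cong {xs = x ∷ xs} {y ∷ ys} zero    s h zero    = refl
writeT-cong {xs = x ∷ xs} {y ∷ ys} zero    s h (suc i) = h (suc i)
writeT-cong {xs = x ∷ xs} {y ∷ ys} (suc n) s h zero    = h 0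
writeT-cong {xs = x ∷ xs} {y ∷ ys} (suc n) s h (suc i) = writeT-cong {xs = xs} {ys} n s (h ∘ suc) i

decodeT-cong : ∀ {g} (xs ys : List (Sym g)) → xs ≈T ys → decodeT xs ≡ decodeT ys
decodeT-cong []       []       h = refl
decodeT-cong []       (y ∷ ys) h with y | h 0
... | zero | refl = refl
decodeT-cong (x ∷ xs) []       h with x | h 0
... | zero | refl = refl
decodeT-cong (x ∷ xs) (y ∷ ys) h with x | y | h 0
... | zero              | _ | refl = refl
... | suc zero          | _ | refl = cong (false ∷_) (decodeT-cong xs ys (h ∘ suc))
... | suc (suc zero)    | _ | refl = cong (true ∷_) (decodeT-cong xs ys (h ∘ suc))
... | suc (suc (suc _)) | _ | refl = refl

writeT-ʳ++ : ∀ {g} (l r : List (Sym g)) n s xs → xs ≡ l ʳ++ r → n ≡ length l → writeT xs n s ≡ l ʳ++ (s ∷ tl r)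
writeT-ʳ++ l r n s _ refl refl = subst₂ (λ k z → writeT (l ʳ++ r) k s ≡ z)
  (ℕ.+-identityʳ _) refl (go l r 0 (s ∷ tl r) (write0 r))
  where
  write0 : ∀ r → writeT r 0 s ≡ s ∷ tl r
  write0 []      = refl
  write0 (_ ∷ _) = refl
  go : ∀ l r i r′ → writeT r i s ≡ r′ → writeT (l ʳ++ r) (length l + i) s ≡ l ʳ++ r′
  go []      r i r′ h = h
  go (a ∷ l) r i r′ h = trans (cong (λ k → writeT (l ʳ++ (a ∷ r)) k s) (sym (ℕ.+-suc (length l) i)))
                              (go l (a ∷ r) (suc i) (a ∷ r′) (cong (a ∷_) h))

sbit : ∀ {g} → Sym g → Maybe Bool
sbit (suc zero)       = just false
sbit (suc (suc zero)) = just true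
sbit _                = nothing

-- Nothing is asked of `M` outside the image of the encodings; a run started inside the image never
-- leaves it.
record Encodes (K : Machine) (M : AOTM) : Set where
  open Machine K
  open AOTM M
  field
    encS  : St → Fin nQ
    encA  : A → Sym g
    kind≡ : ∀ s → kind (encS s) ≡ kindM s
    δ≡    : ∀ s a b → δ (encS s) (encA a) (encA b) ≡
            map (λ (s , a , m , b , m′) → encS s , encA a , m , encA b , m′) (δM s a b)
    blk≡  : encA blk ≡ zero
    bits≡ : ∀ a → sbit (encA a) ≡ bitOf a
    st₀≡  : encS st₀ ≡ start
    qy≡   : encS qy ≡ qyes
    qn≡   : encS qn ≡ qno

module _ {K : Machine} {M : AOTM} (C : Encodes K M) (O : Lang) where
  open Machine K
  open AOTM M
  open Encodes C
  open Run M

  TapeR : Tape A → List (Sym g) → ℕ → Set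
  TapeR (l ◂ r) ts n = n ≡ length l × (ts ≈T (map encA (l ʳ++ r)))

  record ConfR (z : ZConf) (c : Config) : Set where
    constructor confR
    field
      stR : Config.state c ≡ encS (Zip.stz z)
      wkR : TapeR (Zip.wk z) (Config.work c) (Config.wpos c)
      otR : TapeR (Zip.ot z) (Config.otape c) (Config.opos c)

  private
    readT-map : ∀ as i → readT (map encA as) i ≡ encA (rd as i)
    readT-map []       i       = sym blk≡
    readT-map (a ∷ as) zero    = refl
    readT-map (a ∷ as) (suc i) = readT-map as i

    decode-map : ∀ as → decodeT (map encA as) ≡ decodeBy bitOf as
    decode-map [] = refl
    decode-map (a ∷ as) with encA a | bits≡ a
    ... | zero              | e rewrite sym e = refl
    ... | suc zero          | e rewrite sym e = cong (false ∷_) (decode-map as)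
    ... | suc (suc zero)    | e rewrite sym e = cong (true ∷_) (decode-map as)
    ... | suc (suc (suc _)) | e rewrite sym e = refl

    read-R : ∀ {t ts n} → TapeR t ts n → readT ts n ≡ encA (read t)
    read-R {l ◂ r} (refl , h) = trans (h (length l)) (trans (readT-map (l ʳ++ r) (length l)) (cong encA (rd-head blk l r)))

    put-R : ∀ {t ts n} a m → TapeR t ts n → TapeR (put a m t) (writeT ts n (encA a)) (moveH m n)
    put-R {l ◂ r} {ts} a m (refl , h) = go m (λ i → trans (writeT-cong {xs = ts} {map encA (l ʳ++ r)} (length l) (encA a) h i) (cong (λ xs → readT xs i) eq))
      where
      map-tl : ∀ r → tl (map encA r) ≡ map encA (tl r)
      map-tl []      = refl
      map-tl (_ ∷ _) = refl
      eq : writeT (map encA (l ʳ++ r)) (length l) (encA a) ≡ map encA (l ʳ++ (a ∷ tl r))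
      eq = trans (writeT-ʳ++ (map encA l) (map encA r) (length l) (encA a) _ (map-ʳ++ encA l) (sym (length-map encA l)))
                 (trans (cong (λ z → map encA l ʳ++ (encA a ∷ z)) (map-tl r)) (sym (map-ʳ++ encA l)))
      go : ∀ m → (writeT ts (length l) (encA a) ≈T (map encA (l ʳ++ (a ∷ tl r)))) →
           TapeR (put a m (l ◂ r)) (writeT ts (length l) (encA a)) (moveH m (length l))
      go m g with pos-put a m (l ◂ r) | full-put a m l r
      ... | p | f with put a m (l ◂ r)
      ... | l′ ◂ r′ = sym p , λ i → trans (g i) (cong (λ z → readT (map encA z) i) (sym f))

    next-R : ∀ {z c} → ConfR z c → Pointwise ConfR (znext z) (succs c)
    next-R {zc s w o} {cfg _ ws wn os on} (confR refl wr or)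
      rewrite read-R wr | read-R or | δ≡ s (read w) (read o) = go (δM s (read w) (read o))
      where
      go : ∀ es → Pointwise ConfR (map (zstep (zc s w o)) es)
                  (map _ (map (λ (s , a , m , b , m′) → encS s , encA a , m , encA b , m′) es))
      go [] = []
      go ((s′ , a , m , b , m′) ∷ es) = confR refl (put-R a m wr) (put-R b m′ or) ∷ go es

    reply-R : ∀ {z c} → ConfR z c → ConfR (zreply O z) (answer O c)
    reply-R {zc s w (l ◂ r)} {c} (confR refl wr (_ , or)) = confR (st-eq (O (decodeT (Config.otape c))) _ (cong O eq)) wr (refl , λ _ → refl)
      where
      eq : decodeT (Config.otape c) ≡ decodeBy bitOf (l ʳ++ r)
      eq = trans (decodeT-cong _ _ or) (decode-map (l ʳ++ r))
      st-eq : ∀ x y → x ≡ y → (if x then qyes else qno) ≡ encS (if y then qy else qn)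
      st-eq true  _ refl = sym qy≡
      st-eq false _ refl = sym qn≡

  bisim : Bisim (zsys O) (concrete M O) ConfR
  bisim = record
    { ~kind  = λ { {zc s _ _} (confR refl _ _) → sym (kind≡ s) }
    ; ~next  = next-R
    ; ~reply = reply-R }

  initial-R : ∀ x as → map encA as ≡ map encBit x → ConfR (zc st₀ ([] ◂ as) ([] ◂ [])) (initial x)
  initial-R x as e = confR (sym st₀≡) (refl , λ i → cong (λ z → readT z i) (sym e)) (refl , λ _ → refl)

module _ (M : AOTM) where
  open AOTM M

  asMachine : Machine
  asMachine = record
    { St = Fin nQ ; A = Sym g ; blk = zero ; bitOf = sbit ; kindM = kind
    ; st₀ = start ; qy = qyes ; qn = qno ; δM = δ }

  asMachine-encodes : Encodes asMachine M
  asMachine-encodes = record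
    { encS = id ; encA = id ; kind≡ = λ _ → refl ; δ≡ = λ s a b → sym (map-id (δ s a b))
    ; blk≡ = refl ; bits≡ = λ _ → refl ; st₀≡ = refl ; qy≡ = refl ; qn≡ = refl }

-- Compilation of programs

-- Blank and bits are kept apart from the extra symbols because the model fixes their codes: inputs
-- are written and queries are decoded with them.
data Γ (E : Set) : Set where
  □   : Γ E
  bit : Bool → Γ E
  ext : E → Γ E

bitΓ : ∀ {E} → Γ E → Maybe Bool
bitΓ (bit b) = just b
bitΓ _       = nothing

record Program : Set₁ where
  field
    St E      : Set
    fin-St    : Finite St
    fin-E     : Finite E
    kindM     : St → Kind
    st₀ qy qn : St
    δM        : St → Γ E → Γ E → List (St × Γ E × Move × Γ E × Move)

  machine : Machine
  machine = record
    { St = St ; A = Γ E ; blk = □ ; bitOf = bitΓ ; kindM = kindM ; st₀ = st₀ ; qy = qy ; qn = qn ; δM = δM }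

  private
    encΓ : Γ E → Sym (size fin-E)
    encΓ □       = zero
    encΓ (bit b) = encBit b
    encΓ (ext e) = suc (suc (suc (code fin-E e)))

    decΓ : Sym (size fin-E) → Γ E
    decΓ zero                = □
    decΓ (suc zero)          = bit false
    decΓ (suc (suc zero))    = bit true
    decΓ (suc (suc (suc i))) = ext (decode fin-E i)

    dec-encΓ : ∀ a → decΓ (encΓ a) ≡ a
    dec-encΓ □           = refl
    dec-encΓ (bit false) = refl
    dec-encΓ (bit true)  = refl
    dec-encΓ (ext e)     = cong ext (decode-code fin-E e)

    sbit-encΓ : ∀ a → sbit (encΓ a) ≡ bitΓ a
    sbit-encΓ □           = refl
    sbit-encΓ (bit false) = refl
    sbit-encΓ (bit true)  = refl
    sbit-encΓ (ext e)     = refl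

    encT : St × Γ E × Move × Γ E × Move → Fin (size fin-St) × Sym (size fin-E) × Move × Sym (size fin-E) × Move
    encT (s , a , m , b , m′) = code fin-St s , encΓ a , m , encΓ b , m′

  compile : AOTM
  compile = record
    { nQ = size fin-St ; g = size fin-E ; kind = kindM ∘ decode fin-St
    ; start = code fin-St st₀ ; qyes = code fin-St qy ; qno = code fin-St qn
    ; δ = λ i a b → map encT (δM (decode fin-St i) (decΓ a) (decΓ b)) }

  compile-encodes : Encodes machine compile
  compile-encodes = record
    { encS = code fin-St ; encA = encΓ
    ; kind≡ = λ s → cong kindM (decode-code fin-St s)
    ; δ≡ = λ s a b → cong (map encT) (δ-cong (decode-code fin-St s) (dec-encΓ a) (dec-encΓ b))
    ; blk≡ = refl ; bits≡ = sbit-encΓ ; st₀≡ = refl ; qy≡ = refl ; qn≡ = refl }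
    where
    δ-cong : ∀ {s s′ a a′ b b′} → s ≡ s′ → a ≡ a′ → b ≡ b′ → δM s a b ≡ δM s′ a′ b′
    δ-cong refl refl refl = refl

  initial-compiled : ∀ O x → ConfR compile-encodes O
    (zc st₀ ([] ◂ map bit x) ([] ◂ [])) (Run.initial compile x)
  initial-compiled O x = initial-R compile-encodes O x (map bit x) (go x)
    where
    go : ∀ x → map encΓ (map bit x) ≡ map encBit x
    go []      = refl
    go (b ∷ x) = cong (encBit b ∷_) (go x)

-- A block of polynomial length

-- A colour is a suffix of an instruction list. A cell of colour emit b ∷ is gets mark b and
-- appends one cell of colour is; one of colour times ∷ is gets mark false and appends as
-- many cells of colour is as the input is long.
data Instr : Set where
  emit  : Bool → Instr
  times : Instr

data Color : List Instr → Set where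
  now   : ∀ {is} → Color is
  later : ∀ {i is} → Color is → Color (i ∷ is)

suffix : ∀ {is} → Color is → List Instr
suffix {is} now  = is
suffix (later c) = suffix c

advance : ∀ {is} → Color is → Color is
advance {[]}     now       = now
advance {i ∷ is} now       = later now
advance          (later c) = later (advance c)

suffix-advance : ∀ {is} (c : Color is) → suffix (advance c) ≡ tl (suffix c)
suffix-advance {[]}     now       = refl
suffix-advance {i ∷ is} now       = refl
suffix-advance          (later c) = suffix-advance c

fin-Color : ∀ is → Finite (Color is)
fin-Color []       = record { elems = now ∷ [] ; complete = λ { now → here refl } }
fin-Color (i ∷ is) = record
  { elems    = now ∷ map later (elems (fin-Color is))
  ; complete = λ { now → here refl ; (later c) → there (∈-map⁺ later (complete (fin-Color is) c)) } }

cellCount : ℕ → List Instr → ℕ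
cellCount n []            = 1
cellCount n (emit b ∷ is) = 1 + cellCount n is
cellCount n (times ∷ is)  = 1 + n * cellCount n is

b→ℕ : Bool → ℕ
b→ℕ true  = 1
b→ℕ false = 0

markCount : ℕ → List Instr → ℕ
markCount n []            = 0
markCount n (emit b ∷ is) = b→ℕ b + markCount n is
markCount n (times ∷ is)  = n * markCount n is

trues : List Bool → ℕ
trues []       = 0
trues (b ∷ bs) = b→ℕ b + trues bs

trues-ʳ++ : ∀ xs ys → trues (xs ʳ++ ys) ≡ trues xs + trues ys
trues-ʳ++ []       ys = refl
trues-ʳ++ (x ∷ xs) ys = trans (trues-ʳ++ xs (x ∷ ys)) (lem (trues xs) (b→ℕ x) (trues ys))
  where
  lem : ∀ a b c → a + (b + c) ≡ b + a + c
  lem = solve-∀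

nth : ∀ {A : Set} → List A → ℕ → Maybe A
nth []       i       = nothing
nth (a ∷ as) zero    = just a
nth (a ∷ as) (suc i) = nth as i

-- `owork` marks the origin of the work tape and keeps the symbol it replaced, `lend` is the left
-- end of the block, `pend` an unprocessed cell and `mk` a finished one; `core` belongs to the
-- machine that runs afterwards.
data Cell (X : Set) (is₁ is₂ : List Instr) : Set where
  owork : Maybe Bool → Cell X is₁ is₂
  lend  : Cell X is₁ is₂
  pend  : Color is₁ ⊎ Color is₂ → Cell X is₁ is₂
  mk    : Bool → Cell X is₁ is₂
  core  : X → Cell X is₁ is₂

fin-Cell : ∀ {X} is₁ is₂ → Finite X → Finite (Cell X is₁ is₂)
fin-Cell is₁ is₂ fx = fin-retract
  (fin-Maybe fin-Bool fin⊎ fin-⊤ fin⊎ (fin-Color is₁ fin⊎ fin-Color is₂) fin⊎ fin-Bool fin⊎ fx)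
  (λ { (inj₁ m) → owork m ; (inj₂ (inj₁ _)) → lend ; (inj₂ (inj₂ (inj₁ c))) → pend c
     ; (inj₂ (inj₂ (inj₂ (inj₁ b)))) → mk b ; (inj₂ (inj₂ (inj₂ (inj₂ x)))) → core x })
  (λ { (owork m) → inj₁ m ; lend → inj₂ (inj₁ tt) ; (pend c) → inj₂ (inj₂ (inj₁ c))
     ; (mk b) → inj₂ (inj₂ (inj₂ (inj₁ b))) ; (core x) → inj₂ (inj₂ (inj₂ (inj₂ x))) })
  (λ { (owork m) → refl ; lend → refl ; (pend c) → refl ; (mk b) → refl ; (core x) → refl })

-- main visits the first unprocessed cell; go1 and goN walk to the end of the block, loopN
-- appends while sweeping the input, backW and backO return, and rew goes back to the start.
data Pre (C : Set) : Set where
  s0 i1 i2 main backW backO rew : Pre C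
  go1 goN loopN : C → Pre C

fin-Pre : ∀ {C} → Finite C → Finite (Pre C)
fin-Pre fc = fin-retract (fin-Fin 7 fin⊎ fc fin⊎ fc fin⊎ fc)
  (λ { (inj₁ zero) → s0 ; (inj₁ (suc zero)) → i1 ; (inj₁ (suc (suc zero))) → i2
     ; (inj₁ (suc (suc (suc zero)))) → main ; (inj₁ (suc (suc (suc (suc zero))))) → backW
     ; (inj₁ (suc (suc (suc (suc (suc zero)))))) → backO
     ; (inj₁ (suc (suc (suc (suc (suc (suc zero))))))) → rew
     ; (inj₂ (inj₁ c)) → go1 c ; (inj₂ (inj₂ (inj₁ c))) → goN c ; (inj₂ (inj₂ (inj₂ c))) → loopN c })
  (λ { s0 → inj₁ zero ; i1 → inj₁ (suc zero) ; i2 → inj₁ (suc (suc zero))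
     ; main → inj₁ (suc (suc (suc zero))) ; backW → inj₁ (suc (suc (suc (suc zero))))
     ; backO → inj₁ (suc (suc (suc (suc (suc zero)))))
     ; rew → inj₁ (suc (suc (suc (suc (suc (suc zero))))))
     ; (go1 c) → inj₂ (inj₁ c) ; (goN c) → inj₂ (inj₂ (inj₁ c)) ; (loopN c) → inj₂ (inj₂ (inj₂ c)) })
  (λ { s0 → refl ; i1 → refl ; i2 → refl ; main → refl ; backW → refl ; backO → refl ; rew → refl
     ; (go1 c) → refl ; (goN c) → refl ; (loopN c) → refl })

-- A machine whose work starts once the block is there; `program` puts the block construction in
-- front. Two instruction lists allow one block to hold two polynomials, for instance one counted by
-- marks and one by length.
record Core : Set₁ where
  field
    X CSt    : Set
    fin-X    : Finite X
    fin-CSt  : Finite CSt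
    q₀       : Quant
    is₁ is₂  : List Instr
    kindC    : CSt → Kind
    c₀ cy cn : CSt
    δC       : CSt → Γ (Cell X is₁ is₂) → Γ (Cell X is₁ is₂) →
               List (CSt × Γ (Cell X is₁ is₂) × Move × Γ (Cell X is₁ is₂) × Move)

  G : Set
  G = Γ (Cell X is₁ is₂)

  C : Set
  C = Color is₁ ⊎ Color is₂

  instrs : C → List Instr
  instrs (inj₁ c) = suffix c
  instrs (inj₂ c) = suffix c

  adv : C → C
  adv (inj₁ c) = inj₁ (advance c)
  adv (inj₂ c) = inj₂ (advance c)

  instrs-adv : ∀ c → instrs (adv c) ≡ tl (instrs c)
  instrs-adv (inj₁ c) = suffix-advance c
  instrs-adv (inj₂ c) = suffix-advance c

  PreStep : Set
  PreStep = (Pre C ⊎ CSt) × G × Move × G × Move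

  origin : G → G
  origin (bit b) = ext (owork (just b))
  origin _       = ext (owork nothing)

  process : G → C → List Instr → PreStep
  process a c []           = inj₁ main , a , S , ext (mk false) , R
  process a c (emit b ∷ _) = inj₁ (go1 (adv c)) , a , S , ext (mk b) , R
  process a c (times ∷ _)  = inj₁ (goN (adv c)) , a , S , ext (mk false) , R

  δP : Pre C → G → G → PreStep
  δP s0 a b = inj₁ i1 , origin a , S , ext lend , R
  δP i1 a b = inj₁ i2 , a , S , ext (pend (inj₁ now)) , R
  δP i2 a b = inj₁ main , a , S , ext (pend (inj₂ now)) , L
  δP main a (ext (pend c)) = process a c (instrs c)
  δP main a b = inj₁ rew , a , S , b , L
  δP (go1 c) a (ext b) = inj₁ (go1 c) , a , S , ext b , R
  δP (go1 c) a b       = inj₁ backO , a , S , ext (pend c) , L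
  δP (goN c) a (ext b) = inj₁ (goN c) , a , S , ext b , R
  δP (goN c) a b       = inj₁ (loopN c) , a , S , b , S
  -- An origin that kept no symbol means that the input is empty, so nothing is appended.
  δP (loopN c) (ext (owork nothing)) b = inj₁ backO , ext (owork nothing) , S , b , L
  δP (loopN c) □ b = inj₁ backW , □ , L , b , S
  δP (loopN c) a b = inj₁ (loopN c) , a , R , ext (pend c) , R
  δP backW (ext a) b = inj₁ backO , ext a , S , b , L
  δP backW a b       = inj₁ backW , a , L , b , S
  δP backO a (ext (mk b)) = inj₁ main , a , S , ext (mk b) , R
  δP backO a b            = inj₁ backO , a , S , b , L
  δP rew a (ext (mk b)) = inj₁ rew , a , S , ext (mk b) , L
  δP rew a b            = inj₂ c₀ , a , S , b , R

  program : Program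
  program = record
    { St = Pre C ⊎ CSt ; E = Cell X is₁ is₂
    ; fin-St = fin-Pre (fin-Color is₁ fin⊎ fin-Color is₂) fin⊎ fin-CSt
    ; fin-E = fin-Cell is₁ is₂ fin-X
    ; kindM = λ { (inj₁ _) → quant q₀ ; (inj₂ s) → kindC s }
    ; st₀ = inj₁ s0 ; qy = inj₂ cy ; qn = inj₂ cn
    ; δM = λ { (inj₁ s) a b → δP s a b ∷ []
             ; (inj₂ s) a b → map (λ (s , t) → inj₂ s , t) (δC s a b) } }

  open Program program using (machine) public
  open Machine machine using (ZConf; rd; hd; read; zstep; zsys) public

-- Correctness of the block construction

module Prelude (K : Core) (O : Lang) where
  open Core K

  private
    Y : Sys
    Y = zsys O

  pre : Pre C → Tape G → Tape G → ZConf
  pre s = zc (inj₁ s)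

  Blanks : List G → Set
  Blanks ts = ∀ i → rd ts i ≡ □

  blanks-tl : ∀ {ts} → Blanks ts → Blanks (tl ts)
  blanks-tl {ts} h i = trans (rd-tl □ ts i) (h (suc i))

  blanks-□ : ∀ {ts} → Blanks ts → Blanks (□ ∷ tl ts)
  blanks-□ {ts} h zero    = refl
  blanks-□ {ts} h (suc i) = blanks-tl {ts} h i

  pstep : ∀ s {a b w o n d} → read w ≡ a → read o ≡ b →
          Reach Y q₀ n (zstep (pre s w o) (δP s a b)) d → Reach Y q₀ (suc n) (pre s w o) d
  pstep s refl refl g = step refl refl g

  ps : List C → List G
  ps = map (ext ∘ pend)

  module _ {a : G} {wr : List G} where
    private
      W : Tape G
      W = [] ◂ a ∷ wr

    walk1 : ∀ c cs {ol ts} → Reach Y q₀ (length cs) (pre (go1 c) W (ol ◂ ps cs ++ ts)) (pre (go1 c) W (ps cs ʳ++ ol ◂ ts))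
    walk1 c []        = done
    walk1 c (c′ ∷ cs) = step refl refl (walk1 c cs)

    walkN : ∀ c cs {ol ts} → Reach Y q₀ (length cs) (pre (goN c) W (ol ◂ ps cs ++ ts)) (pre (goN c) W (ps cs ʳ++ ol ◂ ts))
    walkN c []        = done
    walkN c (c′ ∷ cs) = step refl refl (walkN c cs)

    -- The marked cells form a prefix of the block, so the first marked cell met on the way
    -- back is the one just processed.
    back : ∀ ds h {b ol or} → Reach Y q₀ (length ds + 1)
           (pre backO W (put h L (ps ds ++ ext (mk b) ∷ ol ◂ or)))
           (pre main W (ext (mk b) ∷ ol ◂ ps ds ʳ++ (h ∷ tl or)))
    back []       h      = step refl refl done
    back (d ∷ ds) h {or = or} = step refl refl (back ds (ext (pend d)) {or = ext (pend d) ∷ h ∷ tl or})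

    private
      ps-reverse : ∀ cs ys → ps cs ʳ++ ys ≡ ps (reverse cs) ++ ys
      ps-reverse cs ys = trans (ʳ++-defn (ps cs)) (cong (_++ ys) (sym (reverse-map (ext ∘ pend) cs)))

    returns : ∀ cs h {b ol or} → Reach Y q₀ (length cs + 1)
              (pre backO W (put h L (ps cs ʳ++ (ext (mk b) ∷ ol) ◂ or)))
              (pre main W (ext (mk b) ∷ ol ◂ ps cs ++ h ∷ tl or))
    returns cs h {b} {ol} {or} = subst₂ (Reach Y q₀ _)
      (cong (λ z → pre backO W (put h L (z ◂ or))) (sym (ps-reverse cs _)))
      (cong (λ z → pre main W (ext (mk b) ∷ ol ◂ z))
        (trans (ps-reverse (reverse cs) _) (cong (λ z → ps z ++ h ∷ tl or) (reverse-involutive cs))))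
      (reach-cong (cong (_+ 1) (length-reverse cs)) refl refl (back (reverse cs) h))

  loopBits : ∀ c x {wl tw ol ts} → Blanks ts → Σ (List G) λ ts′ → Blanks ts′ × Reach Y q₀ (length x)
             (pre (loopN c) (wl ◂ map bit x ++ tw) (ol ◂ ts))
             (pre (loopN c) (map bit x ʳ++ wl ◂ tw) (ps (replicate (length x) c) ʳ++ ol ◂ ts′))
  loopBits c []      h = _ , h , done
  loopBits c (y ∷ x) {ts = ts} h with loopBits c x (blanks-tl {ts} h)
  ... | ts′ , h′ , g = ts′ , h′ , step refl refl g

  backBits : ∀ ds h {m wr ol b or} → Reach Y q₀ (length ds + 1)
             (pre backW (put h L (map bit ds ++ ext (owork m) ∷ [] ◂ wr)) (ol ◂ b ∷ or))
             (pre backO ([] ◂ ext (owork m) ∷ map bit ds ʳ++ (h ∷ tl wr)) (put b L (ol ◂ b ∷ or)))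
  backBits []       h = step refl refl done
  backBits (d ∷ ds) h {wr = wr} = step refl refl (backBits ds (bit d) {wr = bit d ∷ h ∷ tl wr})

  raw : Maybe Bool → G
  raw nothing  = □
  raw (just b) = bit b

  cellAt : Str → ℕ → G
  cellAt x zero    = ext (owork (nth x 0))
  cellAt x (suc i) = raw (nth x (suc i))

  wcells : Str → List G
  wcells x = ext (owork (nth x 0)) ∷ map bit (tl x)

  rd-wcells : ∀ x tw → Blanks tw → ∀ i → rd (wcells x ++ tw) i ≡ cellAt x i
  rd-wcells []      tw h zero    = refl
  rd-wcells []      tw h (suc i) = h i
  rd-wcells (b ∷ x) tw h zero    = refl
  rd-wcells (b ∷ x) tw h (suc i) = go x i
    where
    go : ∀ x i → rd (map bit x ++ tw) i ≡ raw (nth x i)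
    go []      i       = h i
    go (c ∷ x) zero    = refl
    go (c ∷ x) (suc i) = go x i

  sumBy : (List Instr → ℕ) → List C → ℕ
  sumBy f []       = 0
  sumBy f (c ∷ cs) = f (instrs c) + sumBy f cs

  sumBy-++ : ∀ f cs ds → sumBy f (cs ++ ds) ≡ sumBy f cs + sumBy f ds
  sumBy-++ f []       ds = refl
  sumBy-++ f (c ∷ cs) ds = trans (cong (f (instrs c) +_) (sumBy-++ f cs ds)) (sym (ℕ.+-assoc (f (instrs c)) _ _))

  sumBy-replicate : ∀ f k c → sumBy f (replicate k c) ≡ k * f (instrs c)
  sumBy-replicate f zero    c = refl
  sumBy-replicate f (suc k) c = cong (f (instrs c) +_) (sumBy-replicate f k c)

  marks : List Bool → List G
  marks = map (ext ∘ mk)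

  module Building (x : Str) where

    private
      k : ℕ
      k = length x

    mainAt : List Bool → List C → List G → List G → ZConf
    mainAt ms cs ts tw = pre main ([] ◂ wcells x ++ tw) (marks ms ++ ext lend ∷ [] ◂ ps cs ++ ts)

    -- One round of the main loop. `cells≡` and `marks≡` are conservation laws: a pending cell
    -- counts for all the cells, or marks, that it will finally give rise to.
    record Item (c : C) (cs : List C) (ms : List Bool) (ts tw : List G) : Set where
      constructor item
      field
        mark    : Bool
        new     : List C
        ts′ tw′ : List G
        blankt  : Blanks ts′
        blankw  : Blanks tw′
        cells≡  : 1 + sumBy (cellCount k) new ≡ cellCount k (instrs c)
        marks≡  : b→ℕ mark + sumBy (markCount k) new ≡ markCount k (instrs c)
        reach   : Reach Y q₀ (2 * length cs + 3 * k + 8) (mainAt ms (c ∷ cs) ts tw) (mainAt (mark ∷ ms) (cs ++ new) ts′ tw′)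

    private
      bits-reverse : ∀ z {ys : List G} → map bit z ʳ++ ys ≡ map bit (reverse z) ++ ys
      bits-reverse z {ys} = trans (ʳ++-defn (map bit z)) (cong (_++ ys) (sym (reverse-map bit z)))

      ps-snoc : ∀ cs c ts → ps cs ++ ext (pend c) ∷ ts ≡ ps (cs ++ c ∷ []) ++ ts
      ps-snoc []        c ts = refl
      ps-snoc (c′ ∷ cs) c ts = cong (ext (pend c′) ∷_) (ps-snoc cs c ts)

      appendOne : ∀ c cs {a wr ol b} ts → Blanks ts → Reach Y q₀ (2 * length cs + 2)
        (pre (go1 c) ([] ◂ a ∷ wr) (ext (mk b) ∷ ol ◂ ps cs ++ ts))
        (pre main ([] ◂ a ∷ wr) (ext (mk b) ∷ ol ◂ ps (cs ++ c ∷ []) ++ tl ts))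
      appendOne c cs {a} {wr} {ol} {b} ts h = reach-cong refl refl
        (cong (λ z → pre main ([] ◂ a ∷ wr) (ext (mk b) ∷ ol ◂ z)) (ps-snoc cs c (tl ts)))
        (reach-mono (ℕ.≤-reflexive (lem (length cs)))
          (walk1 c cs ⨟ pstep (go1 c) refl (h 0) (returns cs (ext (pend c)))))
        where
        lem : ∀ n → n + suc (n + 1) ≡ 2 * n + 2
        lem = solve-∀

      appendMany : ∀ x c cs {ol b} ts tw → Blanks ts → Blanks tw →
        Σ (List G) λ ts′ → Σ (List G) λ tw′ → Blanks ts′ × Blanks tw′ × Reach Y q₀ (2 * length cs + 3 * length x + 7)
          (pre (goN c) ([] ◂ wcells x ++ tw) (ext (mk b) ∷ ol ◂ ps cs ++ ts))
          (pre main ([] ◂ wcells x ++ tw′) (ext (mk b) ∷ ol ◂ ps (cs ++ replicate (length x) c) ++ ts′))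
      appendMany [] c cs {ol} {b} ts tw ht hw = □ ∷ tl ts , tw , blanks-□ {ts} ht , hw ,
        reach-cong refl refl (cong (λ z → pre main _ (ext (mk b) ∷ ol ◂ ps z ++ □ ∷ tl ts)) (sym (++-identityʳ cs)))
          (reach-mono (≤-split (lem (length cs)))
            (walkN c cs ⨟ pstep (goN c) refl (ht 0) (step refl refl (returns cs □ {or = □ ∷ tl ts}))))
        where
        lem : ∀ n → 2 * n + 0 + 7 ≡ n + suc (suc (n + 1)) + 4
        lem = solve-∀
      appendMany (y ∷ x) c cs {ol} {b} ts tw ht hw with loopBits c x {ext (owork (just y)) ∷ []} {tw}
        {ext (pend c) ∷ ps cs ʳ++ (ext (mk b) ∷ ol)} {tl ts} (blanks-tl {ts} ht)
      ... | ts′ , ht′ , g = □ ∷ tl ts′ , □ ∷ tl tw , blanks-□ {ts′} ht′ , blanks-□ {tw} hw ,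
        (reach-mono (≤-split (lem (length cs) (length x)))
            (walkN c cs ⨟ pstep (goN c) refl (ht 0) (step refl refl
              (g ⨟ pstep (loopN c) (hw 0) (ht′ 0) (back-work ⨟
                subst (λ z → Reach Y q₀ (length cs + suc (length x) + 1)
                               (pre backO ([] ◂ wcells (y ∷ x) ++ □ ∷ tl tw) (put □ L (z ◂ □ ∷ tl ts′))) target)
                  (sym (olist (length x)))
                  (subst (λ n → Reach Y q₀ (n + 1) start target) len (returns (cs ++ new) □ {or = □ ∷ tl ts′})))))))
        where
        new = replicate (suc (length x)) c
        start = pre backO ([] ◂ wcells (y ∷ x) ++ □ ∷ tl tw) (put □ L (ps (cs ++ new) ʳ++ (ext (mk b) ∷ ol) ◂ □ ∷ tl ts′))
        target = pre main ([] ◂ wcells (y ∷ x) ++ □ ∷ tl tw) (ext (mk b) ∷ ol ◂ ps (cs ++ new) ++ □ ∷ tl ts′)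
        len : length (cs ++ new) ≡ length cs + suc (length x)
        len = trans (length-++ cs) (cong (length cs +_) (length-replicate (suc (length x))))
        olist : ∀ n → ps (replicate n c) ʳ++ (ext (pend c) ∷ ps cs ʳ++ (ext (mk b) ∷ ol)) ≡
                      ps (cs ++ replicate (suc n) c) ʳ++ (ext (mk b) ∷ ol)
        olist n = sym (trans (cong (_ʳ++ (ext (mk b) ∷ ol)) (map-++ (ext ∘ pend) cs (replicate (suc n) c)))
                             (++-ʳ++ (ps cs)))
        back-work : Reach Y q₀ (length x + 1)
          (pre backW (put □ L (map bit x ʳ++ (ext (owork (just y)) ∷ []) ◂ tw)) (ps (replicate (length x) c) ʳ++ (ext (pend c) ∷ ps cs ʳ++ (ext (mk b) ∷ ol)) ◂ □ ∷ tl ts′))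
          (pre backO ([] ◂ wcells (y ∷ x) ++ □ ∷ tl tw) (put □ L (ps (replicate (length x) c) ʳ++ (ext (pend c) ∷ ps cs ʳ++ (ext (mk b) ∷ ol)) ◂ □ ∷ tl ts′)))
        back-work = subst₂ (λ u v → Reach Y q₀ (length x + 1) (pre backW (put □ L (u ◂ tw)) _) (pre backO ([] ◂ ext (owork (just y)) ∷ v) _))
          (sym (bits-reverse x)) (trans (bits-reverse (reverse x)) (cong (λ z → map bit z ++ □ ∷ tl tw) (reverse-involutive x)))
          (reach-cong (cong (_+ 1) (length-reverse x)) refl refl (backBits (reverse x) □ {wr = tw}))
        lem : ∀ n m → 2 * n + 3 * (1 + m) + 7 ≡ n + suc (suc (m + suc (m + 1 + (n + suc m + 1)))) + 4
        lem = solve-∀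

      first : ∀ c cs ms ts tw {is n d} → instrs c ≡ is →
              Reach Y q₀ n (zstep (mainAt ms (c ∷ cs) ts tw) (process (ext (owork (nth x 0))) c is)) d →
              Reach Y q₀ (suc n) (mainAt ms (c ∷ cs) ts tw) d
      first c cs ms ts tw refl g = step refl refl g

    itemStep : ∀ c cs ms ts tw → Blanks ts → Blanks tw → Item c cs ms ts tw
    itemStep c cs ms ts tw ht hw with instrs c in e
    ... | [] = item false [] ts tw ht hw (cong (cellCount k) (sym e)) (cong (markCount k) (sym e))
      (subst (λ z → Reach Y q₀ (2 * length cs + 3 * k + 8) (mainAt ms (c ∷ cs) ts tw) (mainAt (false ∷ ms) z ts tw)) (sym (++-identityʳ cs))
        (reach-mono (ℕ.≤-trans (s≤s z≤n) (ℕ.m≤n+m 8 (2 * length cs + 3 * k))) (first c cs ms ts tw e (done {n = 0}))))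
    ... | emit b ∷ is = item b (adv c ∷ []) (tl ts) tw (blanks-tl {ts} ht) hw
      (trans (cong (λ z → 1 + (cellCount k z + 0)) adv≡) (trans (cong suc (ℕ.+-identityʳ _)) (cong (cellCount k) (sym e))))
      (trans (cong (λ z → b→ℕ b + (markCount k z + 0)) adv≡) (trans (cong (b→ℕ b +_) (ℕ.+-identityʳ _)) (cong (markCount k) (sym e))))
      (reach-mono (≤-split (lem (length cs) k)) (first c cs ms ts tw e (appendOne (adv c) cs ts ht)))
      where
      adv≡ : instrs (adv c) ≡ is
      adv≡ = trans (instrs-adv c) (cong tl e)
      lem : ∀ n k → 2 * n + 3 * k + 8 ≡ suc (2 * n + 2) + (3 * k + 5)
      lem = solve-∀
    ... | times ∷ is with appendMany x (adv c) cs {ol = marks ms ++ ext lend ∷ []} {b = false} ts tw ht hw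
    ... | ts′ , tw′ , ht′ , hw′ , g = item false (replicate k (adv c)) ts′ tw′ ht′ hw′
      (trans (cong suc (trans (sumBy-replicate (cellCount k) k (adv c)) (cong (λ z → k * cellCount k z) adv≡))) (cong (cellCount k) (sym e)))
      (trans (trans (sumBy-replicate (markCount k) k (adv c)) (cong (λ z → k * markCount k z) adv≡)) (cong (markCount k) (sym e)))
      (reach-mono (ℕ.≤-reflexive (lem (length cs) k)) (first c cs ms ts tw e g))
      where
      adv≡ : instrs (adv c) ≡ is
      adv≡ = trans (instrs-adv c) (cong tl e)
      lem : ∀ n k → suc (2 * n + 3 * k + 7) ≡ 2 * n + 3 * k + 8
      lem = solve-∀

    private
      cellCount-pos : ∀ is → 1 ≤ cellCount k is
      cellCount-pos []            = s≤s z≤n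
      cellCount-pos (emit b ∷ is) = s≤s z≤n
      cellCount-pos (times ∷ is)  = s≤s z≤n

      length≤cells : ∀ cs → length cs ≤ sumBy (cellCount k) cs
      length≤cells []       = z≤n
      length≤cells (c ∷ cs) = ℕ.+-mono-≤ (cellCount-pos (instrs c)) (length≤cells cs)

    record Built (cs : List C) (ms : List Bool) (ts tw : List G) (cost : ℕ) : Set where
      constructor built
      field
        out     : List Bool
        ts′ tw′ : List G
        blankt  : Blanks ts′
        blankw  : Blanks tw′
        cells≡  : length out ≡ sumBy (cellCount k) cs + length ms
        marks≡  : trues out ≡ sumBy (markCount k) cs + trues ms
        reach   : Reach Y q₀ cost (mainAt ms cs ts tw) (mainAt out [] ts′ tw′)

    -- The fuel is the number of cells still to be finished and drops by one per item. `B` stays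
    -- fixed and bounds the length of the queue, hence the cost of each item.
    build : ∀ fuel B cs ms ts tw → sumBy (cellCount k) cs ≡ fuel → fuel ≤ B → Blanks ts → Blanks tw →
            Built cs ms ts tw (fuel * (2 * B + 3 * k + 8))
    build fuel B [] ms ts tw e le ht hw = built ms ts tw ht hw refl refl done
    build zero B (c ∷ cs) ms ts tw e le ht hw
      with () ← ℕ.≤-trans (cellCount-pos (instrs c)) (ℕ.≤-trans (ℕ.m≤m+n _ _) (ℕ.≤-reflexive e))
    build (suc fuel) B (c ∷ cs) ms ts tw e le ht hw with itemStep c cs ms ts tw ht hw
    ... | item mark new ts₁ tw₁ ht₁ hw₁ cells₁ marks₁ g₁
      with build fuel B (cs ++ new) (mark ∷ ms) ts₁ tw₁
             (ℕ.suc-injective (trans (move (cellCount k) 1 cells₁) e)) (ℕ.≤-trans (ℕ.n≤1+n fuel) le) ht₁ hw₁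
      where
      move : ∀ f j → j + sumBy f new ≡ f (instrs c) → j + sumBy f (cs ++ new) ≡ sumBy f (c ∷ cs)
      move f j h = trans (cong (j +_) (sumBy-++ f cs new)) (trans (lem j (sumBy f cs) (sumBy f new)) (cong (_+ sumBy f cs) h))
        where
        lem : ∀ a b c → a + (b + c) ≡ a + c + b
        lem = solve-∀
    ... | built out ts₂ tw₂ ht₂ hw₂ cells₂ marks₂ g₂ = built out ts₂ tw₂ ht₂ hw₂
      (trans cells₂ (count (cellCount k) 1 (length ms) cells₁))
      (trans marks₂ (count (markCount k) (b→ℕ mark) (trues ms) marks₁))
      (reach-mono (ℕ.+-monoˡ-≤ _ (ℕ.+-monoˡ-≤ 8 (ℕ.+-monoˡ-≤ (3 * k) (ℕ.*-monoʳ-≤ 2 cs≤)))) (g₁ ⨟ g₂))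
      where
      cs≤ : length cs ≤ B
      cs≤ = ℕ.≤-trans (length≤cells cs) (ℕ.≤-trans (ℕ.m≤n+m _ (cellCount k (instrs c))) (ℕ.≤-trans (ℕ.≤-reflexive e) le))
      count : ∀ f j l → j + sumBy f new ≡ f (instrs c) → sumBy f (cs ++ new) + (j + l) ≡ sumBy f (c ∷ cs) + l
      count f j l h = trans (cong (_+ (j + l)) (sumBy-++ f cs new))
        (trans (lem (sumBy f cs) (sumBy f new) j l) (cong (λ z → z + sumBy f cs + l) h))
        where
        lem : ∀ a b j l → a + b + (j + l) ≡ j + b + a + l
        lem = solve-∀

  rewind : ∀ ms h {a wr or} → Reach Y q₀ (length ms + 1)
           (pre rew ([] ◂ a ∷ wr) (put h L (marks ms ++ ext lend ∷ [] ◂ or)))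
           (zc (inj₂ c₀) ([] ◂ a ∷ wr) (ext lend ∷ [] ◂ marks ms ʳ++ (h ∷ tl or)))
  rewind []       h      = step refl refl done
  rewind (m ∷ ms) h {or = or} = step refl refl (rewind ms (ext (mk m)) {or = ext (mk m) ∷ h ∷ tl or})

  blockLength : Str → ℕ
  blockLength x = cellCount (length x) is₁ + cellCount (length x) is₂

  preTime : Str → ℕ
  preTime x = 3 + (blockLength x * (2 * blockLength x + 3 * length x + 8) + (1 + (blockLength x + 1)))

  record Prepared (x : Str) : Set where
    field
      ms     : List Bool
      r ts   : List G
      cells≡ : length ms ≡ blockLength x
      marks≡ : trues ms ≡ markCount (length x) is₁ + markCount (length x) is₂
      input  : ∀ i → rd r i ≡ cellAt x i
      blanks : Blanks ts
      reach  : Reach Y q₀ (preTime x) (zc (inj₁ s0) ([] ◂ map bit x) ([] ◂ []))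
                                      (zc (inj₂ c₀) ([] ◂ r) (ext lend ∷ [] ◂ marks ms ++ ts))

  abstract
    prepare : ∀ x → Prepared x
    prepare x with Building.build x (blockLength x) (blockLength x) (inj₁ now ∷ inj₂ now ∷ []) [] [] []
                     (cong (cellCount (length x) is₁ +_) (ℕ.+-identityʳ _)) ℕ.≤-refl (λ _ → refl) (λ _ → refl)
    ... | Building.built out ts tw ht hw cells marks′ g = record
      { ms = reverse out ; r = wcells x ++ tw ; ts = □ ∷ tl ts
      ; cells≡ = trans (length-reverse out) (trans cells (trans (ℕ.+-identityʳ _) (cong (cellCount (length x) is₁ +_) (ℕ.+-identityʳ _))))
      ; marks≡ = trans (trans (cong trues (sym (ʳ++-self out))) (trans (trues-ʳ++ out []) (ℕ.+-identityʳ _)))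
                       (trans marks′ (trans (ℕ.+-identityʳ _) (cong (markCount (length x) is₁ +_) (ℕ.+-identityʳ _))))
      ; input = rd-wcells x tw hw
      ; blanks = blanks-□ {ts} ht
      ; reach = go x (g ⨟ end) }
      where
      ʳ++-self : ∀ (xs : List Bool) → xs ʳ++ [] ≡ reverse xs
      ʳ++-self xs = trans (ʳ++-defn xs) (++-identityʳ (reverse xs))
      target : ZConf
      target = zc (inj₂ c₀) ([] ◂ wcells x ++ tw) (ext lend ∷ [] ◂ marks (reverse out) ++ □ ∷ tl ts)
      end : Reach Y q₀ (1 + (blockLength x + 1)) (Building.mainAt x out [] ts tw) target
      end = pstep main refl (ht 0)
        (subst₂ (λ n z → Reach Y q₀ (n + 1) (pre rew ([] ◂ wcells x ++ tw) (put □ L (marks out ++ ext lend ∷ [] ◂ ts))) (zc (inj₂ c₀) ([] ◂ wcells x ++ tw) (ext lend ∷ [] ◂ z)))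
          (trans cells (trans (ℕ.+-identityʳ _) (cong (cellCount (length x) is₁ +_) (ℕ.+-identityʳ _))))
          (trans (ʳ++-defn (marks out)) (cong (_++ □ ∷ tl ts) (sym (reverse-map (ext ∘ mk) out))))
          (rewind out □ {or = ts}))
      go : ∀ x {n d} → Reach Y q₀ n (Building.mainAt x [] (inj₁ now ∷ inj₂ now ∷ []) [] []) d →
           Reach Y q₀ (3 + n) (zc (inj₁ s0) ([] ◂ map bit x) ([] ◂ [])) d
      go []      h = step refl refl (step refl refl (step refl refl h))
      go (b ∷ x) {d = d} h = step refl refl (step refl refl (step refl refl
        (subst (λ z → Reach Y q₀ _ (pre main ([] ◂ ext (owork (just b)) ∷ z) _) d) (++-identityʳ (map bit x)) h)))

-- Polynomial and exponential bounds

-- Horner's scheme: `c` emissions, then an n-fold branching into the remaining coefficients. With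
-- `true` the marks count the value; with `false` only the length of the block is of interest.
instrsOf : Bool → Poly → List Instr
instrsOf b []       = []
instrsOf b (c ∷ cs) = replicate c (emit b) ++ times ∷ instrsOf b cs

-- Each `times` cell and each final cell takes up room without being marked, whence the added ones.
cellPoly : Poly → Poly
cellPoly []       = 1 ∷ []
cellPoly (c ∷ cs) = suc c ∷ cellPoly cs

cellCount-instrsOf : ∀ b p n → cellCount n (instrsOf b p) ≡ eval (cellPoly p) n
cellCount-instrsOf b []       n = cong suc (sym (ℕ.*-zeroʳ n))
cellCount-instrsOf b (c ∷ cs) n = go c
  where
  go : ∀ c → cellCount n (replicate c (emit b) ++ times ∷ instrsOf b cs) ≡ suc c + n * eval (cellPoly cs) n
  go zero    = cong (λ z → suc (n * z)) (cellCount-instrsOf b cs n)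
  go (suc c) = cong suc (go c)

markCount-true : ∀ p n → markCount n (instrsOf true p) ≡ eval p n
markCount-true []       n = refl
markCount-true (c ∷ cs) n = go c
  where
  go : ∀ c → markCount n (replicate c (emit true) ++ times ∷ instrsOf true cs) ≡ c + n * eval cs n
  go zero    = cong (n *_) (markCount-true cs n)
  go (suc c) = cong suc (go c)

markCount-false : ∀ p n → markCount n (instrsOf false p) ≡ 0
markCount-false []       n = refl
markCount-false (c ∷ cs) n = go c
  where
  go : ∀ c → markCount n (replicate c (emit false) ++ times ∷ instrsOf false cs) ≡ 0
  go zero    = trans (cong (n *_) (markCount-false cs n)) (ℕ.*-zeroʳ n)
  go (suc c) = go c

eval<cellPoly : ∀ p n → eval p n < eval (cellPoly p) n
eval<cellPoly []       n = s≤s z≤n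
eval<cellPoly (c ∷ cs) n = s≤s (ℕ.+-monoʳ-≤ c (ℕ.*-monoʳ-≤ n (ℕ.<⇒≤ (eval<cellPoly cs n))))

addP : Poly → Poly → Poly
addP []       ds       = ds
addP (c ∷ cs) []       = c ∷ cs
addP (c ∷ cs) (d ∷ ds) = c + d ∷ addP cs ds

scaleP : ℕ → Poly → Poly
scaleP k = map (k *_)

mulP : Poly → Poly → Poly
mulP []       ds = []
mulP (c ∷ cs) ds = addP (scaleP c ds) (0 ∷ mulP cs ds)

eval-addP : ∀ p q n → eval (addP p q) n ≡ eval p n + eval q n
eval-addP []       ds       n = refl
eval-addP (c ∷ cs) []       n = sym (ℕ.+-identityʳ _)
eval-addP (c ∷ cs) (d ∷ ds) n =
  trans (cong (λ z → c + d + n * z) (eval-addP cs ds n)) (lem c d n (eval cs n) (eval ds n))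
  where
  lem : ∀ c d n u v → c + d + n * (u + v) ≡ c + n * u + (d + n * v)
  lem = solve-∀

eval-scaleP : ∀ k p n → eval (scaleP k p) n ≡ k * eval p n
eval-scaleP k []       n = sym (ℕ.*-zeroʳ k)
eval-scaleP k (c ∷ cs) n = trans (cong (λ z → k * c + n * z) (eval-scaleP k cs n)) (lem k c n (eval cs n))
  where
  lem : ∀ k c n u → k * c + n * (k * u) ≡ k * (c + n * u)
  lem = solve-∀

eval-mulP : ∀ p q n → eval (mulP p q) n ≡ eval p n * eval q n
eval-mulP []       ds n = refl
eval-mulP (c ∷ cs) ds n = trans (eval-addP (scaleP c ds) (0 ∷ mulP cs ds) n)
  (trans (cong₂ (λ a b → a + n * b) (eval-scaleP c ds n) (eval-mulP cs ds n)) (lem c n (eval cs n) (eval ds n)))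
  where
  lem : ∀ c n u v → c * v + n * (u * v) ≡ (c + n * u) * v
  lem = solve-∀

-- An upper bound rather than an equation, so that the combinators below can follow the expression
-- of a running time literally.
PolyBounded : (ℕ → ℕ) → Set
PolyBounded F = Σ Poly λ p → ∀ n → F n ≤ eval p n

pb-eval : ∀ p → PolyBounded (eval p)
pb-eval p = p , λ n → ℕ.≤-refl

pb-const : ∀ k → PolyBounded (const k)
pb-const k = k ∷ [] , λ n → ℕ.m≤m+n k _

pb-id : PolyBounded id
pb-id = 0 ∷ 1 ∷ [] , λ n → ℕ.≤-reflexive (sym (trans (cong (n *_) (cong suc (ℕ.*-zeroʳ n))) (ℕ.*-identityʳ n)))

infixl 6 _pb+_
infixl 7 _pb*_

_pb+_ : ∀ {F H} → PolyBounded F → PolyBounded H → PolyBounded (λ n → F n + H n)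
(p , f) pb+ (q , h) = addP p q , λ n → ℕ.≤-trans (ℕ.+-mono-≤ (f n) (h n)) (ℕ.≤-reflexive (sym (eval-addP p q n)))

_pb*_ : ∀ {F H} → PolyBounded F → PolyBounded H → PolyBounded (λ n → F n * H n)
(p , f) pb* (q , h) = mulP p q , λ n → ℕ.≤-trans (ℕ.*-mono-≤ (f n) (h n)) (ℕ.≤-reflexive (sym (eval-mulP p q n)))

pb-≤ : ∀ {F H} → (∀ n → H n ≤ F n) → PolyBounded F → PolyBounded H
pb-≤ h (p , f) = p , λ n → ℕ.≤-trans (h n) (f n)

n<2^n : ∀ n → n < 2 ^ n
n<2^n zero    = s≤s z≤n
n<2^n (suc n) = ℕ.≤-trans (ℕ.+-mono-≤ (ℕ.≤-trans (s≤s z≤n) (n<2^n n)) (n<2^n n))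
  (ℕ.≤-reflexive (cong (2 ^ n +_) (sym (ℕ.+-identityʳ _))))

1≤2^ : ∀ n → 1 ≤ 2 ^ n
1≤2^ n = ℕ.≤-trans (s≤s z≤n) (n<2^n n)

ExpBounded : (ℕ → ℕ) → Set
ExpBounded F = Σ Poly λ p → ∀ n → F n ≤ 2 ^ eval p n

eb-pb : ∀ {F} → PolyBounded F → ExpBounded F
eb-pb (p , f) = p , λ n → ℕ.≤-trans (f n) (ℕ.<⇒≤ (n<2^n _))

eb-2^ : ∀ {F} → PolyBounded F → ExpBounded (λ n → 2 ^ F n)
eb-2^ (p , f) = p , λ n → ℕ.^-monoʳ-≤ 2 (f n)

infixl 6 _eb+_
infixl 7 _eb*_

_eb*_ : ∀ {F H} → ExpBounded F → ExpBounded H → ExpBounded (λ n → F n * H n)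
(p , f) eb* (q , h) = addP p q , λ n → ℕ.≤-trans (ℕ.*-mono-≤ (f n) (h n))
  (ℕ.≤-reflexive (trans (sym (ℕ.^-distribˡ-+-* 2 (eval p n) (eval q n))) (cong (2 ^_) (sym (eval-addP p q n)))))

_eb+_ : ∀ {F H} → ExpBounded F → ExpBounded H → ExpBounded (λ n → F n + H n)
_eb+_ {F} {H} (p , f) (q , h) = addP (1 ∷ []) (addP p q) , λ n → ℕ.≤-trans (ℕ.+-mono-≤ (f n) (h n))
  (ℕ.≤-trans (sum≤ (eval p n) (eval q n)) (ℕ.≤-reflexive (cong (2 ^_) (sym (trans (eval-addP (1 ∷ []) (addP p q) n)
    (cong₂ _+_ (cong suc (ℕ.*-zeroʳ n)) (eval-addP p q n)))))))
  where
  sum≤ : ∀ a b → 2 ^ a + 2 ^ b ≤ 2 ^ (1 + (a + b))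
  sum≤ a b = ℕ.≤-trans (ℕ.+-mono-≤ (ℕ.^-monoʳ-≤ 2 (ℕ.m≤m+n a b)) (ℕ.^-monoʳ-≤ 2 (ℕ.m≤n+m b a)))
                       (ℕ.≤-reflexive (cong (2 ^ (a + b) +_) (sym (ℕ.+-identityʳ _))))

-- Simulating oracle quantifiers by guessed tables

data GS : Set where
  tb        : Bool → GS
  comma dot : GS

-- `hash` opens the table of one oracle. The filler `dot` brings all tables to the same length.
data TS : Set where
  hash : TS
  sym′ : GS → TS

fin-GS : Finite GS
fin-GS = fin-retract (fin-Bool fin⊎ fin-Bool)
  (λ { (inj₁ b) → tb b ; (inj₂ true) → comma ; (inj₂ false) → dot })
  (λ { (tb b) → inj₁ b ; comma → inj₂ true ; dot → inj₂ false })
  (λ { (tb b) → refl ; comma → refl ; dot → refl })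

fin-TS : Finite TS
fin-TS = fin-retract (fin-⊤ fin⊎ fin-GS)
  (λ { (inj₁ _) → hash ; (inj₂ s) → sym′ s }) (λ { hash → inj₁ tt ; (sym′ s) → inj₂ s })
  (λ { hash → refl ; (sym′ s) → refl })

boolEq : Bool → Bool → Bool
boolEq true  b = b
boolEq false b = not b

isZ : ℕ → Bool
isZ zero    = true
isZ (suc _) = false

-- In a table the entries of a segment start with a comma and extend over the following
-- bits. A failed comparison resumes the search at the point of failure, which loses nothing
-- as only bits have been passed.
scan : List TS → Str → Bool
cmp  : List TS → Str → Str → Bool
scan []               y = false
scan (hash ∷ r)       y = false
scan (sym′ comma ∷ r) y = cmp r y y
scan (sym′ _ ∷ r)     y = scan r y
cmp (sym′ (tb b) ∷ r) (c ∷ y) y₀ = if boolEq b c then cmp r y y₀ else scan r y₀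
cmp (sym′ (tb b) ∷ r) []      y₀ = scan r y₀
cmp r                 []      y₀ = true
cmp r                 (c ∷ y) y₀ = scan r y₀

-- Each 1 of the index passes one `hash`. As a `hash` precedes every segment, an index i stops at
-- the start of the i-th one.
skip : List TS → Str → Bool
skip []           s           = false
skip (t ∷ r)      []          = false
skip (t ∷ r)      (false ∷ y) = scan (t ∷ r) y
skip (hash ∷ r)   (true ∷ s)  = skip r s
skip (sym′ _ ∷ r) (true ∷ s)  = skip r (true ∷ s)

-- Indices count from 1 in `tupleOracle`, so a query that does not begin with 1 is refused before
-- any search.
look : List TS → Str → Bool
look r (true ∷ s) = skip r (true ∷ s)
look r _          = false

module Simulator (M : AOTM) (f h : Poly) (q₁ : Quant) where
  open AOTM M using (nQ; g; δ) renaming (kind to kindᴹ; start to startᴹ; qyes to qyesᴹ; qno to qnoᴹ)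

  -- The tracks of a work cell: whether it is the origin, the simulated symbol, the table symbol,
  -- and a flag that marks the place of the simulated head during a query (`just nothing`) and then
  -- holds the answer there.
  W : Set
  W = Bool × Sym g × Maybe TS × Maybe (Maybe Bool)

  -- `used` is a spent segment mark and `one` a counter bit 1, while the counter bit 0 is an
  -- unmarked block cell. `zm` replaces the 0 in front of the key, so that a failed comparison finds
  -- its way back.
  data Xs : Set where
    wc       : W → Xs
    oc       : Bool × Sym g → Xs
    used one zm : Xs

  fin-Xs : Finite Xs
  fin-Xs = fin-retract
    ((fin-Bool fin× fin-Fin _ fin× fin-Maybe fin-TS fin× fin-Maybe (fin-Maybe fin-Bool)) fin⊎ (fin-Bool fin× fin-Fin _) fin⊎ fin-Fin 3)
    (λ { (inj₁ w) → wc w ; (inj₂ (inj₁ o)) → oc o ; (inj₂ (inj₂ zero)) → used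
       ; (inj₂ (inj₂ (suc zero))) → one ; (inj₂ (inj₂ (suc (suc zero)))) → zm })
    (λ { (wc w) → inj₁ w ; (oc o) → inj₂ (inj₁ o) ; used → inj₂ (inj₂ zero)
       ; one → inj₂ (inj₂ (suc zero)) ; zm → inj₂ (inj₂ (suc (suc zero))) })
    (λ { (wc w) → refl ; (oc o) → refl ; used → refl ; one → refl ; zm → refl })

  -- find to fin write the table, sim runs M. A query is answered by rewinding both heads (vb),
  -- skipping segments (va), searching (vs) and comparing (vc), with vr returning to the marked
  -- start of the key; ans and loc bring the head back to the flagged cell, and clr and res
  -- erase the query tape by a genuine query.
  data CS : Set where
    find ret guess incr over fin : Quant → CS
    sim : Fin nQ → CS
    ans loc : Bool → CS
    clr res vb va vs vc vr dead : CS

  fin-CS : Finite CS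
  fin-CS = fin-retract ((fin-Quant fin× fin-Fin 6) fin⊎ fin-Fin nQ fin⊎ (fin-Bool fin× fin-Bool) fin⊎ fin-Fin 8) to from to-from
    where
    to : (Quant × Fin 6) ⊎ Fin nQ ⊎ (Bool × Bool) ⊎ Fin 8 → CS
    to (inj₁ (q , zero)) = find q
    to (inj₁ (q , suc zero)) = ret q
    to (inj₁ (q , suc (suc zero))) = guess q
    to (inj₁ (q , suc (suc (suc zero)))) = incr q
    to (inj₁ (q , suc (suc (suc (suc zero))))) = over q
    to (inj₁ (q , suc (suc (suc (suc (suc zero)))))) = fin q
    to (inj₂ (inj₁ s)) = sim s
    to (inj₂ (inj₂ (inj₁ (true , b)))) = ans b
    to (inj₂ (inj₂ (inj₁ (false , b)))) = loc b
    to (inj₂ (inj₂ (inj₂ zero))) = clr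
    to (inj₂ (inj₂ (inj₂ (suc zero)))) = res
    to (inj₂ (inj₂ (inj₂ (suc (suc zero))))) = vb
    to (inj₂ (inj₂ (inj₂ (suc (suc (suc zero)))))) = va
    to (inj₂ (inj₂ (inj₂ (suc (suc (suc (suc zero))))))) = vs
    to (inj₂ (inj₂ (inj₂ (suc (suc (suc (suc (suc zero)))))))) = vc
    to (inj₂ (inj₂ (inj₂ (suc (suc (suc (suc (suc (suc zero))))))))) = vr
    to (inj₂ (inj₂ (inj₂ (suc (suc (suc (suc (suc (suc (suc zero)))))))))) = dead
    from : CS → (Quant × Fin 6) ⊎ Fin nQ ⊎ (Bool × Bool) ⊎ Fin 8
    from (find q) = inj₁ (q , zero)
    from (ret q) = inj₁ (q , suc zero)
    from (guess q) = inj₁ (q , suc (suc zero))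
    from (incr q) = inj₁ (q , suc (suc (suc zero)))
    from (over q) = inj₁ (q , suc (suc (suc (suc zero))))
    from (fin q) = inj₁ (q , suc (suc (suc (suc (suc zero)))))
    from (sim s) = inj₂ (inj₁ s)
    from (ans b) = inj₂ (inj₂ (inj₁ (true , b)))
    from (loc b) = inj₂ (inj₂ (inj₁ (false , b)))
    from clr = inj₂ (inj₂ (inj₂ zero))
    from res = inj₂ (inj₂ (inj₂ (suc zero)))
    from vb = inj₂ (inj₂ (inj₂ (suc (suc zero))))
    from va = inj₂ (inj₂ (inj₂ (suc (suc (suc zero)))))
    from vs = inj₂ (inj₂ (inj₂ (suc (suc (suc (suc zero))))))
    from vc = inj₂ (inj₂ (inj₂ (suc (suc (suc (suc (suc zero)))))))
    from vr = inj₂ (inj₂ (inj₂ (suc (suc (suc (suc (suc (suc zero))))))))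
    from dead = inj₂ (inj₂ (inj₂ (suc (suc (suc (suc (suc (suc (suc zero)))))))))
    to-from : ∀ s → to (from s) ≡ s
    to-from = λ { (find q) → refl ; (ret q) → refl ; (guess q) → refl ; (incr q) → refl ; (over q) → refl
                ; (fin q) → refl ; (sim s) → refl ; (ans b) → refl ; (loc b) → refl ; clr → refl ; res → refl
                ; vb → refl ; va → refl ; vs → refl ; vc → refl ; vr → refl ; dead → refl }

  I₁ I₂ : List Instr
  I₁ = instrsOf true f
  I₂ = instrsOf false h

  Gs : Set
  Gs = Γ (Cell Xs I₁ I₂)

  -- Cells untouched since the block was built are read as if they carried tracks already, which
  -- saves a pass that converts the tape.
  viewW : Gs → W
  viewW (bit b)                   = false , encBit b , nothing , nothing
  viewW (ext (owork nothing))     = true , zero , nothing , nothing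
  viewW (ext (owork (just b)))    = true , encBit b , nothing , nothing
  viewW (ext (core (wc w)))       = w
  viewW _                         = false , zero , nothing , nothing

  viewO : Gs → Bool × Sym g
  viewO (ext (core (oc o))) = o
  viewO _                   = false , zero

  wG : W → Gs
  wG w = ext (core (wc w))

  oG : Bool × Sym g → Gs
  oG o = ext (core (oc o))

  tabOf : Gs → Maybe TS
  tabOf a = proj₁ (proj₂ (proj₂ (viewW a)))

  orgW : Gs → Bool
  orgW a = proj₁ (viewW a)

  orgO : Gs → Bool
  orgO b = proj₁ (viewO b)

  flagOf : Gs → Maybe (Maybe Bool)
  flagOf a = proj₂ (proj₂ (proj₂ (viewW a)))

  keyBit : Gs → Maybe Bool
  keyBit b = sbit (proj₂ (viewO b))

  setTab : TS → W → W
  setTab t (o , s , _ , f) = o , s , just t , f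

  setFlag : Maybe (Maybe Bool) → W → W
  setFlag f (o , s , t , _) = o , s , t , f

  isZm : Gs → Bool
  isZm (ext (core zm)) = true
  isZm _               = false

  T : Set
  T = CS × Gs × Move × Gs × Move

  -- The erasing query also ends the guessing phase. The flag then holds no answer, and the
  -- simulation begins.
  resume : Maybe (Maybe Bool) → Fin nQ
  resume (just (just true))  = qyesᴹ
  resume (just (just false)) = qnoᴹ
  resume _                   = startᴹ

  δvb : Bool → Bool → Maybe Bool → Gs → Gs → T
  δvb true true (just true) a b = va , a , S , b , S
  δvb true true _           a b = ans false , a , S , b , S
  δvb _    _    _           a b = vb , a , L , b , L

  δva : Maybe TS → Maybe Bool → Gs → Gs → T
  δva nothing         k            a b = ans false , a , S , b , S
  δva (just t)        nothing      a b = ans false , a , S , b , S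
  δva (just t)        (just false) a b = vs , a , S , ext (core zm) , R
  δva (just hash)     (just true)  a b = va , a , R , b , R
  δva (just (sym′ _)) (just true)  a b = va , a , R , b , S

  δvs : Maybe TS → Gs → Gs → T
  δvs nothing             a b = ans false , a , S , b , S
  δvs (just hash)         a b = ans false , a , S , b , S
  δvs (just (sym′ comma)) a b = vc , a , R , b , S
  δvs (just (sym′ _))     a b = vs , a , R , b , S

  δvc : Maybe TS → Maybe Bool → Gs → Gs → T
  δvc (just (sym′ (tb c))) (just d) a b = (if boolEq c d then vc else vr) , a , R , b , (if boolEq c d then R else L)
  δvc (just (sym′ (tb c))) nothing  a b = vr , a , R , b , L
  δvc _                    nothing  a b = ans true , a , S , b , S
  δvc _                    (just d) a b = vr , a , S , b , L

  δloc : Maybe (Maybe Bool) → Bool → Gs → Gs → T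
  δloc nothing  c a b = loc c , a , R , b , S
  δloc (just _) c a b = clr , wG (setFlag (just (just c)) (viewW a)) , S , b , S

  δsim : Kind → Fin nQ → W → Bool × Sym g → List T
  δsim (quant _) s (ow , a , t , fl) (oo , b) =
    map (λ (s′ , a′ , m , b′ , m′) → sim s′ , wG (ow , a′ , t , fl) , m , oG (oo , b′) , m′) (δ s a b)
  δsim query s w o = (vb , wG (setFlag (just nothing) w) , S , oG o , S) ∷ []
  δsim _     s w o = []

  δ1 : CS → Gs → Gs → T
  δ1 (find q) a (ext (mk true)) = ret q , wG (setTab hash (viewW a)) , R , ext (core used) , L
  δ1 (find q) a □               = fin q , a , S , □ , S
  δ1 (find q) a b               = find q , a , S , b , R
  δ1 (ret q) a (ext lend)       = guess q , a , S , ext lend , R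
  δ1 (ret q) a b                = ret q , a , S , b , L
  δ1 (incr q) a (ext (mk false))   = ret q , a , S , ext (core one) , L
  δ1 (incr q) a (ext (core one))   = incr q , a , S , ext (mk false) , R
  δ1 (incr q) a □                  = over q , a , S , □ , L
  δ1 (incr q) a b                  = incr q , a , S , b , R
  δ1 (over q) a (ext lend)      = find (dual q) , a , S , ext lend , R
  δ1 (over q) a b               = over q , a , S , b , L
  δ1 (fin q) a b = if orgW a then (clr , wG (setFlag (just nothing) (viewW a)) , S , b , S) else (fin q , a , L , b , S)
  δ1 res a b = sim (resume (flagOf a)) , wG (setFlag nothing (viewW a)) , S , oG (true , zero) , S
  δ1 vb a b = δvb (orgW a) (orgO b) (keyBit b) a b
  δ1 va a b = δva (tabOf a) (keyBit b) a b
  δ1 vs a b = δvs (tabOf a) a b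
  δ1 vc a b = δvc (tabOf a) (keyBit b) a b
  δ1 vr a b = if isZm b then (vs , a , S , b , R) else (vr , a , S , b , L)
  δ1 (ans c) a b = if orgW a then (loc c , a , S , b , S) else (ans c , a , L , b , S)
  δ1 (loc c) a b = δloc (flagOf a) c a b
  δ1 s a b = dead , a , S , b , S

  kindS : Kind → Kind
  kindS query = quant ∃Q
  kindS k     = k

  kindCS : CS → Kind
  kindCS (find q)  = quant q
  kindCS (ret q)   = quant q
  kindCS (guess q) = quant q
  kindCS (incr q)  = quant q
  kindCS (over q)  = quant q
  kindCS (fin q)   = quant q
  kindCS (sim s)   = kindS (kindᴹ s)
  kindCS clr       = query
  kindCS dead      = reject
  kindCS _         = quant ∃Q

  δCS : CS → Gs → Gs → List T
  δCS (guess q) a b = map (λ s → incr q , wG (setTab (sym′ s) (viewW a)) , R , b , S) (elems fin-GS)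
  δCS (sim s)   a b = δsim (kindᴹ s) s (viewW a) (viewO b)
  δCS s         a b = δ1 s a b ∷ []

  simCore : Core
  simCore = record
    { X = Xs ; CSt = CS ; fin-X = fin-Xs ; fin-CSt = fin-CS ; q₀ = q₁ ; is₁ = I₁ ; is₂ = I₂
    -- The oracle is empty, so a genuine query is always answered no; its only effect is to empty
    -- the query tape.
    ; kindC = kindCS ; c₀ = find q₁ ; cy = dead ; cn = res ; δC = δCS }

  open Core simCore using (machine; program; rd; hd; read; zstep; zsys; ZConf)

  Y : Sys
  Y = zsys emptyOracle

module _ {A : Set} (d : A) where

  rd-set-same : ∀ (a : A) m t → rdOr d (full (put a m t)) (pos t) ≡ a
  rd-set-same a m (l ◂ r) = trans (cong (λ z → rdOr d z (length l)) (full-put a m l r)) (rd-head d l (a ∷ tl r))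

  rd-before : ∀ (l : List A) r r′ i → i < length l → rdOr d (l ʳ++ r) i ≡ rdOr d (l ʳ++ r′) i
  rd-before (a ∷ l) r r′ i i< with i ℕ.≟ length l
  ... | yes refl = trans (rd-head d l (a ∷ r)) (sym (rd-head d l (a ∷ r′)))
  ... | no i≢    = rd-before l (a ∷ r) (a ∷ r′) i (ℕ.≤∧≢⇒< (ℕ.≤-pred i<) i≢)

  rd-set-other : ∀ (a : A) m t i → i ≢ pos t → rdOr d (full (put a m t)) i ≡ rdOr d (full t) i
  rd-set-other a m (l ◂ r) i i≢ = trans (cong (λ z → rdOr d z i) (full-put a m l r)) (go (ℕ.<-cmp i (length l)))
    where
    go : _ → rdOr d (l ʳ++ (a ∷ tl r)) i ≡ rdOr d (l ʳ++ r) i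
    go (tri< i< _ _) = rd-before l (a ∷ tl r) r i i<
    go (tri≈ _ e _)  = ⊥-elim (i≢ e)
    go (tri> _ _ i>) with i ∸ suc (length l) in e
    ... | k = trans (cong (rdOr d (l ʳ++ (a ∷ tl r))) i≡) (trans (rd-beyond d l (a ∷ tl r) (suc k))
                (trans (rd-tl d r k) (sym (trans (cong (rdOr d (l ʳ++ r)) i≡) (rd-beyond d l r (suc k))))))
      where
      i≡ : i ≡ length l + suc k
      i≡ = trans (sym (ℕ.m+[n∸m]≡n i>)) (trans (cong (suc (length l) +_) e) (sym (ℕ.+-suc (length l) k)))

  infix 4 _≈F_
  -- Cellwise equality is needed because writing back a blank that was only implicit lengthens the
  -- list.
  _≈F_ : Tape A → Tape A → Set
  t ≈F t′ = ∀ i → rdOr d (full t) i ≡ rdOr d (full t′) i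

  rd-nf : ∀ (r : List A) i → rdOr d (rdOr d r 0 ∷ tl r) i ≡ rdOr d r i
  rd-nf r zero    = refl
  rd-nf r (suc i) = rd-tl d r i

  head-at : ∀ l r → rdOr d r 0 ≡ rdOr d (full (l ◂ r)) (pos (l ◂ r))
  head-at l r = sym (rd-head d l r)

  put-same : ∀ m l r → put (rdOr d r 0) m (l ◂ r) ≈F (l ◂ r)
  put-same m l r i = trans (cong (λ z → rdOr d z i) (full-put (rdOr d r 0) m l r)) (rd-ʳ++-cong d l (rd-nf r) i)

length-put : ∀ {A : Set} (a : A) m t → length (full (put a m t)) ≤ suc (length (full t))
length-put a m (l ◂ r) = ℕ.≤-trans (ℕ.≤-reflexive (trans (cong length (full-put a m l r)) (length-ʳ++ l)))
  (ℕ.≤-trans (ℕ.+-monoʳ-≤ (length l) (tl-le r)) (ℕ.≤-reflexive (trans (ℕ.+-suc (length l) (length r)) (cong suc (sym (length-ʳ++ l))))))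
  where
  tl-le : ∀ r → suc (length (tl r)) ≤ suc (length r)
  tl-le []      = ℕ.≤-refl
  tl-le (_ ∷ r) = ℕ.n≤1+n _

pos≤length : ∀ {A : Set} (t : Tape A) → pos t ≤ length (full t)
pos≤length (l ◂ r) = ℕ.≤-trans (ℕ.m≤m+n (length l) (length r)) (ℕ.≤-reflexive (sym (length-ʳ++ l)))

-- Looking up an answer in the tables

module Lookup (M : AOTM) (f h : Poly) (q₁ : Quant) where
  open AOTM M using (nQ; g)
  open Simulator M f h q₁
  open Core simCore using (machine; rd; hd; read; zstep; ZConf)

  cz : CS → Tape Gs → Tape Gs → ZConf
  cz s = zc (inj₂ s)

  lift : T → (Pre (Core.C simCore) ⊎ CS) × Gs × Move × Gs × Move
  lift (s , e) = inj₂ s , e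

  cstep : ∀ s {w o e n d q} → kindCS s ≡ quant q → δCS s (read w) (read o) ≡ e ∷ [] →
          Reach Y q n (zstep (cz s w o) (lift e)) d → Reach Y q (suc n) (cz s w o) d
  cstep s {w} {o} k e g = step k (cong (λ es → map (zstep (cz s w o)) (map lift es)) e) g

  _≋_ : Tape Gs → Tape Gs → Set
  _≋_ = _≈F_ □

  nf : Tape Gs → Tape Gs
  nf (l ◂ r) = l ◂ hd r ∷ tl r

  nf≋ : ∀ l r → nf (l ◂ r) ≋ (l ◂ r)
  nf≋ l r = put-same □ S l r

  TabAt : List Gs → List TS → Set
  TabAt r ts = ∀ i → tabOf (rd r i) ≡ nth ts i

  tab-tl : ∀ {r t ts} → TabAt r (t ∷ ts) → TabAt (tl r) ts
  tab-tl {r} h i = trans (cong tabOf (rd-tl □ r i)) (h (suc i))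

  tab-nf : ∀ {r ts} → TabAt r ts → TabAt (hd r ∷ tl r) ts
  tab-nf {r} h i = trans (cong tabOf (rd-nf □ r i)) (h i)

  KeyAt : List Gs → Str → Set
  KeyAt r []      = keyBit (hd r) ≡ nothing
  KeyAt r (c ∷ s) = keyBit (hd r) ≡ just c × KeyAt (tl r) s

  key-cong : ∀ s {r r′} → (∀ i → rd r i ≡ rd r′ i) → KeyAt r s → KeyAt r′ s
  key-cong []      e k       = trans (cong keyBit (sym (e 0))) k
  key-cong (c ∷ s) {r} {r′} e (k , ks) =
    trans (cong keyBit (sym (e 0))) k , key-cong s (λ i → trans (rd-tl □ r i) (trans (e (suc i)) (sym (rd-tl □ r′ i)))) ks

  key-nf : ∀ s {r} → KeyAt r s → KeyAt (hd r ∷ tl r) s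
  key-nf s {r} = key-cong s (λ i → sym (rd-nf □ r i))

  key-zm : ∀ b {c} → keyBit b ≡ just c → isZm b ≡ false
  key-zm (ext (core (oc o))) e = refl
  key-zm □ e = refl
  key-zm (bit b) e = refl
  key-zm (ext (owork m)) e = refl
  key-zm (ext lend) e = refl
  key-zm (ext (pend c)) e = refl
  key-zm (ext (mk b)) e = refl
  key-zm (ext (core (wc w))) e = refl
  key-zm (ext (core used)) e = refl
  key-zm (ext (core one)) e = refl

  zmG : Gs
  zmG = ext (core zm)

  data NoZm : List Gs → Set where
    []  : NoZm []
    _∷_ : ∀ {a as} → isZm a ≡ false → NoZm as → NoZm (a ∷ as)

  -- Only the work tape must come back unchanged. The query tape may have lost the 0 in front of the
  -- key, and is erased by `clr` anyway.
  record Answered (n : ℕ) (s : CS) (w o : Tape Gs) (v : Bool) : Set where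
    constructor answered
    field
      w′ o′ : Tape Gs
      same  : w′ ≋ w
      reach : Reach Y ∃Q n (cz s w o) (cz (ans v) w′ o′)

  private
    vs-eq : ∀ {a b t} → tabOf a ≡ t → δCS vs a b ≡ δvs t a b ∷ []
    vs-eq refl = refl

    vc-eq : ∀ {a b t k} → tabOf a ≡ t → keyBit b ≡ k → δCS vc a b ≡ δvc t k a b ∷ []
    vc-eq refl refl = refl

    va-eq : ∀ {a b t k} → tabOf a ≡ t → keyBit b ≡ k → δCS va a b ≡ δva t k a b ∷ []
    va-eq refl refl = refl

    vr-eq : ∀ {a b} → isZm b ≡ false → δCS vr a b ≡ (vr , a , S , b , L) ∷ []
    vr-eq e rewrite e = refl

    rewindKey : ∀ ds h l r {zl or} → NoZm ds → Reach Y ∃Q (length ds + 1)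
                (cz vr (l ◂ r) (put h L (ds ++ zmG ∷ zl ◂ or))) (cz vs (nf (l ◂ r)) (zmG ∷ zl ◂ ds ʳ++ (h ∷ tl or)))
    rewindKey []       h l r [] = cstep vr refl refl done
    rewindKey (d ∷ ds) h l r {or = or} (z ∷ zs) =
      cstep vr {w = l ◂ r} refl (vr-eq z) (rewindKey ds d l (hd r ∷ tl r) {or = d ∷ h ∷ tl or} zs)

    after : ∀ {n m s w o s′ w₁ o₁ v} → w₁ ≋ w → Reach Y ∃Q n (cz s w o) (cz s′ w₁ o₁) →
            Answered m s′ w₁ o₁ v → Answered (n + m) s w o v
    after e g (answered w′ o′ e′ g′) = answered w′ o′ (λ i → trans (e′ i) (e i)) (g ⨟ g′)

    slow : ∀ {n m s w o v} → n ≤ m → Answered n s w o v → Answered m s w o v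
    slow n≤m (answered w′ o′ e g) = answered w′ o′ e (reach-mono n≤m g)

  -- Linear in the table, since a failure goes back on the key only. The comma of an entry pays for
  -- that one return.
  scanCost : ℕ → Str → ℕ
  scanCost k y = k * (length y + 4) + 1

  scanning : ∀ ts y {wl wr zl or} → TabAt wr ts → KeyAt or y →
             Answered (scanCost (length ts) y) vs (wl ◂ wr) (zmG ∷ zl ◂ or) (scan ts y)
  -- `ds` holds the key cells already matched, nearest first. `KeyAt (ds ʳ++ or) y₀` remembers the
  -- whole key, so that the search can start over after a failure.
  comparing : ∀ ts y y₀ ds {wl wr zl or} → TabAt wr ts → KeyAt or y → KeyAt (ds ʳ++ or) y₀ → NoZm ds →
              length ds + length y ≡ length y₀ →
              Answered (scanCost (length ts) y₀ + (length y₀ + 2)) vc (wl ◂ wr) (ds ++ zmG ∷ zl ◂ or) (cmp ts y y₀)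
  failing : ∀ ts y₀ ds h {l r zl or} → TabAt r ts → KeyAt (ds ʳ++ (h ∷ tl or)) y₀ → NoZm ds →
            Answered (length ds + 1 + scanCost (length ts) y₀) vr (l ◂ r) (put h L (ds ++ zmG ∷ zl ◂ or)) (scan ts y₀)
  scanning [] y {wl} {wr} th kh = answered _ _ (nf≋ wl wr) (cstep vs refl (vs-eq (th 0)) done)
  scanning (hash ∷ ts) y {wl} {wr} th kh =
    slow (ℕ.m≤n+m 1 _) (answered _ _ (nf≋ wl wr) (cstep vs refl (vs-eq (th 0)) done))
  scanning (sym′ comma ∷ ts) y {wl} {wr} th kh =
    slow (ℕ.≤-reflexive (lem (length ts) (length y)))
      (after (put-same □ R wl wr) (cstep vs refl (vs-eq (th 0)) (done {n = 0}))
        (slow (ℕ.n≤1+n _) (comparing ts y y [] (tab-tl {wr} {ts = ts} th) (key-nf y kh) (key-nf y kh) [] refl)))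
    where
    lem : ∀ k n → 1 + suc (k * (n + 4) + 1 + (n + 2)) ≡ suc k * (n + 4) + 1
    lem = solve-∀
  scanning (sym′ (tb b) ∷ ts) y {wl} {wr} th kh =
    slow (≤-split (lem (length ts) (length y)))
      (after (put-same □ R wl wr) (cstep vs refl (vs-eq (th 0)) (done {n = 0}))
        (scanning ts y (tab-tl {wr} {ts = ts} th) (key-nf y kh)))
    where
    lem : ∀ k n → suc k * (n + 4) + 1 ≡ 1 + (k * (n + 4) + 1) + (n + 3)
    lem = solve-∀
  scanning (sym′ dot ∷ ts) y {wl} {wr} th kh =
    slow (≤-split (lem (length ts) (length y)))
      (after (put-same □ R wl wr) (cstep vs refl (vs-eq (th 0)) (done {n = 0}))
        (scanning ts y (tab-tl {wr} {ts = ts} th) (key-nf y kh)))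
    where
    lem : ∀ k n → suc k * (n + 4) + 1 ≡ 1 + (k * (n + 4) + 1) + (n + 3)
    lem = solve-∀
  failing ts y₀ ds h {l} {r} th kh zs = after (nf≋ l r) (rewindKey ds h l r zs) (scanning ts y₀ (tab-nf {r} {ts} th) kh)
  comparing ts y y₀ ds {wl} {wr} {zl} {or} th kh kh₀ zs e = go ts y th kh e
    where
    ds≤ : ∀ {y} → length ds + length y ≡ length y₀ → length ds ≤ length y₀
    ds≤ {y} e = ℕ.≤-trans (ℕ.m≤m+n _ (length y)) (ℕ.≤-reflexive e)
    kh′ : KeyAt (ds ʳ++ (hd or ∷ tl or)) y₀
    kh′ = key-cong y₀ (λ i → sym (rd-ʳ++-cong □ ds (rd-nf □ or) i)) kh₀
    cost₁ : ∀ n k → n ≤ length y₀ → 1 + (n + 1 + k) ≤ k + (length y₀ + 2)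
    cost₁ n k n≤ = ℕ.≤-trans (ℕ.≤-reflexive (lem n k)) (ℕ.+-monoʳ-≤ k (ℕ.+-monoˡ-≤ 2 n≤))
      where
      lem : ∀ n k → 1 + (n + 1 + k) ≡ k + (n + 2)
      lem = solve-∀
    cost₂ : ∀ n k → n ≤ length y₀ → 1 + (n + 1 + scanCost k y₀) ≤ scanCost (suc k) y₀ + (length y₀ + 2)
    cost₂ n k n≤ = ℕ.≤-trans (cost₁ n _ n≤) (ℕ.+-monoˡ-≤ _ (ℕ.+-monoˡ-≤ 1 (ℕ.m≤n+m _ (length y₀ + 4))))
    fail-stay : ∀ ts c → TabAt wr ts → length ds ≤ length y₀ → (∀ {a b} → tabOf a ≡ nth ts 0 → keyBit b ≡ just c →
                  δCS vc a b ≡ (vr , a , S , b , L) ∷ []) → keyBit (hd or) ≡ just c →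
                Answered (scanCost (length ts) y₀ + (length y₀ + 2)) vc (wl ◂ wr) (ds ++ zmG ∷ zl ◂ or) (scan ts y₀)
    fail-stay ts c th n≤ δ≡ k = slow (cost₁ (length ds) _ n≤)
      (after (put-same □ S wl wr) (cstep vc refl (δ≡ (th 0) k) (done {n = 0})) (failing ts y₀ ds (hd or) (tab-nf {wr} {ts} th) kh′ zs))
    success : ∀ ts → keyBit (hd or) ≡ nothing → (∀ {a b} → keyBit b ≡ nothing → tabOf a ≡ nth ts 0 → δCS vc a b ≡ (ans true , a , S , b , S) ∷ []) →
              TabAt wr ts → Answered (scanCost (length ts) y₀ + (length y₀ + 2)) vc (wl ◂ wr) (ds ++ zmG ∷ zl ◂ or) true
    success ts k δ≡ th = slow (ℕ.≤-trans (s≤s z≤n) (ℕ.≤-trans (ℕ.m≤n+m 2 (length y₀)) (ℕ.m≤n+m _ (scanCost (length ts) y₀))))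
      (answered _ _ (nf≋ wl wr) (cstep vc refl (δ≡ k (th 0)) (done {n = 0})))
    go : ∀ ts y → TabAt wr ts → KeyAt or y → length ds + length y ≡ length y₀ →
         Answered (scanCost (length ts) y₀ + (length y₀ + 2)) vc (wl ◂ wr) (ds ++ zmG ∷ zl ◂ or) (cmp ts y y₀)
    go (sym′ (tb b) ∷ ts) (c ∷ y) th (k , ks) e with boolEq b c in eq
    ... | true = slow (ℕ.≤-trans (≤-split (lem (length ts) (length y₀))) ℕ.≤-refl)
      (after (put-same □ R wl wr)
        (cstep vc refl (trans (vc-eq (th 0) k) (cong (λ z → ((if z then vc else vr) , _ , R , _ , (if z then R else L)) ∷ []) eq)) (done {n = 0}))
        (comparing ts y y₀ (hd or ∷ ds) (tab-tl {wr} {ts = ts} th) ks kh′ (key-zm (hd or) k ∷ zs) (trans (sym (ℕ.+-suc (length ds) (length y))) e)))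
      where
      lem : ∀ k n → suc k * (n + 4) + 1 + (n + 2) ≡ 1 + (k * (n + 4) + 1 + (n + 2)) + (n + 3)
      lem = solve-∀
    ... | false = slow (cost₂ (length ds) (length ts) (ds≤ {c ∷ y} e))
      (after (put-same □ R wl wr)
        (cstep vc refl (trans (vc-eq (th 0) k) (cong (λ z → ((if z then vc else vr) , _ , R , _ , (if z then R else L)) ∷ []) eq)) (done {n = 0}))
        (failing ts y₀ ds (hd or) (tab-tl {wr} {ts = ts} th) kh′ zs))
    go (sym′ (tb b) ∷ ts) [] th k e = slow (cost₂ (length ds) (length ts) (ds≤ {[]} e))
      (after (put-same □ R wl wr) (cstep vc refl (vc-eq (th 0) k) (done {n = 0})) (failing ts y₀ ds (hd or) (tab-tl {wr} {ts = ts} th) kh′ zs))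
    go []                []      th k e = success [] k (λ k t → vc-eq t k) th
    go (hash ∷ ts)       []      th k e = success (hash ∷ ts) k (λ k t → vc-eq t k) th
    go (sym′ comma ∷ ts) []      th k e = success (sym′ comma ∷ ts) k (λ k t → vc-eq t k) th
    go (sym′ dot ∷ ts)   []      th k e = success (sym′ dot ∷ ts) k (λ k t → vc-eq t k) th
    go []                (c ∷ y) th (k , _) e = fail-stay [] c th (ds≤ {c ∷ y} e) vc-eq k
    go (hash ∷ ts)       (c ∷ y) th (k , _) e = fail-stay (hash ∷ ts) c th (ds≤ {c ∷ y} e) vc-eq k
    go (sym′ comma ∷ ts) (c ∷ y) th (k , _) e = fail-stay (sym′ comma ∷ ts) c th (ds≤ {c ∷ y} e) vc-eq k
    go (sym′ dot ∷ ts)   (c ∷ y) th (k , _) e = fail-stay (sym′ dot ∷ ts) c th (ds≤ {c ∷ y} e) vc-eq k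
  skipCost : ℕ → Str → ℕ
  skipCost k s = k * (length s + 5) + 2

  skipping : ∀ ts s {wl wr ol or} → TabAt wr ts → KeyAt or s →
             Answered (skipCost (length ts) s) va (wl ◂ wr) (ol ◂ or) (skip ts s)
  skipping [] s {wl} {wr} th kh = slow (ℕ.n≤1+n 1) (answered _ _ (nf≋ wl wr) (cstep va refl (va-eq (th 0) refl) (done {n = 0})))
  skipping (t ∷ ts) [] {wl} {wr} th k =
    slow (s≤s z≤n) (answered _ _ (nf≋ wl wr) (cstep va refl (va-eq (th 0) k) (done {n = 0})))
  skipping (t ∷ ts) (false ∷ y) {wl} {wr} th (k , ks) = slow (≤-split (lem (length ts) (length y)))
    (after (nf≋ wl wr) (cstep va refl (va-eq (th 0) k) (done {n = 0})) (scanning (t ∷ ts) y (tab-nf {wr} {t ∷ ts} th) ks))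
    where
    lem : ∀ k n → suc k * (1 + n + 5) + 2 ≡ 1 + (suc k * (n + 4) + 1) + (suc k * 2)
    lem = solve-∀
  skipping (hash ∷ ts) (true ∷ s) {wl} {wr} th (k , ks) = slow (≤-split (lem (length ts) (length s)))
    (after (put-same □ R wl wr) (cstep va refl (va-eq (th 0) k) (done {n = 0})) (skipping ts s (tab-tl {wr} {ts = ts} th) ks))
    where
    lem : ∀ k n → suc k * (1 + n + 5) + 2 ≡ 1 + (k * (n + 5) + 2) + (k + n + 5)
    lem = solve-∀
  skipping (sym′ _ ∷ ts) (true ∷ s) {wl} {wr} {or = or} th kh = slow (≤-split (lem (length ts) (length s)))
    (after (put-same □ R wl wr) (cstep va refl (va-eq (th 0) (proj₁ kh)) (done {n = 0}))
      (skipping ts (true ∷ s) (tab-tl {wr} {ts = ts} th) (key-nf (true ∷ s) {or} kh)))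
    where
    lem : ∀ k n → suc k * (1 + n + 5) + 2 ≡ 1 + (k * (1 + n + 5) + 2) + (n + 5)
    lem = solve-∀

  rdᴹ : List (Sym g) → ℕ → Sym g
  rdᴹ = rdOr zero

  Flags : Set
  Flags = ℕ → Maybe (Maybe Bool)

  record ViewW (xs : ℕ → Sym g) (ts : List TS) (fl : Flags) (w : Tape Gs) : Set where
    constructor mkW
    field atW : ∀ i → viewW (rd (full w) i) ≡ (isZ i , xs i , nth ts i , fl i)

  record ViewO (xs : ℕ → Sym g) (o : Tape Gs) : Set where
    constructor mkO
    field atO : ∀ i → viewO (rd (full o) i) ≡ (isZ i , xs i)

  open ViewW
  open ViewO

  viewW-≋ : ∀ {xs ts fl w w′} → w′ ≋ w → ViewW xs ts fl w → ViewW xs ts fl w′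
  viewW-≋ e v = mkW λ i → trans (cong viewW (e i)) (atW v i)

  viewO-≋ : ∀ {xs o o′} → o′ ≋ o → ViewO xs o → ViewO xs o′
  viewO-≋ e v = mkO λ i → trans (cong viewO (e i)) (atO v i)

  viewHead : ∀ {xs ts fl} l r → ViewW xs ts fl (l ◂ r) → viewW (hd r) ≡ (isZ (length l) , xs (length l) , nth ts (length l) , fl (length l))
  viewHead l r v = trans (cong viewW (head-at □ l r)) (atW v (length l))

  viewHeadO : ∀ {xs} l r → ViewO xs (l ◂ r) → viewO (hd r) ≡ (isZ (length l) , xs (length l))
  viewHeadO l r v = trans (cong viewO (head-at □ l r)) (atO v (length l))

  private
    vb-eq : ∀ {a b x y k} → orgW a ≡ x → orgO b ≡ y → keyBit b ≡ k → δCS vb a b ≡ δvb x y k a b ∷ []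
    vb-eq refl refl refl = refl

    if-eq : ∀ {A : Set} {b c} {x y : A} → b ≡ c → (if b then x else y) ≡ (if c then x else y)
    if-eq refl = refl

  module _ {xs xo : ℕ → Sym g} {ts : List TS} {fl : Flags} where

    rewindBoth : ∀ n l r m s → ViewW xs ts fl (l ◂ r) → ViewO xo (m ◂ s) → length l ≤ n → length m ≤ n →
      Σ (List Gs) λ r′ → Σ (List Gs) λ s′ → ([] ◂ r′) ≋ (l ◂ r) × ([] ◂ s′) ≋ (m ◂ s) ×
      Reach Y ∃Q n (cz vb (l ◂ r) (m ◂ s)) (cz vb ([] ◂ r′) ([] ◂ s′))
    rewindBoth n [] r [] s vw vo l≤ m≤ = r , s , (λ _ → refl) , (λ _ → refl) , done
    rewindBoth (suc n) [] r (b ∷ m) s vw vo l≤ (s≤s m≤)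
      with rewindBoth n [] (hd r ∷ tl r) m (b ∷ hd s ∷ tl s) (viewW-≋ (put-same □ L [] r) vw) (viewO-≋ (put-same □ L (b ∷ m) s) vo) z≤n m≤
    ... | r′ , s′ , ew , eo , g = r′ , s′ , (λ i → trans (ew i) (put-same □ L [] r i)) , (λ i → trans (eo i) (put-same □ L (b ∷ m) s i)) ,
      cstep vb refl (vb-eq (cong proj₁ (viewHead [] r vw)) (cong proj₁ (viewHeadO (b ∷ m) s vo)) refl) g
    rewindBoth (suc n) (a ∷ l) r [] s vw vo (s≤s l≤) m≤
      with rewindBoth n l (a ∷ hd r ∷ tl r) [] (hd s ∷ tl s) (viewW-≋ (put-same □ L (a ∷ l) r) vw) (viewO-≋ (put-same □ L [] s) vo) l≤ z≤n
    ... | r′ , s′ , ew , eo , g = r′ , s′ , (λ i → trans (ew i) (put-same □ L (a ∷ l) r i)) , (λ i → trans (eo i) (put-same □ L [] s i)) ,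
      cstep vb refl (vb-eq (cong proj₁ (viewHead (a ∷ l) r vw)) (cong proj₁ (viewHeadO [] s vo)) refl) g
    rewindBoth (suc n) (a ∷ l) r (b ∷ m) s vw vo (s≤s l≤) (s≤s m≤)
      with rewindBoth n l (a ∷ hd r ∷ tl r) m (b ∷ hd s ∷ tl s) (viewW-≋ (put-same □ L (a ∷ l) r) vw) (viewO-≋ (put-same □ L (b ∷ m) s) vo) l≤ m≤
    ... | r′ , s′ , ew , eo , g = r′ , s′ , (λ i → trans (ew i) (put-same □ L (a ∷ l) r i)) , (λ i → trans (eo i) (put-same □ L (b ∷ m) s i)) ,
      cstep vb refl (vb-eq (cong proj₁ (viewHead (a ∷ l) r vw)) (cong proj₁ (viewHeadO (b ∷ m) s vo)) refl) g

    ansBack : ∀ c l r o → ViewW xs ts fl (l ◂ r) → Σ (List Gs) λ r′ → Σ (Tape Gs) λ o′ → ([] ◂ r′) ≋ (l ◂ r) ×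
              Reach Y ∃Q (length l + 1) (cz (ans c) (l ◂ r) o) (cz (loc c) ([] ◂ r′) o′)
    ansBack c [] r o vw = hd r ∷ tl r , _ , put-same □ S [] r ,
      cstep (ans c) refl (cong (_∷ []) (if-eq (cong proj₁ (viewHead [] r vw)))) done
    ansBack c (a ∷ l) r o vw with ansBack c l (a ∷ hd r ∷ tl r) (put (read o) S o) (viewW-≋ (put-same □ L (a ∷ l) r) vw)
    ... | r′ , o′ , e , g = r′ , o′ , (λ i → trans (e i) (put-same □ L (a ∷ l) r i)) ,
      cstep (ans c) refl (cong (_∷ []) (if-eq (cong proj₁ (viewHead (a ∷ l) r vw)))) g

    private
      loc-eq : ∀ {a b c f} → flagOf a ≡ f → δCS (loc c) a b ≡ δloc f c a b ∷ []
      loc-eq refl = refl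

    locate : ∀ c k l r o {p v} → ViewW xs ts fl (l ◂ r) → length l + k ≡ p → (∀ i → i < p → fl i ≡ nothing) → fl p ≡ just v →
             Σ (Tape Gs) λ w′ → Σ (Tape Gs) λ o′ → w′ ≋ (l ◂ r) × pos w′ ≡ p ×
             Reach Y ∃Q (k + 1) (cz (loc c) (l ◂ r) o) (cz clr (put (wG (setFlag (just (just c)) (viewW (read w′)))) S w′) o′)
    locate c zero l r o {p} vw e before at = (l ◂ r) , _ , (λ _ → refl) , e₀ ,
      cstep (loc c) refl (loc-eq (trans (cong (λ z → proj₂ (proj₂ (proj₂ z))) (viewHead l r vw)) (trans (cong fl e₀) at))) done
      where
      e₀ : length l ≡ p
      e₀ = trans (sym (ℕ.+-identityʳ _)) e
    locate c (suc k) l r o {p} vw e before at with locate c k (hd r ∷ l) (tl r) (put (read o) S o) {p} (viewW-≋ (put-same □ R l r) vw)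
                                                 (trans (sym (ℕ.+-suc (length l) k)) e) before at
    ... | w′ , o′ , e′ , p′ , g = w′ , o′ , (λ i → trans (e′ i) (put-same □ R l r i)) , p′ ,
      cstep (loc c) refl (loc-eq (trans (cong (λ z → proj₂ (proj₂ (proj₂ z))) (viewHead l r vw))
        (before (length l) (ℕ.≤-trans (s≤s (ℕ.m≤m+n (length l) k)) (ℕ.≤-reflexive (trans (sym (ℕ.+-suc (length l) k)) e)))))) g

  setF : ℕ → Maybe (Maybe Bool) → Flags → Flags
  setF p f fl i with i ℕ.≟ p
  ... | yes _ = f
  ... | no  _ = fl i

  putFlag : ∀ {xs ts fl} f w → ViewW xs ts fl w →
            ViewW xs ts (setF (pos w) f fl) (put (wG (setFlag f (viewW (read w)))) S w)
  putFlag {xs} {ts} {fl} f (l ◂ r) vw = mkW go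
    where
    go : ∀ i → viewW (rd (full (put (wG (setFlag f (viewW (hd r)))) S (l ◂ r))) i) ≡ (isZ i , xs i , nth ts i , setF (length l) f fl i)
    go i with i ℕ.≟ length l
    ... | yes refl = trans (cong viewW (rd-set-same □ _ S (l ◂ r))) (cong (setFlag f) (viewHead l r vw))
    ... | no i≢    = trans (cong viewW (rd-set-other □ _ S (l ◂ r) i i≢)) (atW vw i)

  -- The head moves by at most one cell per step. This bounds the way back to the origin without
  -- following the head through the search.
  reach-pos : ∀ {n q c d} → Reach Y q n c d → pos (Zip.wk d) ≤ pos (Zip.wk c) + n
  reach-pos done = ℕ.m≤m+n _ _
  reach-pos {suc n} {c = c} (step {c′ = c′} e s g) = ℕ.≤-trans (reach-pos g) (ℕ.≤-trans (ℕ.+-monoˡ-≤ n (single _ s)) (ℕ.≤-reflexive (sym (ℕ.+-suc _ n))))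
    where
    moveH≤ : ∀ m k → moveH m k ≤ suc k
    moveH≤ L zero    = z≤n
    moveH≤ L (suc k) = ℕ.≤-trans (ℕ.n≤1+n k) (ℕ.n≤1+n _)
    moveH≤ S k       = ℕ.n≤1+n k
    moveH≤ R k       = ℕ.≤-refl
    single : ∀ es → map (zstep c) es ≡ c′ ∷ [] → pos (Zip.wk c′) ≤ suc (pos (Zip.wk c))
    single (e ∷ []) refl = ℕ.≤-trans (ℕ.≤-reflexive (pos-put _ (proj₁ (proj₂ (proj₂ e))) (Zip.wk c))) (moveH≤ (proj₁ (proj₂ (proj₂ e))) _)

length-decodeBy : ∀ {A : Set} (f : A → Maybe Bool) as → length (decodeBy f as) ≤ length as
length-decodeBy f [] = z≤n
length-decodeBy f (a ∷ as) with f a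
... | just b  = s≤s (length-decodeBy f as)
... | nothing = z≤n

-- Step-by-step simulation of the oracle machine

module Simulation (M : AOTM) (f h : Poly) (q₁ : Quant) where
  open AOTM M using (nQ; g; δ) renaming (kind to kindᴹ; start to startᴹ; qyes to qyesᴹ; qno to qnoᴹ)
  open Simulator M f h q₁
  open Lookup M f h q₁
  open ViewW
  open ViewO
  open Core simCore using (machine; rd; hd; read; zstep; ZConf)
  open Machine machine using (znext)
  module ZM = Machine (asMachine M)

  noFlag : Flags
  noFlag _ = nothing

  private
    keyAt : ∀ as r → (∀ i → proj₂ (viewO (rd r i)) ≡ rdᴹ as i) → KeyAt r (decodeBy sbit as)
    keyAt [] r e = cong sbit (e 0)
    keyAt (a ∷ as) r e with sbit a in eq
    ... | nothing = trans (cong sbit (e 0)) eq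
    ... | just c  = trans (cong sbit (e 0)) eq ,
      keyAt as (tl r) (λ i → trans (cong (λ z → proj₂ (viewO z)) (rd-tl □ r i)) (e (suc i)))

    vbStep : ∀ {xs xo ts fl r s k} → ViewW xs ts fl ([] ◂ r) → ViewO xo ([] ◂ s) → keyBit (hd s) ≡ k →
             δCS vb (hd r) (hd s) ≡ δvb true true k (hd r) (hd s) ∷ []
    vbStep {r = r} {s} vw vo refl rewrite cong proj₁ (atW vw 0) | cong proj₁ (atO vo 0) = refl

    atOrigin : ∀ {xs xo ts fl} y r s → ViewW xs ts fl ([] ◂ r) → ViewO xo ([] ◂ s) → KeyAt s y →
               Answered (1 + skipCost (length ts) y) vb ([] ◂ r) ([] ◂ s) (look ts y)
    atOrigin [] r s vw vo kh =
      answered _ _ (nf≋ [] r) (cstep vb refl (vbStep vw vo kh) done)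
    atOrigin (false ∷ y) r s vw vo (k , _) =
      answered _ _ (nf≋ [] r) (cstep vb refl (vbStep vw vo k) done)
    atOrigin {ts = ts} (true ∷ y) r s vw vo kh
      with skipping ts (true ∷ y) {wl = []} {ol = []} (tab-nf {r} {ts} (λ i → cong (λ z → proj₁ (proj₂ (proj₂ z))) (atW vw i))) (key-nf (true ∷ y) {s} kh)
    ... | answered w′ o′ e g = answered w′ o′ (λ i → trans (e i) (nf≋ [] r i)) (cstep vb refl (vbStep vw vo (proj₁ kh)) g)

  lookupCost : ℕ → ℕ → ℕ
  lookupCost P n = 1 + (n * (P + 5) + 2)

  queryCost : ℕ → ℕ → ℕ
  queryCost P n = 1 + (P + (lookupCost P n + ((lookupCost P n + 1) + ((P + 1) + 2))))

  private
    setF-same : ∀ p f fl → setF p f fl p ≡ f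
    setF-same p f fl with p ℕ.≟ p
    ... | yes _ = refl
    ... | no ¬e = ⊥-elim (¬e refl)

    setF-other : ∀ p f fl i → i ≢ p → setF p f fl i ≡ fl i
    setF-other p f fl i i≢ with i ℕ.≟ p
    ... | yes e = ⊥-elim (i≢ e)
    ... | no _  = refl

    setF-setF : ∀ p f f′ fl i → setF p f (setF p f′ fl) i ≡ setF p f fl i
    setF-setF p f f′ fl i with i ℕ.≟ p
    ... | yes _ = refl
    ... | no i≢ = setF-other p f′ fl i i≢

    setF-none : ∀ p i → setF p nothing noFlag i ≡ nothing
    setF-none p i with i ℕ.≟ p
    ... | yes _ = refl
    ... | no  _ = refl

    viewW-flags : ∀ {xs ts fl fl′ w} → (∀ i → fl i ≡ fl′ i) → ViewW xs ts fl w → ViewW xs ts fl′ w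
    viewW-flags e v = mkW λ i → trans (atW v i) (cong (λ z → _ , _ , _ , z) (e i))

  -- The flag alone preserves the head position: it is set before the heads are rewound, found again
  -- by `loc`, and removed after the erasing query. The work tape then looks as before, and the
  -- query tape is fresh.
  queryEv : ∀ {xs ts s w as o P t k v} → kindᴹ s ≡ query → ViewW xs ts noFlag w → ViewO (rdᴹ as) o →
    pos w ≤ P → pos o ≤ P → length as ≤ P →
    (∀ w″ → ViewW xs ts noFlag w″ → pos w″ ≡ pos w →
      Ev Y t k (just ∃Q) (cz (sim (if look ts (decodeBy sbit as) then qyesᴹ else qnoᴹ)) w″ ([] ◂ oG (true , zero) ∷ [])) v) →
    Ev Y (queryCost P (length ts) + t) k (just ∃Q) (cz (sim s) w o) v
  queryEv {xs} {ts} {s} {l ◂ r} {as} {m ◂ u} {P} {t} {k} {v} ks vw vo pw po las cont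
    with putFlag (just nothing) (l ◂ r) vw
  ... | vw₁ with rewindBoth P l (wG (setFlag (just nothing) (viewW (hd r))) ∷ tl r) m (oG (viewO (hd u)) ∷ tl u) vw₁ vo₁ pw po
    where
    vo₁ : ViewO (rdᴹ as) (m ◂ oG (viewO (hd u)) ∷ tl u)
    vo₁ = mkO go
      where
      go : ∀ i → viewO (rd (full (m ◂ oG (viewO (hd u)) ∷ tl u)) i) ≡ (isZ i , rdᴹ as i)
      go i with i ℕ.≟ length m
      ... | yes refl = trans (cong viewO (rd-set-same □ (oG (viewO (hd u))) S (m ◂ u))) (viewHeadO m u vo)
      ... | no i≢    = trans (cong viewO (rd-set-other □ (oG (viewO (hd u))) S (m ◂ u) i i≢)) (atO vo i)
  ... | r₂ , u₂ , ew , eo , g₂ with atOrigin (decodeBy sbit as) r₂ u₂ (viewW-≋ ew vw₁) vo₂ (keyAt as u₂ (λ i → cong proj₂ (atO vo₂ i)))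
    where
    vo₂ : ViewO (rdᴹ as) ([] ◂ u₂)
    vo₂ = mkO go
      where
      go : ∀ i → viewO (rd u₂ i) ≡ (isZ i , rdᴹ as i)
      go i with i ℕ.≟ length m
      ... | yes refl = trans (cong viewO (trans (eo i) (rd-set-same □ (oG (viewO (hd u))) S (m ◂ u)))) (viewHeadO m u vo)
      ... | no i≢    = trans (cong viewO (trans (eo i) (rd-set-other □ (oG (viewO (hd u))) S (m ◂ u) i i≢))) (atO vo i)
  ... | answered (l₃ ◂ r₃) o₃ e₃ g₃ with ansBack {xo = λ _ → zero} (look ts (decodeBy sbit as)) l₃ r₃ o₃ (viewW-≋ {w = [] ◂ r₂} e₃ (viewW-≋ ew vw₁))
  ... | r₄ , o₄ , e₄ , g₄ with locate {xo = λ _ → zero} (look ts (decodeBy sbit as)) (length l) [] r₄ o₄ {length l} {nothing} (viewW-≋ {w = l₃ ◂ r₃} e₄ (viewW-≋ {w = [] ◂ r₂} e₃ (viewW-≋ ew vw₁))) refl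
                                 (λ i i< → setF-other (length l) (just nothing) noFlag i (ℕ.<⇒≢ i<)) (setF-same (length l) (just nothing) noFlag)
  ... | l₅ ◂ r₅ , o₅ , e₅ , p₅ , g₅ =
    reach-ev-to (first ⨟ g₂ ⨟ g₃ ⨟ g₄ ⨟ g₅) cost-le
      (ev-query refl (ev-step refl refl final))
    where
    b = look ts (decodeBy sbit as)
    reach-ev-to : ∀ {n t t′ c d} → Reach Y ∃Q n c d → n + t ≤ t′ → Ev Y t k (just ∃Q) d v → Ev Y t′ k (just ∃Q) c v
    reach-ev-to g le e = ev-mono le ℕ.≤-refl (reach-ev g e)
    first : Reach Y ∃Q 1 (cz (sim s) (l ◂ r) (m ◂ u)) (cz vb (l ◂ wG (setFlag (just nothing) (viewW (hd r))) ∷ tl r) (m ◂ oG (viewO (hd u)) ∷ tl u))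
    first = cstep (sim s) (cong kindS ks) (cong (λ κ → δsim κ s (viewW (hd r)) (viewO (hd u))) ks) done
    len-y : length (decodeBy sbit as) ≤ P
    len-y = ℕ.≤-trans (length-decodeBy sbit as) las
    A≤ : 1 + skipCost (length ts) (decodeBy sbit as) ≤ lookupCost P (length ts)
    A≤ = s≤s (ℕ.+-monoˡ-≤ 2 (ℕ.*-monoʳ-≤ (length ts) (ℕ.+-monoˡ-≤ 5 len-y)))
    l₃≤ : length l₃ ≤ lookupCost P (length ts)
    l₃≤ = ℕ.≤-trans (reach-pos g₃) A≤
    cost-le : 1 + (P + (1 + skipCost (length ts) (decodeBy sbit as) + (length l₃ + 1 + (length l + 1)))) + suc (suc t) ≤ queryCost P (length ts) + t
    cost-le = ℕ.≤-trans (ℕ.+-monoˡ-≤ (suc (suc t)) (s≤s (ℕ.+-monoʳ-≤ P (ℕ.+-mono-≤ A≤ (ℕ.+-mono-≤ (ℕ.+-monoˡ-≤ 1 l₃≤) (ℕ.+-monoˡ-≤ 1 pw))))))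
      (ℕ.≤-reflexive (lem P (lookupCost P (length ts)) t))
      where
      lem : ∀ P A t → 1 + (P + (A + (A + 1 + (P + 1)))) + suc (suc t) ≡ 1 + (P + (A + ((A + 1) + ((P + 1) + 2)))) + t
      lem = solve-∀
    a₅ = wG (setFlag (just (just b)) (viewW (hd r₅)))
    vw₅ : ViewW xs ts (setF (length l₅) (just (just b)) (setF (length l) (just nothing) noFlag)) (l₅ ◂ a₅ ∷ tl r₅)
    vw₅ = putFlag (just (just b)) (l₅ ◂ r₅) (viewW-≋ {w = [] ◂ r₄} e₅ (viewW-≋ {w = l₃ ◂ r₃} e₄ (viewW-≋ {w = [] ◂ r₂} e₃ (viewW-≋ ew vw₁))))
    vw₆ : ViewW xs ts noFlag (l₅ ◂ wG (setFlag nothing (viewW a₅)) ∷ tl r₅)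
    vw₆ = viewW-flags (λ i → trans (setF-setF (length l₅) nothing (just (just b)) _ i)
                      (trans (cong (λ p → setF (length l₅) nothing (setF p (just nothing) noFlag) i) (sym p₅))
                      (trans (setF-setF (length l₅) nothing (just nothing) noFlag i) (setF-none (length l₅) i))))
                    (putFlag nothing (l₅ ◂ a₅ ∷ tl r₅) vw₅)
    resume-if : ∀ c → resume (just (just c)) ≡ (if c then qyesᴹ else qnoᴹ)
    resume-if true  = refl
    resume-if false = refl
    final : Ev Y t k (just ∃Q) (cz (sim (resume (just (just b)))) (l₅ ◂ wG (setFlag nothing (viewW a₅)) ∷ tl r₅) ([] ◂ oG (true , zero) ∷ [])) v
    final = subst (λ z → Ev Y t k (just ∃Q) (cz (sim z) (l₅ ◂ wG (setFlag nothing (viewW a₅)) ∷ tl r₅) ([] ◂ oG (true , zero) ∷ [])) v)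
      (sym (resume-if b)) (cont _ vw₆ p₅)

  private
    putViewW : ∀ {ts} {tᴹ : Tape (Sym g)} {w} a m → ViewW (rdᴹ (full tᴹ)) ts noFlag w → pos w ≡ pos tᴹ →
               ViewW (rdᴹ (full (put a m tᴹ))) ts noFlag (put (wG (isZ (pos w) , a , nth ts (pos w) , nothing)) m w)
    putViewW {ts} {tᴹ} {w} a m vw p = mkW go
      where
      go : ∀ i → viewW (rd (full (put (wG (isZ (pos w) , a , nth ts (pos w) , nothing)) m w)) i) ≡ (isZ i , rdᴹ (full (put a m tᴹ)) i , nth ts i , nothing)
      go i with i ℕ.≟ pos w
      ... | yes refl = trans (cong viewW (rd-set-same □ _ m w)) (cong (λ z → isZ (pos w) , z , nth ts (pos w) , nothing)
                         (sym (trans (cong (rdᴹ (full (put a m tᴹ))) p) (rd-set-same zero a m tᴹ))))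
      ... | no i≢    = trans (cong viewW (rd-set-other □ _ m w i i≢)) (trans (atW vw i) (cong (λ z → isZ i , z , nth ts i , nothing)
                         (sym (rd-set-other zero a m tᴹ i (λ e → i≢ (trans e (sym p)))))))

    putViewO : ∀ {tᴹ : Tape (Sym g)} {o} a m → ViewO (rdᴹ (full tᴹ)) o → pos o ≡ pos tᴹ →
               ViewO (rdᴹ (full (put a m tᴹ))) (put (oG (isZ (pos o) , a)) m o)
    putViewO {tᴹ} {o} a m vo p = mkO go
      where
      go : ∀ i → viewO (rd (full (put (oG (isZ (pos o) , a)) m o)) i) ≡ (isZ i , rdᴹ (full (put a m tᴹ)) i)
      go i with i ℕ.≟ pos o
      ... | yes refl = trans (cong viewO (rd-set-same □ _ m o)) (cong (λ z → isZ (pos o) , z)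
                         (sym (trans (cong (rdᴹ (full (put a m tᴹ))) p) (rd-set-same zero a m tᴹ))))
      ... | no i≢    = trans (cong viewO (rd-set-other □ _ m o i i≢)) (trans (atO vo i) (cong (λ z → isZ i , z)
                         (sym (rd-set-other zero a m tᴹ i (λ e → i≢ (trans e (sym p)))))))

    pos-put≡ : ∀ {A B : Set} {a : A} {b : B} {m t u} → pos t ≡ pos u → pos (put a m t) ≡ pos (put b m u)
    pos-put≡ {a = a} {b} {m} {t} {u} e = trans (pos-put a m t) (trans (cong (moveH m) e) (sym (pos-put b m u)))

    freshO : ViewO (rdᴹ []) ([] ◂ oG (true , zero) ∷ [])
    freshO = mkO λ { zero → refl ; (suc i) → refl }

  module _ (O : Lang) (ts : List TS) (P : ℕ) (agree : ∀ y → length y ≤ P → O y ≡ look ts y) where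

    record Sim (z : ZM.ZConf) (w o : Tape Gs) : Set where
      constructor simR
      field
        work  : ViewW (rdᴹ (full (Zip.wk z))) ts noFlag w
        wpos  : pos w ≡ pos (Zip.wk z)
        otape : ViewO (rdᴹ (full (Zip.ot z))) o
        opos  : pos o ≡ pos (Zip.ot z)

    private
      QC : ℕ
      QC = queryCost P (length ts)

      -- A step lengthens a tape by at most one cell, so this is an invariant. It keeps queries
      -- within length `P`, where `agree` applies.
      fits : ℕ → ZM.ZConf → Set
      fits t z = length (full (Zip.wk z)) + t ≤ P × length (full (Zip.ot z)) + t ≤ P

      fits-put : ∀ (a : Sym g) m tᴹ {t} → length (full tᴹ) + suc t ≤ P → length (full (put a m tᴹ)) + t ≤ P
      fits-put a m tᴹ {t} le = ℕ.≤-trans (ℕ.+-monoˡ-≤ t (length-put a m tᴹ)) (ℕ.≤-trans (ℕ.≤-reflexive (sym (ℕ.+-suc _ t))) le)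

      conv : Tape Gs → Tape Gs → ZM.Trans → (Pre (Core.C simCore) ⊎ CS) × Gs × Move × Gs × Move
      conv w o (s , a , m , b , m′) = inj₂ (sim s) , wG (isZ (pos w) , a , nth ts (pos w) , nothing) , m , oG (isZ (pos o) , b) , m′

      next≡ : ∀ {q s wᴹ oᴹ w o} → kindᴹ s ≡ quant q → Sim (zc s wᴹ oᴹ) w o →
              znext (cz (sim s) w o) ≡ map (zstep (cz (sim s) w o)) (map (conv w o) (δ s (ZM.read wᴹ) (ZM.read oᴹ)))
      next≡ {q} {s} {lᴹ ◂ rᴹ} {mᴹ ◂ uᴹ} {l ◂ r} {m ◂ u} ks (simR vw wp vo op)
        rewrite ks | viewHead l r vw | viewHeadO m u vo =
        cong (map (zstep (cz (sim s) (l ◂ r) (m ◂ u))))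
          (trans (sym (map-∘ _)) (cong₂ (λ a b → map (conv (l ◂ r) (m ◂ u)) (δ s a b))
            (trans (cong (rdᴹ (lᴹ ʳ++ rᴹ)) wp) (rd-head zero lᴹ rᴹ)) (trans (cong (rdᴹ (mᴹ ʳ++ uᴹ)) op) (rd-head zero mᴹ uᴹ))))

    -- Each step of `M` is charged `QC` steps and one alternation, because queries are worked out in
    -- existential states that may alternate with the branching around them. The crude count is good
    -- enough for a polynomial `t`.
    simulate : ∀ {t k p z v w o} → Ev (ZM.zsys O) t k p z v → Sim z w o → fits t z →
               ∀ p′ → Ev Y (t * QC) t p′ (cz (sim (Zip.stz z)) w o) v
    simulates : ∀ {t k q z w o es vs} → Pointwise (Ev (ZM.zsys O) t k (just q)) (map (ZM.zstep z) es) vs → Sim z w o → fits (suc t) z →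
                Pointwise (Ev Y (t * QC) t (just q)) (map (zstep (cz (sim (Zip.stz z)) w o)) (map (conv w o) es)) vs
    simulate {z = zc s wᴹ oᴹ} (ev-accept e) r ft p′ = ev-accept (cong kindS e)
    simulate {z = zc s wᴹ oᴹ} (ev-reject e) r ft p′ = ev-reject (cong kindS e)
    simulate {suc t} {k} {z = zc s wᴹ oᴹ} {v} {w} {o} (ev-query e g) r@(simR vw wp vo op) (fw , fo) p′ =
      ev-prev (queryEv {as = full oᴹ} e vw vo
        (ℕ.≤-trans (ℕ.≤-reflexive wp) (ℕ.≤-trans (pos≤length wᴹ) (ℕ.m+n≤o⇒m≤o _ fw)))
        (ℕ.≤-trans (ℕ.≤-reflexive op) (ℕ.≤-trans (pos≤length oᴹ) lo))
        lo
        (λ w″ vw″ p″ → subst (λ c → Ev Y (t * QC) t (just ∃Q) (cz (sim (if c then qyesᴹ else qnoᴹ)) w″ ([] ◂ oG (true , zero) ∷ [])) v)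
          (agree _ (ℕ.≤-trans (length-decodeBy sbit (full oᴹ)) lo))
          (simulate g (simR vw″ (trans p″ wp) freshO refl)
            (ℕ.≤-trans (ℕ.+-monoʳ-≤ _ (ℕ.n≤1+n t)) fw , ℕ.≤-trans (ℕ.n≤1+n t) (ℕ.m+n≤o⇒n≤o _ fo)) (just ∃Q))))
      where
      lo : length (full oᴹ) ≤ P
      lo = ℕ.m+n≤o⇒m≤o _ fo
    simulate {suc t} {z = z@(zc s wᴹ oᴹ)} {v} {w} {o} (ev-branch {bs = bs} q e j≤ gs fe) r ft p′ =
      ev-mono (ℕ.+-monoˡ-≤ (t * QC) (s≤s z≤n)) ℕ.≤-refl
        (ev-branch q (cong kindS e) (ℕ.+-monoˡ-≤ t (switch≤1 p′ q))
          (subst (λ cs → Pointwise (Ev Y (t * QC) t (just q)) cs bs) (sym (next≡ e r)) (simulates gs r ft)) fe)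
    simulates {es = []} [] r ft = []
    simulates {z = zc s wᴹ oᴹ} {es = (s′ , a , m , b , m′) ∷ es} (g ∷ gs) r@(simR vw wp vo op) ft@(fw , fo) =
      simulate g (simR (putViewW a m vw wp) (pos-put≡ {m = m} wp) (putViewO b m′ vo op) (pos-put≡ {m = m′} op))
        (fits-put a m wᴹ fw , fits-put b m′ oᴹ fo) _ ∷ simulates {es = es} gs r ft

-- Languages as tables

-- Every word over `GS` denotes some language, so ill-formed guesses need no check, whichever player
-- made them.
langOf : List GS → Lang
langOf seg = scan (map sym′ seg)

trackOf : List (List GS) → List TS
trackOf []           = []
trackOf (seg ∷ segs) = hash ∷ map sym′ seg ++ trackOf segs

-- Both loops treat a `hash` like the end of the table, which keeps neighbouring segments apart.
scan-stop : ∀ u {v} y → scan (map sym′ u ++ hash ∷ v) y ≡ scan (map sym′ u) y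
cmp-stop  : ∀ u {v} y y₀ → cmp (map sym′ u ++ hash ∷ v) y y₀ ≡ cmp (map sym′ u) y y₀
scan-stop []         y = refl
scan-stop (tb b ∷ u) y = scan-stop u y
scan-stop (comma ∷ u) y = cmp-stop u y y
scan-stop (dot ∷ u)  y = scan-stop u y
cmp-stop []          []      y₀ = refl
cmp-stop []          (c ∷ y) y₀ = refl
cmp-stop (tb b ∷ u)  []      y₀ = scan-stop u y₀
cmp-stop (tb b ∷ u)  (c ∷ y) y₀ with boolEq b c
... | true  = cmp-stop u y y₀
... | false = scan-stop u y₀
cmp-stop (comma ∷ u) []      y₀ = refl
cmp-stop (comma ∷ u) (c ∷ y) y₀ = scan-stop (comma ∷ u) y₀
cmp-stop (dot ∷ u)   []      y₀ = refl
cmp-stop (dot ∷ u)   (c ∷ y) y₀ = scan-stop u y₀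

scan-track : ∀ u segs y → scan (map sym′ u ++ trackOf segs) y ≡ langOf u y
scan-track u []           y = cong (λ z → scan z y) (++-identityʳ (map sym′ u))
scan-track u (seg ∷ segs) y = scan-stop u y

tupleAux-[] : ∀ i s → tupleAux [] (suc i) s ≡ false
tupleAux-[] i []          = refl
tupleAux-[] i (true ∷ s)  = tupleAux-[] (suc i) s
tupleAux-[] i (false ∷ s) = refl

tupleAux-∷ : ∀ B Bs i s → tupleAux (B ∷ Bs) (suc (suc i)) s ≡ tupleAux Bs (suc i) s
tupleAux-∷ B Bs i []          = refl
tupleAux-∷ B Bs i (true ∷ s)  = tupleAux-∷ B Bs (suc i) s
tupleAux-∷ B Bs i (false ∷ s) = refl

skip-[] : ∀ r → skip r [] ≡ false
skip-[] []      = refl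
skip-[] (t ∷ r) = refl

skip-false : ∀ r y → skip r (false ∷ y) ≡ scan r y
skip-false []      y = refl
skip-false (t ∷ r) y = refl

skip-bits : ∀ u r s → skip (map sym′ u ++ r) (true ∷ s) ≡ skip r (true ∷ s)
skip-bits []      r s = refl
skip-bits (t ∷ u) r s = skip-bits u r s

skip-track : ∀ u segs s → skip (map sym′ u ++ trackOf segs) s ≡ tupleAux (map langOf (u ∷ segs)) 1 s
skip-track u segs []          = skip-[] (map sym′ u ++ trackOf segs)
skip-track u segs (false ∷ y) = trans (skip-false (map sym′ u ++ trackOf segs) y) (scan-track u segs y)
skip-track u segs (true ∷ s)  = trans (skip-bits u (trackOf segs) s) (trans (go segs) (sym (tupleAux-∷ (langOf u) (map langOf segs) 0 s)))
  where
  go : ∀ segs → skip (trackOf segs) (true ∷ s) ≡ tupleAux (map langOf segs) 1 s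
  go []           = sym (tupleAux-[] 0 s)
  go (seg ∷ segs) = skip-track seg segs s

look-track : ∀ segs s → look (trackOf segs) s ≡ tupleOracle (map langOf segs) s
look-track segs []          = refl
look-track segs (false ∷ s) = refl
look-track []   (true ∷ s)  = sym (tupleAux-[] 0 s)
look-track (seg ∷ segs) (true ∷ s) = skip-track seg segs s

AgreeUpTo : ℕ → Lang → Lang → Set
AgreeUpTo P B B′ = ∀ y → length y ≤ P → B y ≡ B′ y

-- A component is asked about a suffix of the query, so the same length bound serves.
tuple-agree : ∀ {P Bs Cs} → Pointwise (AgreeUpTo P) Bs Cs → AgreeUpTo P (tupleOracle Bs) (tupleOracle Cs)
tuple-agree {P} h y = go 0 y h
  where
  lookup-agree : ∀ {Bs Cs} i y → Pointwise (AgreeUpTo P) Bs Cs → length y ≤ P → lookupL Bs i y ≡ lookupL Cs i y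
  lookup-agree i       y []      le = refl
  lookup-agree zero    y (h ∷ _) le = h y le
  lookup-agree (suc i) y (_ ∷ h) le = lookup-agree i y h le
  go : ∀ {Bs Cs} i y → Pointwise (AgreeUpTo P) Bs Cs → length y ≤ P → tupleAux Bs i y ≡ tupleAux Cs i y
  go i       []          h le = refl
  go i       (true ∷ y)  h le = go (suc i) y h (ℕ.≤-trans (ℕ.n≤1+n _) le)
  go zero    (false ∷ y) h le = refl
  go (suc i) (false ∷ y) h le = lookup-agree i y h (ℕ.≤-trans (ℕ.n≤1+n _) le)

strEq : Str → Str → Bool
strEq []      []      = true
strEq (b ∷ u) (c ∷ v) = boolEq b c ∧ strEq u v
strEq _       _       = false

boolEq-refl : ∀ b → boolEq b b ≡ true
boolEq-refl true  = refl
boolEq-refl false = refl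

boolEq-sound : ∀ b c → boolEq b c ≡ true → b ≡ c
boolEq-sound true  true  _ = refl
boolEq-sound false false _ = refl

strEq-refl : ∀ u → strEq u u ≡ true
strEq-refl []      = refl
strEq-refl (b ∷ u) = cong₂ _∧_ (boolEq-refl b) (strEq-refl u)

strEq-sound : ∀ u v → strEq u v ≡ true → u ≡ v
strEq-sound []      []      e = refl
strEq-sound (b ∷ u) (c ∷ v) e with boolEq b c in eq
... | true = cong₂ _∷_ (boolEq-sound b c eq) (strEq-sound u v e)

entries : Lang → List Str → List GS → List GS
entries B []       z = z
entries B (y ∷ ys) z = if B y then comma ∷ map tb y ++ entries B ys z else entries B ys z

private
  data NonBit : List GS → Set where
    nb-[]    : NonBit []
    nb-comma : ∀ {u} → NonBit (comma ∷ u)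
    nb-dot   : ∀ {u} → NonBit (dot ∷ u)

  scan-bits : ∀ u r y → scan (map sym′ (map tb u ++ r)) y ≡ scan (map sym′ r) y
  scan-bits []      r y = refl
  scan-bits (b ∷ u) r y = scan-bits u r y

  -- An entry ends where the bits end; if `r` began with a bit, the entry would run on into it.
  -- After a mismatch the search passes over the remaining bits of `u`.
  cmp-entry : ∀ u v r y → NonBit r → cmp (map sym′ (map tb u ++ r)) v y ≡ strEq u v ∨ scan (map sym′ r) y
  cmp-entry []      []      _ y nb-[]    = refl
  cmp-entry []      []      _ y nb-comma = refl
  cmp-entry []      []      _ y nb-dot   = refl
  cmp-entry []      (c ∷ v) _ y nb-[]    = refl
  cmp-entry []      (c ∷ v) _ y nb-comma = refl
  cmp-entry []      (c ∷ v) _ y nb-dot   = refl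
  cmp-entry (b ∷ u) []      r y n = scan-bits u r y
  cmp-entry (b ∷ u) (c ∷ v) r y n with boolEq b c
  ... | true  = cmp-entry u v r y n
  ... | false = scan-bits u r y

  scan-dots : ∀ k y → scan (map sym′ (replicate k dot)) y ≡ false
  scan-dots zero    y = refl
  scan-dots (suc k) y = scan-dots k y

  nonBit-dots : ∀ k → NonBit (replicate k dot)
  nonBit-dots zero    = nb-[]
  nonBit-dots (suc k) = nb-dot

  nonBit-entries : ∀ B ys {z} → NonBit z → NonBit (entries B ys z)
  nonBit-entries B []       n = n
  nonBit-entries B (y ∷ ys) n with B y
  ... | true  = nb-comma
  ... | false = nonBit-entries B ys n

scan-entries : ∀ B ys k y → langOf (entries B ys (replicate k dot)) y ≡ anyL (λ u → B u ∧ strEq u y) ys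
scan-entries B []       k y = scan-dots k y
scan-entries B (u ∷ ys) k y with B u
... | false = scan-entries B ys k y
... | true  = trans (cmp-entry u y _ y (nonBit-entries B ys (nonBit-dots k))) (cong (strEq u y ∨_) (scan-entries B ys k y))

strings : ℕ → List Str
strings zero    = [] ∷ []
strings (suc P) = [] ∷ map (true ∷_) (strings P) ++ map (false ∷_) (strings P)

strings-complete : ∀ P y → length y ≤ P → y ∈ strings P
strings-complete zero    []          le = here refl
strings-complete (suc P) []          le = here refl
strings-complete (suc P) (true ∷ y)  (s≤s le) = there (∈-++⁺ˡ (∈-map⁺ (true ∷_) (strings-complete P y le)))
strings-complete (suc P) (false ∷ y) (s≤s le) = there (∈-++⁺ʳ (map (true ∷_) (strings P)) (∈-map⁺ (false ∷_) (strings-complete P y le)))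

any-entries : ∀ (B : Lang) (ys : List Str) y → y ∈ ys → anyL (λ u → B u ∧ strEq u y) ys ≡ B y
any-entries B ys y y∈ = go (B y) refl
  where
  found : B y ≡ true → ∀ ys → y ∈ ys → anyL (λ u → B u ∧ strEq u y) ys ≡ true
  found By (u ∷ ys) (here refl) rewrite By | strEq-refl y = refl
  found By (u ∷ ys) (there i) = trans (cong ((B u ∧ strEq u y) ∨_) (found By ys i)) (Bool.∨-zeroʳ _)
  none : B y ≡ false → ∀ ys → anyL (λ u → B u ∧ strEq u y) ys ≡ false
  none By []       = refl
  none By (u ∷ ys) with B u in Bu
  ... | false = none By ys
  ... | true with strEq u y in eq
  ...   | false = none By ys
  ...   | true with () ← trans (sym Bu) (trans (cong B (strEq-sound u y eq)) By)
  go : ∀ b → B y ≡ b → anyL (λ u → B u ∧ strEq u y) ys ≡ B y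
  go true  By = trans (found By ys y∈) (sym By)
  go false By = trans (none By ys) (sym By)

length-entries : ∀ B ys P z → (∀ y → y ∈ ys → length y ≤ P) → length (entries B ys z) ≤ length ys * suc P + length z
length-entries B []       P z h = ℕ.≤-refl
length-entries B (y ∷ ys) P z h with B y
... | false = ℕ.≤-trans (length-entries B ys P z (λ u i → h u (there i))) (ℕ.+-monoˡ-≤ _ (ℕ.m≤n+m _ (suc P)))
... | true = ℕ.≤-trans (s≤s (ℕ.≤-reflexive (trans (length-++ (map tb y)) (cong (_+ _) (length-map tb y)))))
  (ℕ.≤-trans (s≤s (ℕ.+-mono-≤ (h y (here refl)) (length-entries B ys P z (λ u i → h u (there i)))))
    (ℕ.≤-reflexive (sym (ℕ.+-assoc (suc P) (length ys * suc P) (length z)))))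

entries-++ : ∀ B ys z → entries B ys z ≡ entries B ys [] ++ z
entries-++ B []       z = refl
entries-++ B (y ∷ ys) z with B y
... | false = entries-++ B ys z
... | true  = cong (comma ∷_) (trans (cong (map tb y ++_) (entries-++ B ys z)) (sym (++-assoc (map tb y) _ z)))

strings-short : ∀ P y → y ∈ strings P → length y ≤ P
strings-short zero y (here refl) = z≤n
strings-short (suc P) y (here refl) = z≤n
strings-short (suc P) y (there i) with ∈-++⁻ (map (true ∷_) (strings P)) i
... | inj₁ j with ∈-map⁻ (true ∷_) j
...   | u , u∈ , refl = s≤s (strings-short P u u∈)
strings-short (suc P) y (there i) | inj₂ j with ∈-map⁻ (false ∷_) j
...   | u , u∈ , refl = s≤s (strings-short P u u∈)

length-strings : ∀ P → suc (length (strings P)) ≡ 2 ^ suc P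
length-strings zero    = refl
length-strings (suc P) = trans (cong (λ z → suc (suc z)) (trans (length-++ (map (true ∷_) (strings P)))
    (cong₂ _+_ (length-map _ (strings P)) (length-map _ (strings P)))))
  (trans (lem (length (strings P))) (cong (2 *_) (length-strings P)))
  where
  lem : ∀ n → suc (suc (n + n)) ≡ 2 * suc n
  lem = solve-∀

-- There are fewer than 2^(P+1) strings of length at most `P`, and an entry has at most P+1 <
-- 2^(P+1) symbols. The product gives the condition on `k`; dots fill the rest.
tabulateLang : ∀ P k B → 2 * suc P ≤ k → Σ (List GS) λ seg → length seg ≡ 2 ^ k × AgreeUpTo P B (langOf seg)
tabulateLang P k B le = entries B (strings P) (replicate pad dot) , len ,
  λ y y≤ → sym (trans (scan-entries B (strings P) pad y) (any-entries B (strings P) y (strings-complete P y y≤)))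
  where
  n = length (entries B (strings P) [])
  pad = 2 ^ k ∸ n
  n≤ : n ≤ 2 ^ k
  n≤ = ℕ.≤-trans (length-entries B (strings P) P [] (strings-short P))
    (ℕ.≤-trans (ℕ.≤-reflexive (ℕ.+-identityʳ _))
    (ℕ.≤-trans (ℕ.*-mono-≤ (ℕ.≤-trans (ℕ.n≤1+n _) (ℕ.≤-reflexive (length-strings P))) (ℕ.<⇒≤ (n<2^n (suc P))))
    (ℕ.≤-trans (ℕ.≤-reflexive (sym (ℕ.^-distribˡ-+-* 2 (suc P) (suc P))))
      (ℕ.^-monoʳ-≤ 2 (ℕ.≤-trans (ℕ.≤-reflexive (cong (suc P +_) (sym (ℕ.+-identityʳ (suc P))))) le)))))
  len : length (entries B (strings P) (replicate pad dot)) ≡ 2 ^ k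
  len = trans (cong length (entries-++ B (strings P) (replicate pad dot)))
    (trans (length-++ (entries B (strings P) [])) (trans (cong (n +_) (length-replicate pad)) (ℕ.m+[n∸m]≡n n≤)))

-- Guessing the tables under a binary counter

GuessP : Quant → ℕ → (List GS → Set) → Set
GuessP ∃Q n K = Σ (List GS) λ seg → length seg ≡ n × K seg
GuessP ∀Q n K = ∀ seg → length seg ≡ n → K seg

SegP : Quant → ℕ → ℕ → (List TS → Set) → List TS → Set
SegP q zero    n F ts = F ts
SegP q (suc j) n F ts = GuessP q n λ seg → SegP (dual q) j n F (ts ++ hash ∷ map sym′ seg)

-- The cells of the block double as a binary counter, least significant bit first; the
-- cells marked true count the segments instead and are skipped by the counter.
data Cc : Set where
  cb cm : Bool → Cc

incC : List Cc → Bool × List Cc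
incC []              = true , []
incC (cb false ∷ cs) = false , cb true ∷ cs
incC (cb true ∷ cs)  = proj₁ (incC cs) , cb false ∷ proj₂ (incC cs)
incC (cm u ∷ cs)     = proj₁ (incC cs) , cm u ∷ proj₂ (incC cs)

valC bitsC unused : List Cc → ℕ
valC []          = 0
valC (cb b ∷ cs) = b→ℕ b + 2 * valC cs
valC (cm u ∷ cs) = valC cs

bitsC []          = 0
bitsC (cb b ∷ cs) = suc (bitsC cs)
bitsC (cm u ∷ cs) = bitsC cs

unused []              = 0
unused (cm false ∷ cs) = suc (unused cs)
unused (_ ∷ cs)        = unused cs

inc-step : ∀ cs → proj₁ (incC cs) ≡ false → valC (proj₂ (incC cs)) ≡ suc (valC cs)
inc-step (cb false ∷ cs) e = refl
inc-step (cb true ∷ cs)  e = trans (cong (2 *_) (inc-step cs e)) (cong suc (ℕ.+-suc (valC cs) (valC cs + 0)))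
inc-step (cm u ∷ cs)     e = inc-step cs e

-- Overflow happens at the largest value only and leaves zero. Hence a segment has as many symbols
-- as the counter has values, and the counter is ready for the next one.
inc-overflow : ∀ cs → proj₁ (incC cs) ≡ true → suc (valC cs) ≡ 2 ^ bitsC cs × valC (proj₂ (incC cs)) ≡ 0
inc-overflow []              e = refl , refl
inc-overflow (cb true ∷ cs)  e with inc-overflow cs e
... | f , z = trans (lem (valC cs)) (cong (2 *_) f) , cong (2 *_) z
  where
  lem : ∀ n → suc (1 + 2 * n) ≡ 2 * suc n
  lem = solve-∀
inc-overflow (cm u ∷ cs)     e = inc-overflow cs e

valC< : ∀ cs → suc (valC cs) ≤ 2 ^ bitsC cs
valC< []          = s≤s z≤n
valC< (cb b ∷ cs) = ℕ.≤-trans (ℕ.≤-trans (s≤s (ℕ.+-monoˡ-≤ _ (b≤ b))) (ℕ.≤-reflexive (lem (valC cs)))) (ℕ.*-monoʳ-≤ 2 (valC< cs))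
  where
  b≤ : ∀ b → b→ℕ b ≤ 1
  b≤ true  = ℕ.≤-refl
  b≤ false = z≤n
  lem : ∀ n → suc (1 + 2 * n) ≡ 2 * suc n
  lem = solve-∀
valC< (cm u ∷ cs) = valC< cs

inc-bits : ∀ cs → bitsC (proj₂ (incC cs)) ≡ bitsC cs
inc-bits []              = refl
inc-bits (cb false ∷ cs) = refl
inc-bits (cb true ∷ cs)  = cong suc (inc-bits cs)
inc-bits (cm u ∷ cs)     = inc-bits cs

inc-unused : ∀ cs → unused (proj₂ (incC cs)) ≡ unused cs
inc-unused []              = refl
inc-unused (cb false ∷ cs) = refl
inc-unused (cb true ∷ cs)  = inc-unused cs
inc-unused (cm false ∷ cs) = cong suc (inc-unused cs)
inc-unused (cm true ∷ cs)  = inc-unused cs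

inc-length : ∀ cs → length (proj₂ (incC cs)) ≡ length cs
inc-length []              = refl
inc-length (cb false ∷ cs) = refl
inc-length (cb true ∷ cs)  = cong suc (inc-length cs)
inc-length (cm u ∷ cs)     = cong suc (inc-length cs)

module Guessing (M : AOTM) (f h : Poly) (q₁ : Quant) where
  open AOTM M using (nQ; g; δ) renaming (kind to kindᴹ; start to startᴹ; qyes to qyesᴹ; qno to qnoᴹ)
  open Simulator M f h q₁
  open Lookup M f h q₁
  open Simulation M f h q₁
  open ViewW
  open ViewO
  open Core simCore using (machine; rd; hd; read; zstep; ZConf)

  Blank : List Gs → Set
  Blank ts = ∀ i → rd ts i ≡ □

  blank-tl : ∀ {ts} → Blank ts → Blank (□ ∷ tl ts)
  blank-tl h zero    = refl
  blank-tl {ts} h (suc i) = trans (rd-tl □ ts i) (h (suc i))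

  cellG : Cc → Gs
  cellG (cb false) = ext (mk false)
  cellG (cb true)  = ext (core one)
  cellG (cm false) = ext (mk true)
  cellG (cm true)  = ext (core used)

  cells : List Cc → List Gs
  cells = map cellG

  lendG : Gs
  lendG = ext lend

  private
    module BackTo (s t : CS) (q : Quant) (ks : kindCS s ≡ quant q)
                  (δc : ∀ a c → δCS s a (cellG c) ≡ (s , a , S , cellG c , L) ∷ [])
                  (δl : ∀ a → δCS s a lendG ≡ (t , a , S , lendG , R) ∷ []) where
      backTo : ∀ ds h l r {or} → Reach Y q (length ds + 1)
               (cz s (l ◂ r) (put h L (cells ds ++ lendG ∷ [] ◂ or)))
               (cz t (nf (l ◂ r)) (lendG ∷ [] ◂ cells ds ʳ++ (h ∷ tl or)))
      backTo []       h l r = cstep s ks (δl (hd r)) done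
      backTo (d ∷ ds) h l r {or} = cstep s ks (δc (hd r) d) (backTo ds (cellG d) l (hd r ∷ tl r) {or = cellG d ∷ h ∷ tl or})

    retTo : ∀ q → _
    retTo q = BackTo.backTo (ret q) (guess q) q refl
      (λ { a (cb false) → refl ; a (cb true) → refl ; a (cm false) → refl ; a (cm true) → refl }) (λ a → refl)

    overTo : ∀ q → _
    overTo q = BackTo.backTo (over q) (find (dual q)) q refl
      (λ { a (cb false) → refl ; a (cb true) → refl ; a (cm false) → refl ; a (cm true) → refl }) (λ a → refl)

    cells-ʳ++ : ∀ ds cs ts → cells ds ʳ++ (cells cs ++ ts) ≡ cells (ds ʳ++ cs) ++ ts
    cells-ʳ++ []       cs ts = refl
    cells-ʳ++ (d ∷ ds) cs ts = cells-ʳ++ ds (d ∷ cs) ts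

  incrStep : ∀ q cs ds l r {tso} → proj₁ (incC cs) ≡ false → Blank tso →
    Reach Y q (2 * length cs + length ds + 2)
      (cz (incr q) (l ◂ r) (cells ds ++ lendG ∷ [] ◂ cells cs ++ tso))
      (cz (guess q) (nf (l ◂ r)) (lendG ∷ [] ◂ cells (ds ʳ++ proj₂ (incC cs)) ++ tso))
  incrStep q (cb false ∷ cs) ds l r {tso} e bl = reach-mono (≤-split (lem (length cs) (length ds)))
    (reach-cong refl refl (cong (λ z → cz (guess q) (nf (l ◂ r)) (lendG ∷ [] ◂ z)) (cells-ʳ++ ds (cb true ∷ cs) tso))
      (cstep (incr q) refl refl (retTo q ds (ext (core one)) l (hd r ∷ tl r))))
    where
    lem : ∀ n m → 2 * suc n + m + 2 ≡ suc (m + 1) + (2 * n + 2)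
    lem = solve-∀
  incrStep q (cb true ∷ cs) ds l r {tso} e bl = reach-mono (ℕ.≤-reflexive (lem (length cs) (length ds)))
    (cstep (incr q) refl refl (incrStep q cs (cb false ∷ ds) l (hd r ∷ tl r) e bl))
    where
    lem : ∀ n m → suc (2 * n + suc m + 2) ≡ 2 * suc n + m + 2
    lem = solve-∀
  incrStep q (cm u ∷ cs) ds l r {tso} e bl = reach-mono (ℕ.≤-reflexive (lem (length cs) (length ds)))
    (cstep (incr q) refl (eq u) (incrStep q cs (cm u ∷ ds) l (hd r ∷ tl r) e bl))
    where
    eq : ∀ u {a} → δCS (incr q) a (cellG (cm u)) ≡ (incr q , a , S , cellG (cm u) , R) ∷ []
    eq true  = refl
    eq false = refl
    lem : ∀ n m → suc (2 * n + suc m + 2) ≡ 2 * suc n + m + 2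
    lem = solve-∀

  incrOver : ∀ q cs ds l r {tso} → proj₁ (incC cs) ≡ true → Blank tso →
    Reach Y q (2 * length cs + length ds + 2)
      (cz (incr q) (l ◂ r) (cells ds ++ lendG ∷ [] ◂ cells cs ++ tso))
      (cz (find (dual q)) (nf (l ◂ r)) (lendG ∷ [] ◂ cells (ds ʳ++ proj₂ (incC cs)) ++ □ ∷ tl tso))
  incrOver q [] ds l r {tso} e bl = reach-mono (ℕ.≤-reflexive (lem (length ds)))
    (reach-cong refl refl (cong (λ z → cz (find (dual q)) (nf (l ◂ r)) (lendG ∷ [] ◂ z)) (cells-ʳ++ ds [] (□ ∷ tl tso)))
      (cstep (incr q) refl (cong (λ b → δ1 (incr q) (hd r) b ∷ []) (bl 0)) (overTo q ds □ l (hd r ∷ tl r) {tso})))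
    where
    lem : ∀ m → suc (m + 1) ≡ m + 2
    lem = solve-∀
  incrOver q (cb true ∷ cs) ds l r {tso} e bl = reach-mono (ℕ.≤-reflexive (lem (length cs) (length ds)))
    (cstep (incr q) refl refl (incrOver q cs (cb false ∷ ds) l (hd r ∷ tl r) e bl))
    where
    lem : ∀ n m → suc (2 * n + suc m + 2) ≡ 2 * suc n + m + 2
    lem = solve-∀
  incrOver q (cm u ∷ cs) ds l r {tso} e bl = reach-mono (ℕ.≤-reflexive (lem (length cs) (length ds)))
    (cstep (incr q) refl (eq u) (incrOver q cs (cm u ∷ ds) l (hd r ∷ tl r) e bl))
    where
    eq : ∀ u {a} → δCS (incr q) a (cellG (cm u)) ≡ (incr q , a , S , cellG (cm u) , R) ∷ []
    eq true  = refl
    eq false = refl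
    lem : ∀ n m → suc (2 * n + suc m + 2) ≡ 2 * suc n + m + 2
    lem = solve-∀

  record Same (cs cs′ : List Cc) : Set where
    constructor same
    field
      val≡  : valC cs′ ≡ valC cs
      bits≡ : bitsC cs′ ≡ bitsC cs
      len≡  : length cs′ ≡ length cs

  record Found (q : Quant) (cs ds : List Cc) (l r : List Gs) (tso : List Gs) : Set where
    constructor found
    field
      cs′     : List Cc
      same′   : Same cs cs′
      unused≡ : suc (unused cs′) ≡ unused cs
      reach   : Reach Y q (2 * length cs + length ds + 1)
        (cz (find q) (l ◂ r) (cells ds ++ lendG ∷ [] ◂ cells cs ++ tso))
        (cz (guess q) (nf (wG (setTab hash (viewW (hd r))) ∷ l ◂ tl r)) (lendG ∷ [] ◂ cells (ds ʳ++ cs′) ++ tso))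

  finding : ∀ q cs ds l r {tso} n → unused cs ≡ suc n → Found q cs ds l r tso
  finding q (cm false ∷ cs) ds l r {tso} n u = found (cm true ∷ cs) (same refl refl refl) refl
    (reach-mono (≤-split (lem (length cs) (length ds)))
      (reach-cong refl refl (cong (λ z → cz (guess q) (nf (wG (setTab hash (viewW (hd r))) ∷ l ◂ tl r)) (lendG ∷ [] ◂ z)) (cells-ʳ++ ds (cm true ∷ cs) tso))
      (cstep (find q) refl refl (retTo q ds (ext (core used)) (wG (setTab hash (viewW (hd r))) ∷ l) (tl r)))))
    where
    lem : ∀ n m → 2 * suc n + m + 1 ≡ suc (m + 1) + (2 * n + 1)
    lem = solve-∀
  finding q (c@(cm true) ∷ cs) ds l r {tso} n u with finding q cs (c ∷ ds) l (hd r ∷ tl r) {tso} n u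
  ... | found cs′ (same v b e) u′ g = found (c ∷ cs′) (same v b (cong suc e)) u′
    (reach-mono (ℕ.≤-reflexive (lem (length cs) (length ds))) (cstep (find q) refl refl g))
    where
    lem : ∀ n m → suc (2 * n + suc m + 1) ≡ 2 * suc n + m + 1
    lem = solve-∀
  finding q (c@(cb b₀) ∷ cs) ds l r {tso} n u with finding q cs (c ∷ ds) l (hd r ∷ tl r) {tso} n u
  ... | found cs′ (same v b e) u′ g = found (c ∷ cs′) (same (cong (λ z → b→ℕ b₀ + 2 * z) v) (cong suc b) (cong suc e)) u′
    (reach-mono (ℕ.≤-reflexive (lem (length cs) (length ds))) (cstep (find q) refl (eq b₀) g))
    where
    eq : ∀ b {a} → δCS (find q) a (cellG (cb b)) ≡ (find q , a , S , cellG (cb b) , R) ∷ []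
    eq true  = refl
    eq false = refl
    lem : ∀ n m → suc (2 * n + suc m + 1) ≡ 2 * suc n + m + 1
    lem = solve-∀

  finished : ∀ q cs ol l r {tso} → unused cs ≡ 0 → Blank tso → Σ (Tape Gs) λ o′ →
    Reach Y q (length cs + 1) (cz (find q) (l ◂ r) (ol ◂ cells cs ++ tso)) (cz (fin q) (nf (l ◂ r)) o′)
  finished q [] ol l r u bl = _ , cstep (find q) refl (cong (λ b → δ1 (find q) (hd r) b ∷ []) (bl 0)) done
  finished q (cb true ∷ cs) ol l r {tso} u bl with finished q cs (ext (core one) ∷ ol) l (hd r ∷ tl r) {tso} u bl
  ... | o′ , g = o′ , cstep (find q) refl refl g
  finished q (cb false ∷ cs) ol l r {tso} u bl with finished q cs (ext (mk false) ∷ ol) l (hd r ∷ tl r) {tso} u bl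
  ... | o′ , g = o′ , cstep (find q) refl refl g
  finished q (cm true ∷ cs) ol l r {tso} u bl with finished q cs (ext (core used) ∷ ol) l (hd r ∷ tl r) {tso} u bl
  ... | o′ , g = o′ , cstep (find q) refl refl g

nth-snoc-same : ∀ {A : Set} (ts : List A) t → nth (ts ++ t ∷ []) (length ts) ≡ just t
nth-snoc-same []       t = refl
nth-snoc-same (_ ∷ ts) t = nth-snoc-same ts t

nth-snoc-other : ∀ {A : Set} (ts : List A) t i → i ≢ length ts → nth (ts ++ t ∷ []) i ≡ nth ts i
nth-snoc-other []       t zero    i≢ = ⊥-elim (i≢ refl)
nth-snoc-other []       t (suc i) i≢ = refl
nth-snoc-other (_ ∷ ts) t zero    i≢ = refl
nth-snoc-other (_ ∷ ts) t (suc i) i≢ = nth-snoc-other ts t i (λ e → i≢ (cong suc e))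

module Tables (M : AOTM) (f h : Poly) (q₁ : Quant) (xs : ℕ → Sym (AOTM.g M)) where
  open AOTM M using (nQ; g; δ) renaming (kind to kindᴹ; start to startᴹ; qyes to qyesᴹ; qno to qnoᴹ)
  open Simulator M f h q₁
  open Lookup M f h q₁
  open Simulation M f h q₁
  open Guessing M f h q₁
  open ViewW
  open ViewO
  open Core simCore using (machine; rd; hd; read; zstep; ZConf)

  record Written (ts : List TS) (l r : List Gs) : Set where
    constructor written
    field
      view : ViewW xs ts noFlag (l ◂ r)
      len  : length l ≡ length ts

  write : ∀ {ts l r} t → Written ts l r → Written (ts ++ t ∷ []) (wG (setTab t (viewW (hd r))) ∷ l) (tl r)
  write {ts} {l} {r} t (written vw e) = written (mkW go) (trans (cong suc e) (sym (trans (length-++ ts) (ℕ.+-comm (length ts) 1))))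
    where
    go : ∀ i → viewW (rd (full (wG (setTab t (viewW (hd r))) ∷ l ◂ tl r)) i) ≡ (isZ i , xs i , nth (ts ++ t ∷ []) i , nothing)
    go i with i ℕ.≟ length l
    ... | yes refl = trans (cong viewW (rd-set-same □ (wG (setTab t (viewW (hd r)))) R (l ◂ r)))
      (trans (cong (setTab t) (viewHead l r vw)) (cong (λ z → isZ (length l) , xs (length l) , z , nothing)
        (sym (trans (cong (nth (ts ++ t ∷ [])) e) (nth-snoc-same ts t)))))
    ... | no i≢ = trans (cong viewW (rd-set-other □ (wG (setTab t (viewW (hd r)))) R (l ◂ r) i i≢))
      (trans (atW vw i) (cong (λ z → isZ i , xs i , z , nothing) (sym (nth-snoc-other ts t i (λ i≡ → i≢ (trans i≡ (sym e)))))))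

  written-nf : ∀ {ts l r} → Written ts l r → Written ts l (hd r ∷ tl r)
  written-nf {l = l} {r} (written vw e) = written (viewW-≋ (nf≋ l r) vw) e

  Choose : Quant → (GS → Set) → Set
  Choose ∃Q K = Σ GS K
  Choose ∀Q K = ∀ s → K s

  private
    choose : ∀ q {t k c K} (e : GS → ZConf) → Sys.kindOf Y c ≡ quant q → Sys.next Y c ≡ map e (elems fin-GS) →
             (∀ s → EvP Y t k (just q) (e s) (K s)) → EvP Y (suc t) k (just q) c (Choose q K)
    choose ∃Q {K = K} e ks n≡ ev = evp-map (λ (s , _ , k) → s , k) (λ (s , k) → s , complete fin-GS s , k)
      (evp-ex e K ks n≡ ℕ.≤-refl (λ s _ → ev s))
    choose ∀Q {K = K} e ks n≡ ev = evp-map (λ h s → h s (complete fin-GS s)) (λ h s _ → h s)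
      (evp-all e K ks n≡ ℕ.≤-refl (λ s _ → ev s))

    choose→ : ∀ q r {K} → Choose q (λ s → GuessP q r (λ seg → K (s ∷ seg))) → GuessP q (suc r) K
    choose→ ∃Q r (s , seg , e , k) = s ∷ seg , cong suc e , k
    choose→ ∀Q r h (s ∷ seg) e     = h s seg (ℕ.suc-injective e)

    choose← : ∀ q r {K} → GuessP q (suc r) K → Choose q (λ s → GuessP q r (λ seg → K (s ∷ seg)))
    choose← ∃Q r (s ∷ seg , e , k) = s , seg , ℕ.suc-injective e , k
    choose← ∀Q r h s seg e         = h (s ∷ seg) (cong suc e)

    guess0→ : ∀ q {K : List GS → Set} → K [] → GuessP q 0 K
    guess0→ ∃Q k        = [] , refl , k
    guess0→ ∀Q k [] e   = k

    guess0← : ∀ q {K : List GS → Set} → GuessP q 0 K → K []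
    guess0← ∃Q ([] , e , k) = k
    guess0← ∀Q h            = h [] refl

  findAt : Quant → List Gs → List Gs → List Cc → List Gs → ZConf
  findAt q l r cs tso = cz (find q) (l ◂ r) (lendG ∷ [] ◂ cells cs ++ tso)

  guessAt : Quant → List Gs → List Gs → List Cc → List Gs → ZConf
  guessAt q l r cs tso = cz (guess q) (l ◂ r) (lendG ∷ [] ◂ cells cs ++ tso)

  record Fresh (W u n : ℕ) (cs : List Cc) : Set where
    constructor fresh
    field
      val0  : valC cs ≡ 0
      bits  : bitsC cs ≡ W
      marks : unused cs ≡ u
      len   : length cs ≡ suc n

  -- `r` counts the symbols to come after the present one. The invariant `valC cs + suc r ≡ 2 ^ W`
  -- makes overflow coincide with the last symbol and refutes the two mismatched cases of `after`.
  guessing : ∀ r q {W u n T k K ts l rr tso} cs → valC cs + suc r ≡ 2 ^ W → bitsC cs ≡ W → unused cs ≡ u → length cs ≡ suc n →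
    Written ts l rr → Blank tso →
    (∀ seg → length seg ≡ suc r → ∀ cs₁ l₁ r₁ tso₁ → Fresh W u n cs₁ → Written (ts ++ map sym′ seg) l₁ r₁ → Blank tso₁ →
      EvP Y T k (just q) (findAt (dual q) l₁ r₁ cs₁ tso₁) (K seg)) →
    EvP Y (suc r * (2 * suc n + 3) + T) k (just q) (guessAt q l rr cs tso) (GuessP q (suc r) K)
  guessing r q {W} {u} {n} {T} {k} {K} {ts} {l} {rr} {tso} (c ∷ cs) v b us le w bl cont =
    evp-mono (ℕ.≤-reflexive (lem₀ n r T)) ℕ.≤-refl (evp-map (choose→ q r) (choose← q r)
      (choose q (λ s → cz (incr q) (wG (setTab (sym′ s) (viewW (hd rr))) ∷ l ◂ tl rr) (lendG ∷ [] ◂ cells (c ∷ cs) ++ tso))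
        refl refl (λ s → after s r v cont)))
    where
    lem₀ : ∀ n r T → suc (2 * suc n + 2 + r * (2 * suc n + 3) + T) ≡ suc r * (2 * suc n + 3) + T
    lem₀ = solve-∀
    after : ∀ s r {K : List GS → Set} → valC (c ∷ cs) + suc r ≡ 2 ^ W →
      (∀ seg → length seg ≡ suc r → ∀ cs₁ l₁ r₁ tso₁ → Fresh W u n cs₁ → Written (ts ++ map sym′ seg) l₁ r₁ → Blank tso₁ →
        EvP Y T k (just q) (findAt (dual q) l₁ r₁ cs₁ tso₁) (K seg)) →
      EvP Y (2 * suc n + 2 + r * (2 * suc n + 3) + T) k (just q)
        (cz (incr q) (wG (setTab (sym′ s) (viewW (hd rr))) ∷ l ◂ tl rr) (lendG ∷ [] ◂ cells (c ∷ cs) ++ tso)) (GuessP q r (λ seg → K (s ∷ seg)))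
    after s r v cont with proj₁ (incC (c ∷ cs)) in e
    after s zero v cont | false with () ← ℕ.<⇒≢ (valC< (proj₂ (incC (c ∷ cs)))) (trans (inc-step (c ∷ cs) e) (trans (ℕ.+-comm 1 _) (trans v (cong (2 ^_) (sym (trans (inc-bits (c ∷ cs)) b))))))
    after s zero v cont | true =
      evp-map (guess0→ q) (guess0← q)
        (evp-mono (ℕ.≤-reflexive (lem n T (length cs) (ℕ.suc-injective le))) ℕ.≤-refl
          (reach-evp (incrOver q (c ∷ cs) [] _ _ e bl)
            (cont (s ∷ []) refl (proj₂ (incC (c ∷ cs))) _ _ (□ ∷ tl tso) (fresh (proj₂ (inc-overflow (c ∷ cs) e)) (trans (inc-bits (c ∷ cs)) b) (trans (inc-unused (c ∷ cs)) us) (trans (inc-length (c ∷ cs)) le))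
              (written-nf (write (sym′ s) w)) (blank-tl {tso} bl))))
      where
      lem : ∀ n T m → m ≡ n → 2 * suc m + 0 + 2 + T ≡ 2 * suc n + 2 + 0 + T
      lem n T m refl = lem′ n T
        where
        lem′ : ∀ n T → 2 * suc n + 0 + 2 + T ≡ 2 * suc n + 2 + 0 + T
        lem′ = solve-∀
    after s (suc r) v cont | true with () ← ℕ.m+1+n≢m (valC (c ∷ cs) + 1)
      (trans (trans (ℕ.+-assoc (valC (c ∷ cs)) 1 (suc r)) v) (trans (cong (2 ^_) (sym b)) (trans (sym (proj₁ (inc-overflow (c ∷ cs) e))) (ℕ.+-comm 1 _))))
    after s (suc r) {K} v cont | false =
      evp-mono (ℕ.≤-reflexive (lem n T (length cs) (ℕ.suc-injective le) r)) ℕ.≤-refl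
        (reach-evp (incrStep q (c ∷ cs) [] _ _ e bl)
          (guessing r q {K = λ seg → K (s ∷ seg)} (proj₂ (incC (c ∷ cs))) (trans (cong (_+ suc r) (inc-step (c ∷ cs) e)) (trans (sym (ℕ.+-suc _ (suc r))) v))
            (trans (inc-bits (c ∷ cs)) b) (trans (inc-unused (c ∷ cs)) us) (trans (inc-length (c ∷ cs)) le)
            (written-nf (write (sym′ s) w)) bl
            (λ seg es cs₁ l₁ r₁ tso₁ fr w₁ bl₁ → cont (s ∷ seg) (cong suc es) cs₁ l₁ r₁ tso₁ fr
              (subst (λ z → Written z l₁ r₁) (++-assoc ts (sym′ s ∷ []) (map sym′ seg)) w₁) bl₁)))
      where
      lem : ∀ n T m → m ≡ n → ∀ r → 2 * suc m + 0 + 2 + (suc r * (2 * suc n + 3) + T) ≡ 2 * suc n + 2 + suc r * (2 * suc n + 3) + T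
      lem n T m refl r = lem′ n T r
        where
        lem′ : ∀ n T r → 2 * suc n + 0 + 2 + (suc r * (2 * suc n + 3) + T) ≡ 2 * suc n + 2 + suc r * (2 * suc n + 3) + T
        lem′ = solve-∀

  private
    fin-eq : ∀ {q a b c} → orgW a ≡ c →
             δCS (fin q) a b ≡ (if c then (clr , wG (setFlag (just nothing) (viewW a)) , S , b , S) else (fin q , a , L , b , S)) ∷ []
    fin-eq refl = refl

  finishing : ∀ q l r o {ts T k P} → ViewW xs ts noFlag (l ◂ r) →
    (∀ w″ → ViewW xs ts noFlag w″ → pos w″ ≡ 0 → EvP Y T k (just ∃Q) (cz (sim startᴹ) w″ ([] ◂ oG (true , zero) ∷ [])) P) →
    EvP Y (length l + 3 + T) (suc k) (just q) (cz (fin q) (l ◂ r) o) P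
  finishing q [] r o {ts} {T} {k} vw cont =
    reach-evp (cstep (fin q) {w = [] ◂ r} {o} {n = 0} refl (fin-eq (cong proj₁ (viewHead [] r vw))) done)
      (evp-query refl (evp-prev (reach-evp (cstep res {n = 0} refl refl done) (cont _ final refl))))
    where
    vw₁ : ViewW xs ts (setF 0 (just nothing) noFlag) ([] ◂ wG (setFlag (just nothing) (viewW (hd r))) ∷ tl r)
    vw₁ = putFlag (just nothing) ([] ◂ r) vw
    final : ViewW xs ts noFlag ([] ◂ wG (setFlag nothing (setFlag (just nothing) (viewW (hd r)))) ∷ tl r)
    final = mkW λ { zero    → trans (atW (putFlag nothing ([] ◂ wG (setFlag (just nothing) (viewW (hd r))) ∷ tl r) vw₁) 0) refl
                  ; (suc i) → trans (atW (putFlag nothing ([] ◂ wG (setFlag (just nothing) (viewW (hd r))) ∷ tl r) vw₁) (suc i)) refl }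
  finishing q (a ∷ l) r o vw cont =
    reach-evp (cstep (fin q) {w = a ∷ l ◂ r} {o} {n = 0} refl (fin-eq (cong proj₁ (viewHead (a ∷ l) r vw))) done)
      (finishing q l (a ∷ hd r ∷ tl r) _ (viewW-≋ (put-same □ L (a ∷ l) r) vw) cont)

  segTime : ℕ → ℕ → ℕ → ℕ → ℕ → ℕ
  segTime zero    W n len T = suc n + 1 + (len + 3 + T)
  segTime (suc j) W n len T = 2 * suc n + 1 + (2 ^ W * (2 * suc n + 3) + segTime j W n len T)

  -- Each segment spends one mark of the block, so the unspent marks count the quantifiers still to
  -- come. Each segment adds one alternation, and `finishing` one more for entering the existential
  -- simulation.
  segments : ∀ j q {W n T k F tot ts l r tso} cs → Fresh W j n cs → Written ts l r → Blank tso → length ts + j * suc (2 ^ W) ≡ tot →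
    (∀ ts w″ → length ts ≡ tot → ViewW xs ts noFlag w″ → pos w″ ≡ 0 →
      EvP Y T k (just ∃Q) (cz (sim startᴹ) w″ ([] ◂ oG (true , zero) ∷ [])) (F ts)) →
    EvP Y (segTime j W n tot T) (j + suc k) (just q) (findAt q l r cs tso) (SegP q j (2 ^ W) F ts)
  segments zero q {n = n} {T} {ts = ts} {l} {r} cs (fresh v b u le) (written vw e) bl tot base
    with finished q cs (lendG ∷ []) l r u bl
  ... | o′ , g = evp-mono (ℕ.≤-reflexive (cong₂ (λ a b → a + 1 + (b + 3 + T)) le lts)) ℕ.≤-refl
    (reach-evp g (finishing q l (hd r ∷ tl r) o′ (viewW-≋ (nf≋ l r) vw)
      (λ w″ vw″ p → base ts w″ (trans (sym (ℕ.+-identityʳ _)) tot) vw″ p)))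
    where
    lts : length l ≡ _
    lts = trans e (trans (sym (ℕ.+-identityʳ _)) tot)
  segments (suc j) q {W} {n} {T} {k} {F} {tot} {ts} {l} {r} {tso} cs (fresh v b u le) w bl len base
    with finding q cs [] l r {tso} j u | 2 ^ W ∸ 1 | ℕ.m+[n∸m]≡n (1≤2^ W)
  ... | found cs′ (same v′ b′ e′) u′ g | m | eW =
    evp-mono (ℕ.≤-reflexive (cong (_+ (2 ^ W * (2 * suc n + 3) + segTime j W n tot T)) (trans (cong (λ a → 2 * a + 0 + 1) le) (lem n)))) ℕ.≤-refl
    (reach-evp g
      (subst (λ z → EvP Y (z * (2 * suc n + 3) + segTime j W n tot T) (suc (j + suc k)) (just q) (guessAt q _ _ cs′ tso) (GuessP q z K)) eW
      (guessing m q cs′ (trans (cong (_+ suc m) (trans v′ v)) eW) (trans b′ b) (ℕ.suc-injective (trans u′ u)) (trans e′ le)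
        (written-nf (write hash w)) bl
        (λ seg es cs₁ l₁ r₁ tso₁ fr w₁ bl₁ → evp-prev
          (segments j (dual q) cs₁ fr (subst (λ z → Written z l₁ r₁) (++-assoc ts (hash ∷ []) (map sym′ seg)) w₁) bl₁
            (trans (lens seg (trans es eW)) len) base)))))
    where
    K : List GS → Set
    K seg = SegP (dual q) j (2 ^ W) F (ts ++ hash ∷ map sym′ seg)
    lem : ∀ n → 2 * suc n + 0 + 1 ≡ 2 * suc n + 1
    lem = solve-∀
    lens : ∀ seg → length seg ≡ 2 ^ W → length (ts ++ hash ∷ map sym′ seg) + j * suc (2 ^ W) ≡ length ts + suc j * suc (2 ^ W)
    lens seg es = trans (cong (_+ j * suc (2 ^ W)) (trans (length-++ ts) (cong (λ z → length ts + suc z) (trans (length-map sym′ seg) es))))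
      (ℕ.+-assoc (length ts) (suc (2 ^ W)) (j * suc (2 ^ W)))

-- The machine sees an oracle only up to length `P`. There every language agrees with some table,
-- and every table denotes a language, so a quantifier of either kind can be exchanged in both
-- directions.
prefix⇔segments : ∀ j q {P k} (val : List Lang → Set) (F : List TS → Set) ts → 2 * suc P ≤ k →
  (∀ Bs segs → Pointwise (AgreeUpTo P) Bs (map langOf segs) → val Bs ⇔ F (ts ++ trackOf segs)) →
  QPrefix q j val ⇔ SegP q j (2 ^ k) F ts
prefix⇔segments zero q val F ts le hyp = subst (λ z → val [] ⇔ F z) (++-identityʳ ts) (hyp [] [] [])
prefix⇔segments (suc j) q {P} {k} val F ts le hyp = go q
  where
  next : ∀ q B seg → AgreeUpTo P B (langOf seg) →
         QPrefix q j (λ Bs → val (B ∷ Bs)) ⇔ SegP q j (2 ^ k) F (ts ++ hash ∷ map sym′ seg)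
  next q B seg a = prefix⇔segments j q (λ Bs → val (B ∷ Bs)) F (ts ++ hash ∷ map sym′ seg) le
    (λ Bs segs as → subst (λ z → val (B ∷ Bs) ⇔ F z) (sym (++-assoc ts (hash ∷ map sym′ seg) (trackOf segs))) (hyp (B ∷ Bs) (seg ∷ segs) (a ∷ as)))
  go : ∀ q → QPrefix q (suc j) val ⇔ SegP q (suc j) (2 ^ k) F ts
  go ∃Q = mk⇔
    (λ (B , x) → let seg , e , a = tabulateLang P k B le in seg , e , Equivalence.to (next ∀Q B seg a) x)
    (λ (seg , e , x) → langOf seg , Equivalence.from (next ∀Q (langOf seg) seg (λ _ _ → refl)) x)
  go ∀Q = mk⇔
    (λ h seg e → Equivalence.to (next ∃Q (langOf seg) seg (λ _ _ → refl)) (h (langOf seg)))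
    (λ h B → let seg , e , a = tabulateLang P k B le in Equivalence.from (next ∃Q B seg a) (h seg e))

module _ (M : AOTM) where
  private
    module Z = Machine (asMachine M)

  startConf : Str → Z.ZConf
  startConf x = zc (AOTM.start M) ([] ◂ map encBit x) ([] ◂ [])

  -- As in `fits`, query tape and remaining time together stay within `P`, so no query tells the two
  -- oracles apart.
  ev-agree : ∀ {O O′ P t k p z v} → AgreeUpTo P O O′ → length (full (Zip.ot z)) + t ≤ P →
             Ev (Z.zsys O) t k p z v → Ev (Z.zsys O′) t k p z v
  evs-agree : ∀ {O O′ P t k p z es vs} → AgreeUpTo P O O′ → length (full (Zip.ot z)) + suc t ≤ P →
              Pointwise (Ev (Z.zsys O) t k p) (map (Z.zstep z) es) vs → Pointwise (Ev (Z.zsys O′) t k p) (map (Z.zstep z) es) vs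
  ev-agree a le (ev-accept e) = ev-accept e
  ev-agree a le (ev-reject e) = ev-reject e
  ev-agree {O} {O′} {P} {suc t} {k} {p} {zc s w o} {v} a le (ev-query e g) = ev-query e
    (subst (λ b → Ev (Z.zsys O′) t k p (zc (if b then AOTM.qyes M else AOTM.qno M) w ([] ◂ [])) v)
      (a _ (ℕ.≤-trans (length-decodeBy sbit (full o)) (ℕ.m+n≤o⇒m≤o _ le)))
      (ev-agree a (ℕ.≤-trans (ℕ.n≤1+n t) (ℕ.m+n≤o⇒n≤o (length (full o)) le)) g))
  ev-agree {z = zc s w o} a le (ev-branch q e j≤ gs f) = ev-branch q e j≤ (evs-agree {z = zc s w o} {es = AOTM.δ M s (Z.read w) (Z.read o)} a le gs) f
  evs-agree {es = []} a le [] = []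
  evs-agree {t = t} {z = zc s w o} {es = (_ , _ , _ , b , m) ∷ es} a le (g ∷ gs) =
    ev-agree a (ℕ.≤-trans (ℕ.+-monoˡ-≤ t (length-put b m o)) (ℕ.≤-trans (ℕ.≤-reflexive (sym (ℕ.+-suc _ t))) le)) g ∷ evs-agree {z = zc s w o} {es = es} a le gs

  startR : ∀ O x → ConfR (asMachine-encodes M) O (startConf x) (Run.initial M x)
  startR O x = initial-R (asMachine-encodes M) O x (map encBit x) (map-id (map encBit x))

  halts⇒run : ∀ O t x → Run.halts M O t (Run.initial M x) ≡ true →
              Ev (Z.zsys O) t (Run.alts M O t nothing (Run.initial M x)) nothing (startConf x) (Run.accepts M O t x)
  halts⇒run O t x h = backward (bisim (asMachine-encodes M) O) (startR O x) (halts⇒ev M O t _ h ℕ.≤-refl)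

  accepts-agree : ∀ {O O′ P} t x → AgreeUpTo P O O′ → t ≤ P → Run.halts M O t (Run.initial M x) ≡ true →
                  Run.accepts M O t x ≡ Run.accepts M O′ t x
  accepts-agree {O} {O′} t x a le h =
    sym (ev⇒acc M O′ (forward (bisim (asMachine-encodes M) O′) (startR O′ x) (ev-agree a le (halts⇒run O t x h))))

iff⇒≡ : ∀ {a b} → (a ≡ true) ⇔ (b ≡ true) → a ≡ b
iff⇒≡ {true}  {b}     h = sym (Equivalence.to h refl)
iff⇒≡ {false} {true}  h = Equivalence.from h refl
iff⇒≡ {false} {false} h = refl

_⇔∘_ : ∀ {A B C : Set} → A ⇔ B → B ⇔ C → A ⇔ C
f ⇔∘ h = mk⇔ (Equivalence.to h ∘ Equivalence.to f) (Equivalence.from f ∘ Equivalence.from h)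

-- From right to left: assembly and bounds

module Backward (A : Lang) (f : Poly) (M : AOTM) (p : Poly) (q₁ : Quant) (poly : PolyTimeAOTM M p)
  (spec : ∀ x → (A x ≡ true) ⇔ QPrefix q₁ (eval f (length x)) (λ Bs → Run.accepts M (tupleOracle Bs) (eval p (length x)) x ≡ true)) where

  -- The input plus one cell per step: a bound on both tapes, and so on every query.
  PB : ℕ → ℕ
  PB n = n + eval p n

  -- The counter width that `tabulateLang` demands.
  h-bound : PolyBounded (λ n → 2 * suc (PB n))
  h-bound = pb-const 2 pb* (pb-const 1 pb+ (pb-id pb+ pb-eval p))

  h : Poly
  h = proj₁ h-bound

  open Simulator M f h q₁
  open Lookup M f h q₁
  open Simulation M f h q₁
  open Guessing M f h q₁
  open Core simCore using (machine; program; rd)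
  module Pre₁ = Prelude simCore emptyOracle

  N wd tot QC simT total : ℕ → ℕ
  N n     = eval (cellPoly f) n + eval (cellPoly h) n
  -- All block cells that are not segment marks serve as counter bits.
  wd n    = N n ∸ eval f n
  tot n   = eval f n * suc (2 ^ wd n)
  QC n    = queryCost (PB n) (tot n)
  simT n  = eval p n * QC n
  total n = 3 + (N n * (2 * N n + 3 * n + 8) + (1 + (N n + 1))) +
            (eval f n * (2 * N n + 1 + 2 ^ wd n * (2 * N n + 3)) + (N n + 1 + (tot n + 3 + simT n)))

  time-bound : ExpBounded total
  time-bound = eb-pb (pb-const 3 pb+ (pbN pb* (pb-const 2 pb* pbN pb+ pb-const 3 pb* pb-id pb+ pb-const 8) pb+ (pb-const 1 pb+ (pbN pb+ pb-const 1))))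
    eb+ (eb-pb (pb-eval f) eb* (eb-pb (pb-const 2 pb* pbN pb+ pb-const 1) eb+ ebW eb* eb-pb (pb-const 2 pb* pbN pb+ pb-const 3))
    eb+ (eb-pb (pbN pb+ pb-const 1) eb+ (ebTot eb+ eb-pb (pb-const 3) eb+ eb-pb (pb-eval p) eb* ebQ)))
    where
    pbN : PolyBounded N
    pbN = pb-eval (cellPoly f) pb+ pb-eval (cellPoly h)
    pbP : PolyBounded PB
    pbP = pb-id pb+ pb-eval p
    ebW : ExpBounded (λ n → 2 ^ wd n)
    ebW = eb-2^ (pb-≤ (λ n → ℕ.m∸n≤m (N n) (eval f n)) pbN)
    ebTot : ExpBounded tot
    ebTot = eb-pb (pb-eval f) eb* (eb-pb (pb-const 1) eb+ ebW)
    ebL : ExpBounded (λ n → lookupCost (PB n) (tot n))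
    ebL = eb-pb (pb-const 1) eb+ (ebTot eb* eb-pb (pbP pb+ pb-const 5) eb+ eb-pb (pb-const 2))
    ebQ : ExpBounded QC
    ebQ = eb-pb (pb-const 1) eb+ (eb-pb pbP eb+ (ebL eb+ (ebL eb+ eb-pb (pb-const 1) eb+ eb-pb (pbP pb+ pb-const 1 pb+ pb-const 2))))

  -- One alternation per segment, one for entering the existential simulation, one per simulated
  -- step, and one charged by `ev-prev` at the very start.
  alts-bound : PolyBounded (λ n → suc (eval f n + suc (eval p n)))
  alts-bound = pb-const 1 pb+ (pb-eval f pb+ (pb-const 1 pb+ pb-eval p))

  module Input (x : Str) where
    n : ℕ
    n = length x

    xs : ℕ → Sym (AOTM.g M)
    xs = rdᴹ (map encBit x)

    open Tables M f h q₁ xs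

    val : List Lang → Set
    val Bs = Run.accepts M (tupleOracle Bs) (eval p n) x ≡ true

    F : List TS → Set
    F ts = Run.accepts M (look ts) (eval p n) x ≡ true

    P : Set
    P = SegP q₁ (eval f n) (2 ^ wd n) F []

    N≡ : cellCount n I₁ + cellCount n I₂ ≡ N n
    N≡ = cong₂ _+_ (cellCount-instrsOf true f n) (cellCount-instrsOf false h n)

    wide : 2 * suc (PB n) ≤ wd n
    wide = ℕ.≤-trans (proj₂ h-bound n) (ℕ.≤-trans (ℕ.<⇒≤ (eval<cellPoly h n))
      (ℕ.≤-trans (ℕ.m≤n+m _ (eval (cellPoly f) n ∸ eval f n)) (ℕ.≤-reflexive (sym (ℕ.+-∸-comm _ (ℕ.<⇒≤ (eval<cellPoly f n)))))))

    spec′ : (A x ≡ true) ⇔ P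
    spec′ = spec x ⇔∘ prefix⇔segments (eval f n) q₁ val F [] wide λ Bs segs as →
      let e = accepts-agree M (eval p n) x (λ y le → trans (tuple-agree as y le) (sym (look-track segs y))) (ℕ.m≤n+m _ n) (poly (tupleOracle Bs) x)
      in mk⇔ (trans (sym e)) (trans e)

    base : ∀ ts w″ → length ts ≡ tot n → ViewW xs ts noFlag w″ → pos w″ ≡ 0 →
           EvP Y (simT n) (eval p n) (just ∃Q) (cz (sim (AOTM.start M)) w″ ([] ◂ oG (true , zero) ∷ [])) (F ts)
    base ts w″ le vw e = _ , subst (λ z → Ev Y (eval p n * queryCost (PB n) z) (eval p n) (just ∃Q)
        (cz (sim (AOTM.start M)) w″ ([] ◂ oG (true , zero) ∷ [])) (Run.accepts M (look ts) (eval p n) x)) le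
      (simulate (look ts) ts (PB n) (λ y _ → refl) (halts⇒run M (look ts) (eval p n) x (poly (look ts) x))
        (simR vw e (mkO λ { zero → refl ; (suc i) → refl }) refl)
        (ℕ.≤-reflexive (cong (_+ eval p n) (length-map encBit x)) , ℕ.m≤n+m _ n) (just ∃Q)) ,
      reflects-≡true _

    open Pre₁.Prepared (Pre₁.prepare x)

    cc : Bool → Cc
    cc true  = cm false
    cc false = cb false

    cells-cc : ∀ ms → Pre₁.marks ms ≡ cells (map cc ms)
    cells-cc []           = refl
    cells-cc (true ∷ ms)  = cong (_ ∷_) (cells-cc ms)
    cells-cc (false ∷ ms) = cong (_ ∷_) (cells-cc ms)

    val-cc : ∀ ms → valC (map cc ms) ≡ 0
    val-cc []           = refl
    val-cc (true ∷ ms)  = val-cc ms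
    val-cc (false ∷ ms) = cong (2 *_) (val-cc ms)

    unused-cc : ∀ ms → unused (map cc ms) ≡ trues ms
    unused-cc []           = refl
    unused-cc (true ∷ ms)  = cong suc (unused-cc ms)
    unused-cc (false ∷ ms) = unused-cc ms

    bits-cc : ∀ ms → bitsC (map cc ms) + trues ms ≡ length ms
    bits-cc []           = refl
    bits-cc (true ∷ ms)  = trans (ℕ.+-suc _ (trues ms)) (cong suc (bits-cc ms))
    bits-cc (false ∷ ms) = cong suc (bits-cc ms)

    trues≡ : trues ms ≡ eval f n
    trues≡ = trans marks≡ (trans (cong₂ _+_ (markCount-true f n) (markCount-false h n)) (ℕ.+-identityʳ _))

    length≡ : length ms ≡ N n
    length≡ = trans cells≡ N≡

    W≡ : bitsC (map cc ms) ≡ wd n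
    W≡ = trans (sym (ℕ.m+n∸n≡m (bitsC (map cc ms)) (trues ms))) (cong₂ _∸_ (trans (bits-cc ms) length≡) trues≡)

    N-pos : suc (N n ∸ 1) ≡ N n
    N-pos = ℕ.m+[n∸m]≡n (ℕ.≤-trans (s≤s z≤n) (ℕ.≤-trans (eval<cellPoly h n) (ℕ.m≤n+m _ (eval (cellPoly f) n))))

    input-view : ∀ i → viewW (Pre₁.cellAt x i) ≡ (isZ i , xs i , nothing , nothing)
    input-view = go x
      where
      inner : ∀ (x : Str) i → viewW (Pre₁.raw (nth x i)) ≡ (false , rdᴹ (map encBit x) i , nothing , nothing)
      inner []      i       = refl
      inner (b ∷ x) zero    = refl
      inner (b ∷ x) (suc i) = inner x i
      go : ∀ (x : Str) i → viewW (Pre₁.cellAt x i) ≡ (isZ i , rdᴹ (map encBit x) i , nothing , nothing)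
      go []      zero    = refl
      go []      (suc i) = refl
      go (b ∷ x) zero    = refl
      go (b ∷ x) (suc i) = inner x i

    segTime≡ : ∀ j W m len T → segTime j W m len T ≡ j * (2 * suc m + 1 + 2 ^ W * (2 * suc m + 3)) + (suc m + 1 + (len + 3 + T))
    segTime≡ zero    W m len T = refl
    segTime≡ (suc j) W m len T = trans (cong (λ z → 2 * suc m + 1 + (2 ^ W * (2 * suc m + 3) + z)) (segTime≡ j W m len T))
      (lem (2 * suc m + 1) (2 ^ W * (2 * suc m + 3)) _ _)
      where
      lem : ∀ a b c d → a + (b + (c + d)) ≡ a + b + c + d
      lem = solve-∀

    run : EvP Y (total n) (suc (eval f n + suc (eval p n))) nothing
              (zc (inj₁ s0) ([] ◂ map bit x) ([] ◂ [])) P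
    run = evp-prev (evp-mono (ℕ.≤-reflexive time≡) ℕ.≤-refl
      (reach-evp reach (subst (λ z → EvP Y (segTime (eval f n) (wd n) (N n ∸ 1) (tot n) (simT n)) (eval f n + suc (eval p n)) (just q₁) (zc (inj₂ (find q₁)) ([] ◂ r) (lendG ∷ [] ◂ z ++ ts)) P) (sym (cells-cc ms))
        (segments (eval f n) q₁ {wd n} {N n ∸ 1} {simT n} {eval p n} {F} {tot n} (map cc ms)
          (fresh (val-cc ms) W≡ (trans (unused-cc ms) trues≡) (trans (length-map cc ms) (trans length≡ (sym N-pos))))
          (written (mkW λ i → trans (cong viewW (input i)) (input-view i)) refl) blanks refl base))))
      where
      time≡ : Pre₁.preTime x + segTime (eval f n) (wd n) (N n ∸ 1) (tot n) (simT n) ≡ total n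
      time≡ = cong₂ _+_ (cong (λ z → 3 + (z * (2 * z + 3 * n + 8) + (1 + (z + 1)))) N≡)
        (trans (segTime≡ (eval f n) (wd n) (N n ∸ 1) (tot n) (simT n))
          (cong (λ z → eval f n * (2 * z + 1 + 2 ^ wd n * (2 * z + 3)) + (z + 1 + (tot n + 3 + simT n))) N-pos))

  open Program program using (compile; compile-encodes; initial-compiled)

  result : AEXPTIMEpoly A
  result = compile , proj₁ time-bound , proj₁ alts-bound , λ x →
    let v , ev , rf = Input.run x
        ev′ = forward (bisim compile-encodes emptyOracle) (initial-compiled emptyOracle x)
                (ev-mono (proj₂ time-bound (length x)) (proj₂ alts-bound (length x)) ev)
    in ev⇒halts compile emptyOracle ev′ , ev⇒alts compile emptyOracle ev′ ,
       trans (iff⇒≡ (Input.spec′ x ⇔∘ mk⇔ (Equivalence.from (reflects-true rf)) (Equivalence.to (reflects-true rf))))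
             (sym (ev⇒acc compile emptyOracle ev′))

-- Horn clauses describing a deterministic run

eqF : ∀ {A : Set} → Finite A → A → A → Bool
eqF fa a b = does (code fa a Fin.≟ code fa b)

eqF-refl : ∀ {A : Set} (fa : Finite A) a → eqF fa a a ≡ true
eqF-refl fa a with code fa a Fin.≟ code fa a
... | yes _ = refl
... | no ¬e = ⊥-elim (¬e refl)

eqF-sound : ∀ {A : Set} (fa : Finite A) a b → eqF fa a b ≡ true → a ≡ b
eqF-sound fa a b e with code fa a Fin.≟ code fa b
... | yes c = trans (sym (decode-code fa a)) (trans (cong (decode fa) c) (decode-code fa b))

data Tr : Set where
  idK decK incK upredK usuccK zeroK : Tr

abstract
  fin-Tr : Finite Tr
  fin-Tr = fin-retract (fin-Fin 6)
    (λ { zero → idK ; (suc zero) → decK ; (suc (suc zero)) → incK ; (suc (suc (suc zero))) → upredK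
       ; (suc (suc (suc (suc zero)))) → usuccK ; (suc (suc (suc (suc (suc zero))))) → zeroK })
    (λ { idK → zero ; decK → suc zero ; incK → suc (suc zero) ; upredK → suc (suc (suc zero))
       ; usuccK → suc (suc (suc (suc zero))) ; zeroK → suc (suc (suc (suc (suc zero)))) })
    (λ { idK → refl ; decK → refl ; incK → refl ; upredK → refl ; usuccK → refl ; zeroK → refl })

-- One step of a transducer, from carry and input bit to output bit and carry: decK and incK
-- are modulo 2^N with the least significant bit first, upredK clears the first 1 and
-- usuccK sets the first 0.
trStep : Tr → Bool → Bool → Bool × Bool
trStep decK   true true  = false , false
trStep decK   true false = true , true
trStep incK   true true  = false , true
trStep incK   true false = true , false
trStep upredK true true  = false , false
trStep usuccK true false = true , false
trStep zeroK  c    b     = false , c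
trStep _      c    b     = b , c

transduce : Tr → Bool → Str → Str
transduce k c []      = []
transduce k c (b ∷ u) = proj₁ (trStep k c b) ∷ transduce k (proj₂ (trStep k c b)) u

app : Tr → Str → Str
app k = transduce k true

-- Time, depth and stage are interleaved because each block cell holds one bit of each, and the
-- verifier writes them in a single sweep.
weave : Str → Str → Str → Str
weave (a ∷ u) (b ∷ v) (c ∷ w) = a ∷ b ∷ c ∷ weave u v w
weave _       _       _       = []

module Clauses (M : AOTM) where
  open AOTM M using (nQ; g; δ; kind) renaming (start to startᴹ; qno to qnoᴹ)

  Sy : Set
  Sy = Sym g

  -- What the tape stacks hold at some depth: the symbol that far to the left of the head,
  -- if any, and the symbol that far to the right, on the work tape and on the oracle tape.
  V : Set
  V = (Maybe Sy × Sy) × (Maybe Sy × Sy)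

  -- State, player, and the symbols under the two heads.
  Rho : Set
  Rho = Fin nQ × Quant × Sy × Sy

  Tn : Set
  Tn = Fin nQ × Sy × Move × Sy × Move

  data Act : Set where
    stay call swap : Act
    -- The flag says that no choice bit was set, so that the last transition is taken.
    take : Bool → Tn → Act

  abstract
    fin-V : Finite V
    fin-V = (fin-Maybe (fin-Fin _) fin× fin-Fin _) fin× (fin-Maybe (fin-Fin _) fin× fin-Fin _)

  abstract
    fin-Rho : Finite Rho
    fin-Rho = fin-Fin _ fin× fin-Quant fin× fin-Fin _ fin× fin-Fin _

  abstract
    fin-Tn : Finite Tn
    fin-Tn = fin-Fin _ fin× fin-Fin _ fin× fin-Move fin× fin-Fin _ fin× fin-Move

  abstract
    fin-Act : Finite Act
    fin-Act = fin-retract (fin-Fin 3 fin⊎ (fin-Bool fin× fin-Tn))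
      (λ { (inj₁ zero) → stay ; (inj₁ (suc zero)) → call ; (inj₁ (suc (suc zero))) → swap ; (inj₂ (b , e)) → take b e })
      (λ { stay → inj₁ zero ; call → inj₁ (suc zero) ; swap → inj₁ (suc (suc zero)) ; (take b e) → inj₂ (b , e) })
      (λ { stay → refl ; call → refl ; swap → refl ; (take b e) → refl })

  data Tag : Set where
    load   : Sy → Tag
    depth  : V → Tag
    row    : Rho → Tag
    choice : Tn → Tag

  abstract
    fin-Tag : Finite Tag
    fin-Tag = fin-retract (fin-Fin _ fin⊎ fin-V fin⊎ fin-Rho fin⊎ fin-Tn)
      (λ { (inj₁ a) → load a ; (inj₂ (inj₁ v)) → depth v ; (inj₂ (inj₂ (inj₁ ρ))) → row ρ ; (inj₂ (inj₂ (inj₂ e))) → choice e })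
      (λ { (load a) → inj₁ a ; (depth v) → inj₂ (inj₁ v) ; (row ρ) → inj₂ (inj₂ (inj₁ ρ)) ; (choice e) → inj₂ (inj₂ (inj₂ e)) })
      (λ { (load a) → refl ; (depth v) → refl ; (row ρ) → refl ; (choice e) → refl })

  -- The first transition with its choice bit set is taken, and the last one by default. Thus every
  -- oracle plays legally, and nothing has to be verified about the oracles of the stages.
  pick : (Tn → Bool) → Tn → List Tn → Act
  pick α e []        = take (not (α e)) e
  pick α e (e′ ∷ es) = if α e then take false e else pick α e′ es

  eqT : Tn → Tn → Bool
  eqT = eqF fin-Tn

  consM : Tn × Bool → Maybe (List (Tn × Bool)) → Maybe (List (Tn × Bool))
  consM l nothing   = nothing
  consM l (just ls) = just (l ∷ ls)

  -- The bits that `pick` reads on its way to `take b x`, with the values they must have. At the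
  -- last transition `not b` is right for both flags, since the default is taken with its bit unset.
  path : Bool → Tn → Tn → List Tn → Maybe (List (Tn × Bool))
  path b     x e []        = if eqT x e then just ((e , not b) ∷ []) else nothing
  path true  x e (e′ ∷ es) = consM (e , false) (path true x e′ es)
  path false x e (e′ ∷ es) = if eqT x e then just ((e , true) ∷ []) else consM (e , false) (path false x e′ es)

  sameQ : Quant → Quant → Bool
  sameQ = eqF fin-Quant

  -- In a state of the other player the turn is passed, which takes a time step and opens the next
  -- stage. Without successors the run has halted.
  actBranch : (Tn → Bool) → Bool → List Tn → Act
  actBranch α false es       = swap
  actBranch α true  []       = stay
  actBranch α true  (e ∷ es) = pick α e es

  actKind : (Tn → Bool) → Kind → Rho → Act
  actKind α (quant Q) (q , pl , a , b) = actBranch α (sameQ Q pl) (δ q a b)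
  actKind α query     ρ = call
  actKind α _         ρ = stay

  actOf : (Tn → Bool) → Rho → Act
  actOf α ρ = actKind α (kind (proj₁ ρ)) ρ

  reqBranch : Act → Bool → List Tn → Maybe (List (Tn × Bool))
  reqBranch swap   false es       = just []
  reqBranch stay   true  []       = just []
  reqBranch (take b x) true (e ∷ es) = path b x e es
  reqBranch _      _     _        = nothing

  reqKind : Act → Kind → Rho → Maybe (List (Tn × Bool))
  reqKind act  (quant Q) (q , pl , a , b) = reqBranch act (sameQ Q pl) (δ q a b)
  reqKind call query     ρ = just []
  reqKind stay accept    ρ = just []
  reqKind stay reject    ρ = just []
  reqKind _    _         ρ = nothing

  -- The choice bits under which the action is the one taken.
  required : Act → Rho → Maybe (List (Tn × Bool))
  required act ρ = reqKind act (kind (proj₁ ρ)) ρ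

  -- An empty disjunction is false: an existential state without successors rejects, whereas a
  -- universal one accepts.
  rejBranch : Quant → Bool → List Tn → Bool
  rejBranch ∃Q true [] = true
  rejBranch _  _    _  = false

  rejKind : Kind → Rho → Bool
  rejKind (quant Q) (q , pl , a , b) = rejBranch Q (sameQ Q pl) (δ q a b)
  rejKind reject    ρ = true
  rejKind _         ρ = false

  rejecting : Rho → Bool
  rejecting ρ = rejKind (kind (proj₁ ρ)) ρ

  headAfter : Move → Sy → Maybe Sy → Sy → Sy
  headAfter L a (just c) r = c
  headAfter L a nothing  r = a
  headAfter S a l        r = a
  headAfter R a l        r = r

  rowUpd : Act → Rho → V → Rho
  rowUpd stay ρ v = ρ
  rowUpd swap (q , pl , a , b) v = q , dual pl , a , b
  -- The described machine runs with the empty oracle, so every query is answered no.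
  rowUpd call (q , pl , a , b) v = qnoᴹ , pl , a , zero
  rowUpd (take _ (q′ , a′ , m , b′ , m′)) (q , pl , a , b) ((lw , rw) , (lo , ro)) =
    q′ , pl , headAfter m a′ lw rw , headAfter m′ b′ lo ro

  -- A move pushes on one stack and pops the other, so a depth depends on itself and its two
  -- neighbours one step before (`p`, `c`, `n`). `z` says that the depth is zero; then the
  -- wrapped-around `p` is not read. `l₀` tells whether a left move is blocked.
  tapeUpd : Move → Sy → Maybe Sy → Bool → (p c n : Maybe Sy × Sy) → Maybe Sy × Sy
  tapeUpd S a l₀       z p c n = c
  tapeUpd R a l₀       z p c n = (if z then just a else proj₁ p) , proj₂ n
  tapeUpd L a nothing  z p c n = c
  tapeUpd L a (just _) z p c n = proj₁ n , (if z then a else proj₂ p)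

  cellUpd : Act → V → Bool → (p c n : V) → V
  cellUpd call v₀ z p c n = proj₁ c , (nothing , zero)
  cellUpd (take _ (_ , a , m , b , m′)) v₀ z p c n =
    tapeUpd m a (proj₁ (proj₁ v₀)) z (proj₁ p) (proj₁ c) (proj₁ n) , tapeUpd m′ b (proj₁ (proj₂ v₀)) z (proj₂ p) (proj₂ c) (proj₂ n)
  cellUpd _ v₀ z p c n = c

  -- Whether the fact is claimed by the last oracle, the transducers applied to time, depth
  -- and stage, and what is claimed of them.
  Atom : Set
  Atom = Bool × Tr × Tr × Tr × Tag

  Lit : Set
  Lit = Atom × Bool

  abstract
    fin-Lit : Finite Lit
    fin-Lit = (fin-Bool fin× fin-Tr fin× fin-Tr fin× fin-Tr fin× fin-Tag) fin× fin-Bool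

  -- The input is pushed on a stack, last symbol first. Loading time is not a binary number: its 1s
  -- count the pushes made, and in 0^i 1^m the first 1 points at the symbol just pushed. The
  -- verifier meets that symbol in the sweep that guesses the time, so finite memory is enough to
  -- check the input.
  loadA : Tr → Tr → Sy → Atom
  loadA kt kd a = true , kt , kd , zeroK , load a

  depthA : Tr → Tr → V → Atom
  depthA kt kd v = true , kt , kd , zeroK , depth v

  rowA : Tr → Tr → Rho → Atom
  rowA kt ks ρ = true , kt , zeroK , ks , row ρ

  -- With the flag `false` the question starts with 1 followed by the stage string instead of 1s
  -- throughout. A stage string 1^σ 0... thus addresses the oracle of stage σ, and the all-ones
  -- prefix addresses the last oracle.
  choiceA : Tn → Atom
  choiceA e = false , decK , zeroK , zeroK , choice e

  -- Clause schemes with their finite parameters: loading (`u`), the first row (`b`), one step of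
  -- the row and of a depth, and the exclusion of rejection. Being finite, the type is covered by
  -- one universal branching.
  data Id : Set where
    uInit uPush : Id
    uShift bRow bCell : Sy → Id
    rowI  : Rho → V → Act → Id
    cellI : Rho → V → Act → V → V → V → Id
    rejI  : Rho → Id

  abstract
    fin-Id : Finite Id
    fin-Id = fin-retract (fin-Bool fin⊎ (fin-Fin 3 fin× fin-Fin (3 + g)) fin⊎ (fin-Rho fin× fin-V fin× fin-Act) fin⊎
                          (fin-Rho fin× fin-V fin× fin-Act fin× fin-V fin× fin-V fin× fin-V) fin⊎ fin-Rho)
      (λ { (inj₁ true) → uInit ; (inj₁ false) → uPush ; (inj₂ (inj₁ (zero , a))) → uShift a
         ; (inj₂ (inj₁ (suc zero , a))) → bRow a ; (inj₂ (inj₁ (suc (suc zero) , a))) → bCell a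
         ; (inj₂ (inj₂ (inj₁ (ρ , v , a)))) → rowI ρ v a ; (inj₂ (inj₂ (inj₂ (inj₁ (ρ , v , a , p , c , n))))) → cellI ρ v a p c n
         ; (inj₂ (inj₂ (inj₂ (inj₂ ρ)))) → rejI ρ })
      (λ { uInit → inj₁ true ; uPush → inj₁ false ; (uShift a) → inj₂ (inj₁ (zero , a))
         ; (bRow a) → inj₂ (inj₁ (suc zero , a)) ; (bCell a) → inj₂ (inj₁ (suc (suc zero) , a))
         ; (rowI ρ v a) → inj₂ (inj₂ (inj₁ (ρ , v , a))) ; (cellI ρ v a p c n) → inj₂ (inj₂ (inj₂ (inj₁ (ρ , v , a , p , c , n))))
         ; (rejI ρ) → inj₂ (inj₂ (inj₂ (inj₂ ρ))) })
      (λ { uInit → refl ; uPush → refl ; (uShift a) → refl ; (bRow a) → refl ; (bCell a) → refl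
         ; (rowI ρ v a) → refl ; (cellI ρ v a p c n) → refl ; (rejI ρ) → refl })

  -- Whether this is about loading the input, whether time and depth are zero, and the input
  -- symbol at the first 1 of the time.
  Fl : Set
  Fl = Bool × Bool × Bool × Maybe Bool

  abstract
    fin-Fl : Finite Fl
    fin-Fl = fin-Bool fin× fin-Bool fin× fin-Bool fin× fin-Maybe fin-Bool

  paySym : Maybe Bool → Sy
  paySym nothing  = zero
  paySym (just b) = encBit b

  Clause : Set
  Clause = List Lit × List Atom

  premises : Rho → V → List (Tn × Bool) → List Lit
  premises ρ v₀ ls = (rowA decK idK ρ , true) ∷ (depthA decK zeroK v₀ , true) ∷ map (λ (e , b) → choiceA e , b) ls

  stageTr : Act → Tr
  stageTr swap = usuccK
  stageTr _    = idK

  withReq : Maybe (List (Tn × Bool)) → (List (Tn × Bool) → Clause) → Maybe Clause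
  withReq nothing   f = nothing
  withReq (just ls) f = just (f ls)

  -- A scheme that does not fit the flags gives `nothing` and counts as satisfied. Time, depth and
  -- stage are the guessed strings themselves; neighbouring ones are reached through the transducers
  -- in the atoms.
  clause : Fl → Id → Maybe Clause
  clause (true , true , _ , _)         uInit = just ([] , loadA idK idK zero ∷ [])
  clause (true , false , true , pay)   uPush = just ([] , loadA idK idK (paySym pay) ∷ [])
  clause (true , false , false , _)    (uShift a) = just ((loadA upredK decK a , true) ∷ [] , loadA idK idK a ∷ [])
  -- At time zero `decK` wraps around to the string of all 1s, which is the last loading time.
  clause (false , true , _ , _)        (bRow a) = just ((loadA decK zeroK a , true) ∷ [] , rowA idK zeroK (startᴹ , ∃Q , a , zero) ∷ [])
  clause (false , true , _ , _)        (bCell a) = just ((loadA decK incK a , true) ∷ [] , depthA idK idK ((nothing , a) , (nothing , zero)) ∷ [])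
  clause (false , false , _ , _)       (rowI ρ v₀ act) = withReq (required act ρ) λ ls →
    premises ρ v₀ ls , rowA idK (stageTr act) (rowUpd act ρ v₀) ∷ []
  clause (false , false , zd , _)      (cellI ρ v₀ act p c n) = withReq (required act ρ) λ ls →
    (depthA decK decK p , true) ∷ (depthA decK idK c , true) ∷ (depthA decK incK n , true) ∷ premises ρ v₀ ls ,
    depthA idK idK (cellUpd act v₀ zd p c n) ∷ []
  clause (false , _ , _ , _)           (rejI ρ) = if rejecting ρ then just ((rowA idK idK ρ , true) ∷ [] , []) else nothing
  clause _ _ = nothing

  literals : Clause → List Lit
  literals (ps , cs) = map (λ (a , b) → a , not b) ps ++ map (_, true) cs

  Bits : Set
  Bits = Bool × Bool × Bool

  abstract
    fin-Bits : Finite Bits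
    fin-Bits = fin-Bool fin× fin-Bool fin× fin-Bool

  flagStep : Fl → Maybe Bool → Bits → Fl
  flagStep (md , zt , zd , pay) x (t , d , s) = md , (zt ∧ not t) , (zd ∧ not d) , (if zt ∧ t then x else pay)

  flags : Fl → Str → List Bits → Fl
  flags fl x []       = fl
  flags fl x (c ∷ cs) = flags (flagStep fl (nth x 0) c) (tl x) cs

  flagsOf : Bool → Str → List Bits → Fl
  flagsOf md = flags (md , true , true , nothing)

  tagSize : ℕ
  tagSize = suc (size fin-Tag)

  tagCode : Tag → Fin tagSize
  tagCode t = suc (code fin-Tag t)

  tagNo : Tag → ℕ
  tagNo t = toℕ (tagCode t)

  prefixBits : Bool → List Bits → Str
  prefixBits cl []                 = []
  prefixBits cl ((t , d , s) ∷ cs) = (if cl then true else s) ∷ prefixBits cl cs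

  bodyBits : Tr × Tr × Tr → Bool × Bool × Bool → List Bits → Str
  bodyBits ks cs [] = []
  bodyBits ks@(kt , kd , ks′) (ct , cd , cs) ((t , d , s) ∷ bs) =
    proj₁ (trStep kt ct t) ∷ proj₁ (trStep kd cd d) ∷ proj₁ (trStep ks′ cs s) ∷
    bodyBits ks (proj₂ (trStep kt ct t) , proj₂ (trStep kd cd d) , proj₂ (trStep ks′ cs s)) bs

  question : Atom → List Bits → Str
  question (cl , kt , kd , ks , tag) cs =
    true ∷ prefixBits cl cs ++ false ∷ bodyBits (kt , kd , ks) (true , true , true) cs ++ replicate (tagNo tag) true

  Holds : Lang → List Bits → Lit → Set
  Holds O cs (a , b) = O (question a cs) ≡ b

  -- The property decided by the verifier, for blocks of N cells.
  Closed : ℕ → Str → Lang → Set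
  Closed N x O = ∀ md cs → length cs ≡ N → ∀ i C → clause (flagsOf md x cs) i ≡ just C →
    Σ Lit λ ℓ → ℓ ∈ literals C × Holds O cs ℓ

-- The machine that verifies the clauses

module Verifier (M : AOTM) (h : Poly) where
  open Clauses M

  IH : List Instr
  IH = instrsOf false h

  -- swp guesses the strings, bck returns, pck chooses a clause and cls a literal of it; lead
  -- to tg write the question, whose expected answer is left under the head of the work tape.
  data VS : Set where
    vs0 qask ansY ansN accS rejS : VS
    swp bck pck : Fl → VS
    cls : Fl → Id → VS
    lead pre′ rw : Lit → VS
    bd0 bd1 bd2 : Lit → Bits → VS
    tg : Fin tagSize → Bool → VS

  abstract
    fin-VS : Finite VS
    fin-VS = fin-retract (fin-Fin 6 fin⊎ (fin-Fin 3 fin× fin-Fl) fin⊎ (fin-Fl fin× fin-Id) fin⊎ (fin-Fin 3 fin× fin-Lit) fin⊎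
                          (fin-Fin 3 fin× fin-Lit fin× fin-Bool fin× fin-Bool fin× fin-Bool) fin⊎ (fin-Fin tagSize fin× fin-Bool)) to from to-from
      where
      Code : Set
      Code = Fin 6 ⊎ (Fin 3 × Fl) ⊎ (Fl × Id) ⊎ (Fin 3 × Lit) ⊎ (Fin 3 × Lit × Bits) ⊎ (Fin tagSize × Bool)
      to : Code → VS
      to (inj₁ zero) = vs0
      to (inj₁ (suc zero)) = qask
      to (inj₁ (suc (suc zero))) = ansY
      to (inj₁ (suc (suc (suc zero)))) = ansN
      to (inj₁ (suc (suc (suc (suc zero))))) = accS
      to (inj₁ (suc (suc (suc (suc (suc zero)))))) = rejS
      to (inj₂ (inj₁ (zero , f))) = swp f
      to (inj₂ (inj₁ (suc zero , f))) = bck f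
      to (inj₂ (inj₁ (suc (suc zero) , f))) = pck f
      to (inj₂ (inj₂ (inj₁ (f , i)))) = cls f i
      to (inj₂ (inj₂ (inj₂ (inj₁ (zero , ℓ))))) = lead ℓ
      to (inj₂ (inj₂ (inj₂ (inj₁ (suc zero , ℓ))))) = pre′ ℓ
      to (inj₂ (inj₂ (inj₂ (inj₁ (suc (suc zero) , ℓ))))) = rw ℓ
      to (inj₂ (inj₂ (inj₂ (inj₂ (inj₁ (zero , ℓ , c)))))) = bd0 ℓ c
      to (inj₂ (inj₂ (inj₂ (inj₂ (inj₁ (suc zero , ℓ , c)))))) = bd1 ℓ c
      to (inj₂ (inj₂ (inj₂ (inj₂ (inj₁ (suc (suc zero) , ℓ , c)))))) = bd2 ℓ c
      to (inj₂ (inj₂ (inj₂ (inj₂ (inj₂ (i , e)))))) = tg i e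
      from : VS → Code
      from vs0 = inj₁ zero
      from qask = inj₁ (suc zero)
      from ansY = inj₁ (suc (suc zero))
      from ansN = inj₁ (suc (suc (suc zero)))
      from accS = inj₁ (suc (suc (suc (suc zero))))
      from rejS = inj₁ (suc (suc (suc (suc (suc zero)))))
      from (swp f) = inj₂ (inj₁ (zero , f))
      from (bck f) = inj₂ (inj₁ (suc zero , f))
      from (pck f) = inj₂ (inj₁ (suc (suc zero) , f))
      from (cls f i) = inj₂ (inj₂ (inj₁ (f , i)))
      from (lead ℓ) = inj₂ (inj₂ (inj₂ (inj₁ (zero , ℓ))))
      from (pre′ ℓ) = inj₂ (inj₂ (inj₂ (inj₁ (suc zero , ℓ))))
      from (rw ℓ) = inj₂ (inj₂ (inj₂ (inj₁ (suc (suc zero) , ℓ))))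
      from (bd0 ℓ c) = inj₂ (inj₂ (inj₂ (inj₂ (inj₁ (zero , ℓ , c)))))
      from (bd1 ℓ c) = inj₂ (inj₂ (inj₂ (inj₂ (inj₁ (suc zero , ℓ , c)))))
      from (bd2 ℓ c) = inj₂ (inj₂ (inj₂ (inj₂ (inj₁ (suc (suc zero) , ℓ , c)))))
      from (tg i e) = inj₂ (inj₂ (inj₂ (inj₂ (inj₂ (i , e)))))
      to-from : ∀ s → to (from s) ≡ s
      to-from = λ { vs0 → refl ; qask → refl ; ansY → refl ; ansN → refl ; accS → refl ; rejS → refl
                  ; (swp f) → refl ; (bck f) → refl ; (pck f) → refl ; (cls f i) → refl
                  ; (lead ℓ) → refl ; (pre′ ℓ) → refl ; (rw ℓ) → refl
                  ; (bd0 ℓ c) → refl ; (bd1 ℓ c) → refl ; (bd2 ℓ c) → refl ; (tg i e) → refl }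

  Gv : Set
  Gv = Γ (Cell (Bool × Bits) IH IH)

  cG : Bool → Bits → Gv
  cG o c = ext (core (o , c))

  payOf : Gv → Maybe Bool
  payOf (bit b)         = just b
  payOf (ext (owork m)) = m
  payOf _               = nothing

  isOrg : Gv → Bool
  isOrg (ext (owork _)) = true
  isOrg _               = false

  TV : Set
  TV = VS × Gv × Move × Gv × Move

  allBits : List Bits
  allBits = elems fin-Bits

  start : Bool → Fl
  start md = md , true , true , nothing

  δcls : Maybe Clause → Gv → Gv → List TV
  δcls nothing  a b = (accS , a , S , b , S) ∷ []
  δcls (just C) a b = map (λ ℓ → lead ℓ , a , S , b , S) (literals C)

  δv : VS → Gv → Gv → TV
  δv (lead ℓ) a b = pre′ ℓ , a , S , bit true , R
  δv (pre′ ℓ@((cl , _) , _)) a@(ext (core (_ , t , d , s))) b = pre′ ℓ , a , R , bit (if cl then true else s) , R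
  δv (pre′ ℓ) a b = rw ℓ , a , L , bit false , R
  δv (rw ℓ) a@(ext (core (true , c))) b = bd0 ℓ (true , true , true) , a , S , b , S
  δv (rw ℓ) a b = rw ℓ , a , L , b , S
  δv (bd0 ℓ@((_ , k , _) , _) (c₁ , c₂ , c₃)) a@(ext (core (_ , t , d , s))) b =
    bd1 ℓ (proj₂ (trStep k c₁ t) , c₂ , c₃) , a , S , bit (proj₁ (trStep k c₁ t)) , R
  δv (bd1 ℓ@((_ , _ , k , _) , _) (c₁ , c₂ , c₃)) a@(ext (core (_ , t , d , s))) b =
    bd2 ℓ (c₁ , proj₂ (trStep k c₂ d) , c₃) , a , S , bit (proj₁ (trStep k c₂ d)) , R
  δv (bd2 ℓ@((_ , _ , _ , k , _) , _) (c₁ , c₂ , c₃)) a@(ext (core (_ , t , d , s))) b =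
    bd0 ℓ (c₁ , c₂ , proj₂ (trStep k c₃ s)) , a , R , bit (proj₁ (trStep k c₃ s)) , R
  δv (bd0 ((_ , _ , _ , _ , t) , e) c) a b = tg (tagCode t) e , a , S , b , S
  δv (tg zero e) a b    = qask , bit e , S , b , S
  δv (tg (suc i) e) a b = tg (inject₁ i) e , a , S , bit true , R
  δv ansY (bit true) b  = accS , bit true , S , b , S
  δv ansN (bit false) b = accS , bit false , S , b , S
  -- The block starts behind `lend`, one cell further right than the guessed bits, so the query head
  -- has one more move to make.
  δv (bck f) a@(ext (core (true , c))) b = pck f , a , S , b , L
  δv (bck f) a b = bck f , a , L , b , L
  δv s a b = rejS , a , S , b , S

  δV : VS → Gv → Gv → List TV
  δV vs0 a b = map (λ md → swp (start md) , a , S , b , S) (elems fin-Bool)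
  δV (swp f) a (ext b) = map (λ c → swp (flagStep f (payOf a) c) , cG (isOrg a) c , R , ext b , R) allBits
  δV (swp f) a b       = (bck f , a , L , b , L) ∷ []
  δV (pck f) a b       = map (λ i → cls f i , a , S , b , S) (elems fin-Id)
  δV (cls f i) a b     = δcls (clause f i) a b
  δV s a b             = δv s a b ∷ []

  kindV : VS → Kind
  kindV vs0     = quant ∀Q
  kindV (swp f) = quant ∀Q
  kindV (bck f) = quant ∀Q
  kindV (pck f) = quant ∀Q
  kindV qask    = query
  kindV accS    = accept
  kindV rejS    = reject
  kindV _       = quant ∃Q

  verCore : Core
  verCore = record
    { X = Bool × Bits ; CSt = VS ; fin-X = fin-Bool fin× fin-Bits ; fin-CSt = fin-VS
    -- Two equal halves give the block even length. It is also the number of stages, so the stage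
    -- oracles, beginning with an existential one, end with a universal one.
    ; q₀ = ∀Q ; is₁ = IH ; is₂ = IH ; kindC = kindV ; c₀ = vs0 ; cy = ansY ; cn = ansN ; δC = δV }

-- Correctness and cost of the verifier

module Verification (M : AOTM) (h : Poly) (O : Lang) (x : Str) where
  open Clauses M
  open Verifier M h
  open Core verCore using (machine; program; rd; hd; read; zstep; zsys; ZConf)
  module Pre₂ = Prelude verCore O

  Yv : Sys
  Yv = zsys O

  vz : VS → Tape Gv → Tape Gv → ZConf
  vz s = zc (inj₂ s)

  liftV : TV → (Pre (Core.C verCore) ⊎ VS) × Gv × Move × Gv × Move
  liftV (s , e) = inj₂ s , e

  vstep : ∀ s {w o e n d q} → kindV s ≡ quant q → δV s (read w) (read o) ≡ e ∷ [] →
          Reach Yv q n (zstep (vz s w o) (liftV e)) d → Reach Yv q (suc n) (vz s w o) d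
  vstep s {w} {o} k e g = step k (cong (λ es → map (zstep (vz s w o)) (map liftV es)) e) g

  nodes : ∀ {A : Set} s {w o} (f : A → TV) {es} → δV s (read w) (read o) ≡ map f es →
          Sys.next Yv (vz s w o) ≡ map (λ a → zstep (vz s w o) (liftV (f a))) es
  nodes s {w} {o} f {es} e = trans (cong (λ es → map (zstep (vz s w o)) (map liftV es)) e)
    (trans (sym (map-∘ (map f es))) (sym (map-∘ es)))

  -- The question is written over the block. The remains of the block behind it end the query
  -- because they are not bits.
  NoBits : List Gv → Set
  NoBits r = ∀ i → bitΓ (rd r i) ≡ nothing

  noBits-tl : ∀ {r} → NoBits r → NoBits (tl r)
  noBits-tl {r} h i = trans (cong bitΓ (rd-tl □ r i)) (h (suc i))

  noBits-nf : ∀ {r} → NoBits r → NoBits (hd r ∷ tl r)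
  noBits-nf {r} h i = trans (cong bitΓ (rd-nf □ r i)) (h i)

  noCore : Gv → Bool
  noCore (ext (core _)) = false
  noCore _              = true

  wl : Bool → List Bits → List Gv
  wl o []       = []
  wl o (c ∷ cs) = cG o c ∷ wl false cs

  wl-false : ∀ cs → wl false cs ≡ map (cG false) cs
  wl-false []       = refl
  wl-false (c ∷ cs) = cong (cG false c ∷_) (wl-false cs)

  bits : Str → List Gv
  bits = map bit

  record Wrote (n : ℕ) (s : VS) (w : Tape Gv) (ol or : List Gv) (s′ : VS) (w′ : Tape Gv) (u : Str) : Set where
    constructor wrote
    field
      or′    : List Gv
      clean  : NoBits or′
      reach  : Reach Yv ∃Q n (vz s w (ol ◂ or)) (vz s′ w′ (bits u ʳ++ ol ◂ or′))

  infixr 5 _⋆_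
  _⋆_ : ∀ {n m s w ol or s₁ w₁ u s₂ w₂ v} → Wrote n s w ol or s₁ w₁ u →
        (∀ {or} → NoBits or → Wrote m s₁ w₁ (bits u ʳ++ ol) or s₂ w₂ v) → Wrote (n + m) s w ol or s₂ w₂ (u ++ v)
  _⋆_ {ol = ol} {u = u} {v = v} (wrote or₁ c₁ g₁) k with k c₁
  ... | wrote or₂ c₂ g₂ = wrote or₂ c₂ (g₁ ⨟ reach-cong refl refl
    (cong (λ z → vz _ _ (z ◂ or₂)) (sym (trans (cong (_ʳ++ ol) (map-++ bit u v)) (++-ʳ++ (bits u))))) g₂)

  writePrefix : ∀ ℓ o cs {l wr ol or} → NoBits or →
    Wrote (length cs) (pre′ ℓ) (l ◂ wl o cs ++ wr) ol or (pre′ ℓ) (wl o cs ʳ++ l ◂ wr) (prefixBits (proj₁ (proj₁ ℓ)) cs)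
  writePrefix ℓ o [] nb = wrote _ nb done
  writePrefix ℓ@((cl , _) , _) o ((t , d , s) ∷ cs) {ol = ol} {or} nb with writePrefix ℓ false cs {ol = bit (if cl then true else s) ∷ ol} (noBits-tl {or} nb)
  ... | wrote or′ nb′ g = wrote or′ nb′ (vstep (pre′ ℓ) refl refl g)

  pre-end : ∀ ℓ {a b} → noCore a ≡ true → δV (pre′ ℓ) a b ≡ (rw ℓ , a , L , bit false , R) ∷ []
  pre-end ℓ {□} e = refl
  pre-end ℓ {bit _} e = refl
  pre-end ℓ {ext (owork _)} e = refl
  pre-end ℓ {ext lend} e = refl
  pre-end ℓ {ext (pend _)} e = refl
  pre-end ℓ {ext (mk _)} e = refl

  endPrefix : ∀ ℓ {l wr ol or} → NoBits or → noCore (hd wr) ≡ true →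
    Wrote 1 (pre′ ℓ) (l ◂ wr) ol or (rw ℓ) (put (hd wr) L (l ◂ wr)) (false ∷ [])
  endPrefix ℓ {or = or} nb e = wrote _ (noBits-tl {or} nb) (vstep (pre′ ℓ) refl (pre-end ℓ e) done)

  rewindWork : ∀ ℓ ds hh {c wr ol or} → NoBits or →
    Wrote (length ds + 1) (rw ℓ) (put hh L (map (cG false) ds ++ cG true c ∷ [] ◂ wr)) ol or
      (bd0 ℓ (true , true , true)) ([] ◂ cG true c ∷ map (cG false) ds ʳ++ (hh ∷ tl wr)) []
  rewindWork ℓ [] hh {or = or} nb = wrote _ (noBits-nf {or} nb) (vstep (rw ℓ) refl refl done)
  rewindWork ℓ (d ∷ ds) hh {wr = wr} {or = or} nb with rewindWork ℓ ds (cG false d) {wr = cG false d ∷ hh ∷ tl wr} (noBits-nf {or} nb)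
  ... | wrote or′ nb′ g = wrote or′ nb′ (vstep (rw ℓ) refl refl g)

  carryOut : Tr × Tr × Tr → Bits → List Bits → Bits
  carryOut ks carry [] = carry
  carryOut ks@(kt , kd , k) (c₁ , c₂ , c₃) ((t , d , s) ∷ cs) =
    carryOut ks (proj₂ (trStep kt c₁ t) , proj₂ (trStep kd c₂ d) , proj₂ (trStep k c₃ s)) cs

  writeBody : ∀ cl kt kd ks t e o cs carry {l wr ol or} → NoBits or →
    let ℓ = (cl , kt , kd , ks , t) , e in
    Wrote (length cs * 3) (bd0 ℓ carry) (l ◂ wl o cs ++ wr) ol or (bd0 ℓ (carryOut (kt , kd , ks) carry cs)) (wl o cs ʳ++ l ◂ wr)
      (bodyBits (kt , kd , ks) carry cs)
  writeBody cl kt kd ks tag e o [] carry nb = wrote _ nb done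
  writeBody cl kt kd ks tag e o ((t , d , s) ∷ cs) (c₁ , c₂ , c₃) {or = or} nb
    with writeBody cl kt kd ks tag e false cs (proj₂ (trStep kt c₁ t) , proj₂ (trStep kd c₂ d) , proj₂ (trStep ks c₃ s))
           (noBits-tl {tl (tl or)} (noBits-tl {tl or} (noBits-tl {or} nb)))
  ... | wrote or′ nb′ g = wrote or′ nb′ (vstep (bd0 _ _) refl refl (vstep (bd1 _ _) refl refl (vstep (bd2 _ _) refl refl g)))

  body-end : ∀ ℓ c {a b} → noCore a ≡ true →
             δV (bd0 ℓ c) a b ≡ (tg (tagCode (proj₂ (proj₂ (proj₂ (proj₂ (proj₁ ℓ)))))) (proj₂ ℓ) , a , S , b , S) ∷ []
  body-end ℓ c {□} e = refl
  body-end ℓ c {bit _} e = refl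
  body-end ℓ c {ext (owork _)} e = refl
  body-end ℓ c {ext lend} e = refl
  body-end ℓ c {ext (pend _)} e = refl
  body-end ℓ c {ext (mk _)} e = refl

  writeTag : ∀ m (i : Fin tagSize) e {l a r ol or} → toℕ i ≡ m → NoBits or →
    Wrote (m + 1) (tg i e) (l ◂ a ∷ r) ol or qask (l ◂ bit e ∷ r) (replicate m true)
  writeTag zero zero e {or = or} eq nb = wrote _ (noBits-nf {or} nb) (vstep (tg zero e) refl refl done)
  writeTag (suc m) (suc i) e {ol = ol} {or} eq nb
    with writeTag m (inject₁ i) e {ol = bit true ∷ ol} (trans (Fin.toℕ-inject₁ i) (ℕ.suc-injective eq)) (noBits-tl {or} nb)
  ... | wrote or′ nb′ g = wrote or′ nb′ (vstep (tg (suc i) e) refl refl g)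

  decode-bits : ∀ u {r} → NoBits r → decodeBy bitΓ (bits u ++ r) ≡ u
  decode-bits [] {[]}    nb = refl
  decode-bits [] {a ∷ r} nb with bitΓ a | nb 0
  ... | nothing | _ = refl
  decode-bits (b ∷ u) nb = cong (b ∷_) (decode-bits u nb)

  verdict : ∀ u e {l r or k} → NoBits or →
    EvP Yv 2 k (just ∃Q) (vz qask (l ◂ bit e ∷ r) (bits u ʳ++ [] ◂ or)) (O u ≡ e)
  verdict u e {l} {r} {or} {k} nb = evp-query refl
    (subst (λ v → EvP Yv 1 k (just ∃Q) (answered v) (O u ≡ e)) (cong O (sym key)) (final (O u) e))
    where
    key : decodeBy bitΓ (full (bits u ʳ++ [] ◂ or)) ≡ u
    key = trans (cong (decodeBy bitΓ) (ʳ++-ʳ++ (bits u))) (decode-bits u nb)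
    answered : Bool → ZConf
    answered v = zc (if v then inj₂ ansY else inj₂ ansN) (l ◂ bit e ∷ r) ([] ◂ [])
    final : ∀ v e → EvP Yv 1 k (just ∃Q) (zc (if v then inj₂ ansY else inj₂ ansN) (l ◂ bit e ∷ r) ([] ◂ [])) (v ≡ e)
    final true  true  = reach-evp (vstep ansY {n = 0} refl refl done) (evp-map {Y = Yv} (λ _ → refl) (λ _ → tt) (evp-accept refl))
    final true  false = reach-evp (vstep ansY {n = 0} refl refl done) (evp-map {Y = Yv} (λ ()) (λ ()) (evp-reject refl))
    final false true  = reach-evp (vstep ansN {n = 0} refl refl done) (evp-map {Y = Yv} (λ ()) (λ ()) (evp-reject refl))
    final false false = reach-evp (vstep ansN {n = 0} refl refl done) (evp-map {Y = Yv} (λ _ → refl) (λ _ → tt) (evp-accept refl))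

  askCost : ℕ → ℕ
  askCost N = 1 + (N + (1 + (N + (N * 3 + (1 + (tagSize + 1)))))) + 2

  private
    wl-reverse : ∀ cs ys → wl false cs ʳ++ ys ≡ map (cG false) (reverse cs) ++ ys
    wl-reverse cs ys = trans (cong (_ʳ++ ys) (wl-false cs)) (trans (ʳ++-defn (map (cG false) cs)) (cong (_++ ys) (sym (reverse-map (cG false) cs))))

    reverse-wl : ∀ cs ys → map (cG false) (reverse cs) ʳ++ ys ≡ wl false cs ++ ys
    reverse-wl cs ys = trans (ʳ++-defn (map (cG false) (reverse cs)))
      (cong (_++ ys) (trans (sym (reverse-map (cG false) (reverse cs))) (trans (cong (map (cG false)) (reverse-involutive cs)) (sym (wl-false cs)))))

  rewindAll : ∀ ℓ c cs hh {wr ol or} → NoBits or →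
    Wrote (length cs + 1) (rw ℓ) (put hh L (wl true (c ∷ cs) ʳ++ [] ◂ wr)) ol or
      (bd0 ℓ (true , true , true)) ([] ◂ wl true (c ∷ cs) ++ hh ∷ tl wr) []
  rewindAll ℓ c cs hh {wr} {ol} {or} nb with rewindWork ℓ (reverse cs) hh {c} {wr} {ol} nb
  ... | wrote or′ nb′ g = wrote or′ nb′ (reach-cong (cong (_+ 1) (length-reverse cs))
    (cong (λ z → vz (rw ℓ) (put hh L (z ◂ wr)) (ol ◂ or)) (sym (wl-reverse cs _)))
    (cong (λ z → vz (bd0 ℓ (true , true , true)) ([] ◂ cG true c ∷ z) (ol ◂ or′)) (reverse-wl cs _)) g)

  asking : ∀ ℓ c cs {wr or k} → noCore (hd wr) ≡ true → NoBits or →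
    EvP Yv (askCost (suc (length cs))) k (just ∃Q) (vz (lead ℓ) ([] ◂ wl true (c ∷ cs) ++ wr) ([] ◂ or)) (Holds O (c ∷ cs) ℓ)
  asking ℓ@(a@(cl , kt , kd , ks , t) , e) c cs {wr} {or} {k} nc nb = evp-mono (ℕ.+-monoˡ-≤ 2 (cost (length cs))) ℕ.≤-refl (reach-evp (Wrote.reach chain) (verdict (question a (c ∷ cs)) e (Wrote.clean chain)))
    where
    leading : Wrote 1 (lead ℓ) ([] ◂ wl true (c ∷ cs) ++ wr) [] or (pre′ ℓ) ([] ◂ wl true (c ∷ cs) ++ wr) (true ∷ [])
    leading = wrote _ (noBits-tl {or} nb) (vstep (lead ℓ) refl refl done)
    ending : ∀ {l ol or carry} → NoBits or → Wrote 1 (bd0 ℓ carry) (l ◂ hd wr ∷ tl wr) ol or (tg (tagCode t) e) (l ◂ hd wr ∷ tl wr) []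
    ending {or = or} nb = wrote _ (noBits-nf {or} nb) (vstep (bd0 ℓ _) refl (body-end ℓ _ nc) done)
    chain : Wrote (1 + (suc (length cs) + (1 + (length cs + 1 + (suc (length cs) * 3 + (1 + (tagNo t + 1)))))))
              (lead ℓ) ([] ◂ wl true (c ∷ cs) ++ wr) [] or qask (wl true (c ∷ cs) ʳ++ [] ◂ bit e ∷ tl wr) (question a (c ∷ cs))
    chain = leading ⋆ (λ {or} nb → writePrefix ℓ true (c ∷ cs) {or = or} nb ⋆ (λ {or} nb → endPrefix ℓ {or = or} nb nc ⋆
      (λ {or} nb → rewindAll ℓ c cs (hd wr) {or = or} nb ⋆ (λ {or} nb → writeBody cl kt kd ks t e true (c ∷ cs) (true , true , true) {or = or} nb ⋆
      (λ {or} nb → ending {or = or} nb ⋆ (λ {or} nb → writeTag (tagNo t) (tagCode t) e {or = or} refl nb))))))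
    cost : ∀ n → 1 + (suc n + (1 + (n + 1 + (suc n * 3 + (1 + (tagNo t + 1)))))) ≤ 1 + (suc n + (1 + (suc n + (suc n * 3 + (1 + (tagSize + 1))))))
    cost n = s≤s (ℕ.+-monoʳ-≤ (suc n) (s≤s (ℕ.+-mono-≤ (ℕ.≤-reflexive (ℕ.+-comm n 1))
      (ℕ.+-monoʳ-≤ (suc n * 3) (s≤s (ℕ.+-monoˡ-≤ 1 (ℕ.<⇒≤ (Fin.toℕ<n (tagCode t)))))))))

  clauseCost : ℕ → ℕ
  clauseCost N = 2 + askCost N

  ClauseHolds : Fl → List Bits → Id → Set
  ClauseHolds fl cs i = ∀ C → clause fl i ≡ just C → Σ Lit λ ℓ → ℓ ∈ literals C × Holds O cs ℓ

  choosing : ∀ fl i c cs {wr or} → noCore (hd wr) ≡ true → NoBits or →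
    EvP Yv (suc (askCost (suc (length cs)))) 1 (just ∀Q) (vz (cls fl i) ([] ◂ wl true (c ∷ cs) ++ wr) ([] ◂ or)) (ClauseHolds fl (c ∷ cs) i)
  choosing fl i c cs {wr} {or} nc nb with clause fl i in eq
  ... | nothing = evp-map {P = Σ TV λ e → e ∈ (accS , _ , S , _ , S) ∷ [] × ⊤} (λ _ _ ()) (λ _ → _ , here refl , tt)
    (evp-ex (λ e → zstep (vz (cls fl i) ([] ◂ wl true (c ∷ cs) ++ wr) ([] ◂ or)) (liftV e)) (λ _ → ⊤) {j = 0} refl
      (trans (nodes (cls fl i) {w = [] ◂ wl true (c ∷ cs) ++ wr} {o = [] ◂ or} id (trans (cong (λ m → δcls m _ _) eq) (sym (map-id _)))) refl) (s≤s z≤n)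
      (λ { _ (here refl) → evp-accept refl }))
  ... | just C = evp-map (λ { (ℓ , i , p) _ refl → ℓ , i , p }) (λ h → h C refl)
    (evp-ex _ (Holds O (c ∷ cs)) {j = 0} refl
      (nodes (cls fl i) {w = [] ◂ wl true (c ∷ cs) ++ wr} {o = [] ◂ or} (λ ℓ → lead ℓ , _ , S , _ , S) (cong (λ m → δcls m _ _) eq)) (s≤s z≤n)
      (λ ℓ _ → asking ℓ c cs nc (noBits-nf {or} nb)))

  picking : ∀ fl c cs {wr or} → noCore (hd wr) ≡ true → NoBits or →
    EvP Yv (clauseCost (suc (length cs))) 1 (just ∀Q) (vz (pck fl) ([] ◂ wl true (c ∷ cs) ++ wr) ([] ◂ or)) (∀ i → ClauseHolds fl (c ∷ cs) i)
  picking fl c cs {wr} {or} nc nb = evp-map (λ h i → h i (complete fin-Id i)) (λ h i _ → h i)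
    (evp-all _ (ClauseHolds fl (c ∷ cs)) {j = 1} refl
      (nodes (pck fl) {w = [] ◂ wl true (c ∷ cs) ++ wr} {o = [] ◂ or} (λ i → cls fl i , _ , S , _ , S) refl) ℕ.≤-refl
      (λ i _ → choosing fl i c cs nc (noBits-nf {or} nb)))

  CleanTape : Tape Gv → Set
  CleanTape t = NoBits (full t)

  backing : ∀ fl ds hh {c wr} ol or → length ol ≡ suc (suc (length ds)) → CleanTape (ol ◂ or) →
    Σ (List Gv) λ or′ → NoBits or′ × Reach Yv ∀Q (length ds + 1)
      (vz (bck fl) (put hh L (map (cG false) ds ++ cG true c ∷ [] ◂ wr)) (put (hd or) L (ol ◂ or)))
      (vz (pck fl) ([] ◂ cG true c ∷ map (cG false) ds ʳ++ (hh ∷ tl wr)) ([] ◂ or′))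
  backing fl [] hh (b ∷ a ∷ []) or len cl = _ , (λ i → trans (cong bitΓ (eq i)) (cl i)) , vstep (bck fl) refl refl done
    where
    eq : ∀ i → rd (a ∷ b ∷ hd or ∷ tl or) i ≡ rd (a ∷ b ∷ or) i
    eq = put-same □ L (b ∷ a ∷ []) or
  backing fl (d ∷ ds) hh {wr = wr} (b ∷ ol) or len cl
    with backing fl ds (cG false d) {wr = cG false d ∷ hh ∷ tl wr} ol (b ∷ hd or ∷ tl or) (ℕ.suc-injective len)
           (λ i → trans (cong bitΓ (put-same □ L (b ∷ ol) or i)) (cl i))
  ... | or′ , nb , g = or′ , nb , vstep (bck fl) refl refl g

  private
    payOf-cell : ∀ i → payOf (Pre₂.cellAt x i) ≡ nth x i
    payOf-cell zero    = refl
    payOf-cell (suc i) with nth x (suc i)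
    ... | nothing = refl
    ... | just b  = refl

    isOrg-cell : ∀ i → isOrg (Pre₂.cellAt x i) ≡ isZ i
    isOrg-cell zero    = refl
    isOrg-cell (suc i) with nth x (suc i)
    ... | nothing = refl
    ... | just b  = refl

    noCore-cell : ∀ i → noCore (Pre₂.cellAt x i) ≡ true
    noCore-cell zero    = refl
    noCore-cell (suc i) with nth x (suc i)
    ... | nothing = refl
    ... | just b  = refl

    nth-tl : ∀ {A : Set} (y : List A) i → nth (tl y) i ≡ nth y (suc i)
    nth-tl []      i = refl
    nth-tl (_ ∷ _) i = refl

  -- The block on the query tape only measures the length. The guessed bits go onto the work tape
  -- over the input, so the input symbol reaches `flagStep` at the moment when the bits of its place
  -- are guessed.
  sweeping : ∀ ms fl y l r ol {ts T k} {K : Fl → List Bits → Set} →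
    (∀ i → rd r i ≡ Pre₂.cellAt x (length l + i)) → (∀ i → nth y i ≡ nth x (length l + i)) →
    (∀ cs r′ → length cs ≡ length ms → noCore (hd r′) ≡ true →
      EvP Yv T k (just ∀Q) (vz (swp (flags fl y cs)) (wl (isZ (length l)) cs ʳ++ l ◂ r′) (Pre₂.marks ms ʳ++ ol ◂ ts)) (K (flags fl y cs) cs)) →
    EvP Yv (length ms + T) k (just ∀Q) (vz (swp fl) (l ◂ r) (ol ◂ Pre₂.marks ms ++ ts)) (∀ cs → length cs ≡ length ms → K (flags fl y cs) cs)
  sweeping [] fl y l r ol hr hy cont = evp-map (λ { k [] refl → k }) (λ h → h [] refl)
    (cont [] r refl (trans (cong noCore (hr 0)) (noCore-cell (length l + 0))))
  sweeping (m ∷ ms) fl y l r ol {ts} {T} {k} {K} hr hy cont =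
    evp-map (λ { h (c ∷ cs) e → h c (complete fin-Bits c) cs (ℕ.suc-injective e) }) (λ h c _ cs e → h (c ∷ cs) (cong suc e))
      (evp-all _ (λ c → ∀ cs → length cs ≡ length ms → K (flags (flagStep fl (nth y 0) c) (tl y) cs) (c ∷ cs)) refl
        (trans (nodes (swp fl) {w = l ◂ r} {o = ol ◂ Pre₂.marks (m ∷ ms) ++ ts} (λ c → swp (flagStep fl (payOf (hd r)) c) , cG (isOrg (hd r)) c , R , ext (mk m) , R) refl)
          (map-cong (λ c → cong₂ (λ p o → vz (swp (flagStep fl p c)) (cG o c ∷ l ◂ tl r) (ext (mk m) ∷ ol ◂ Pre₂.marks ms ++ ts)) pay org) allBits))
        ℕ.≤-refl (λ c _ → sweeping ms (flagStep fl (nth y 0) c) (tl y) (cG (isZ (length l)) c ∷ l) (tl r) (ext (mk m) ∷ ol) {K = λ f cs → K f (c ∷ cs)}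
          (λ i → trans (rd-tl □ r i) (trans (hr (suc i)) (cong (Pre₂.cellAt x) (ℕ.+-suc (length l) i))))
          (λ i → trans (nth-tl y i) (trans (hy (suc i)) (cong (nth x) (ℕ.+-suc (length l) i))))
          (λ cs r′ e nc → cont (c ∷ cs) r′ (cong suc e) nc)))
    where
    pay : payOf (hd r) ≡ nth y 0
    pay = trans (cong payOf (hr 0)) (trans (payOf-cell _) (sym (hy 0)))
    org : isOrg (hd r) ≡ isZ (length l)
    org = trans (cong isOrg (hr 0)) (trans (isOrg-cell _) (cong isZ (ℕ.+-identityʳ (length l))))

  verCost : ℕ → ℕ
  verCost N = 1 + (N + (1 + (N + clauseCost N)))

  private
    clean-marks : ∀ ms {ts} → Pre₂.Blanks ts → CleanTape (Pre₂.marks ms ʳ++ (ext lend ∷ []) ◂ ts)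
    clean-marks ms {ts} bl i = trans (cong (λ z → bitΓ (rd z i)) (ʳ++-ʳ++ (Pre₂.marks ms))) (go′ i)
      where
      go : ∀ ms i → bitΓ (rd (Pre₂.marks ms ++ ts) i) ≡ nothing
      go []       i       = cong bitΓ (bl i)
      go (m ∷ ms) zero    = refl
      go (m ∷ ms) (suc i) = go ms i
      go′ : ∀ i → bitΓ (rd (ext lend ∷ Pre₂.marks ms ++ ts) i) ≡ nothing
      go′ zero    = refl
      go′ (suc i) = go ms i

    returning : ∀ ms fl c cs r′ {ts} → length (c ∷ cs) ≡ length ms → noCore (hd r′) ≡ true → Pre₂.Blanks ts →
      EvP Yv (1 + (length ms + clauseCost (length ms))) 1 (just ∀Q)
        (vz (swp fl) (wl true (c ∷ cs) ʳ++ [] ◂ r′) (Pre₂.marks ms ʳ++ (ext lend ∷ []) ◂ ts)) (∀ i → ClauseHolds fl (c ∷ cs) i)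
    returning ms fl c cs r′ {ts} len nc bl
      with backing fl (reverse cs) (hd r′) {c} {r′} (Pre₂.marks ms ʳ++ (ext lend ∷ [])) ts
             (trans (length-ʳ++ (Pre₂.marks ms)) (trans (ℕ.+-comm _ 1) (cong suc (trans (length-map _ ms) (trans (sym len) (cong suc (sym (length-reverse cs)))))))) (clean-marks ms bl)
    ... | or′ , nb , g = evp-mono (ℕ.≤-reflexive cost) ℕ.≤-refl (reach-evp (vstep (swp fl) refl end
      (reach-cong {m = length cs + 1} (cong (_+ 1) (length-reverse cs))
        (cong₂ (λ z b → vz (bck fl) (put (hd r′) L (z ◂ r′)) (put b L (Pre₂.marks ms ʳ++ (ext lend ∷ []) ◂ ts))) (sym (wl-reverse cs _)) (bl 0))
        (cong (λ z → vz (pck fl) ([] ◂ cG true c ∷ z) ([] ◂ or′)) (reverse-wl cs _)) g))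
      (picking fl c cs nc nb))
      where
      end : δV (swp fl) (hd r′) (hd ts) ≡ (bck fl , hd r′ , L , □ , L) ∷ []
      end = cong (δV (swp fl) (hd r′)) (bl 0)
      cost : suc (length cs + 1) + clauseCost (suc (length cs)) ≡ 1 + (length ms + clauseCost (length ms))
      cost = trans (cong (λ z → suc z + clauseCost (suc (length cs))) (ℕ.+-comm (length cs) 1)) (cong (λ z → suc (z + clauseCost z)) len)

  verified : EvP Yv (Pre₂.preTime x + verCost (Pre₂.blockLength x)) 2 nothing
               (zc (inj₁ s0) ([] ◂ map bit x) ([] ◂ [])) (Closed (Pre₂.blockLength x) x O)
  verified = evp-prev (reach-evp reach (evp-map
    (λ h md cs e i → h md (complete fin-Bool md) cs (trans e (sym cells≡)) i)
    (λ h md _ cs e i → h md cs (trans e cells≡) i)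
    (evp-mono (ℕ.≤-reflexive (cong verCost cells≡)) ℕ.≤-refl
    (evp-all _ (λ md → ∀ cs → length cs ≡ length ms → ∀ i → ClauseHolds (flagsOf md x cs) cs i) refl
      (nodes vs0 {w = [] ◂ r} {o = ext lend ∷ [] ◂ Pre₂.marks ms ++ ts} (λ md → swp (start md) , hd r , S , hd (Pre₂.marks ms ++ ts) , S) {elems fin-Bool} refl) ℕ.≤-refl
      (λ md _ → sweep (start md) ms (trans cells≡ block-pos))))))
    where
    open Pre₂.Prepared (Pre₂.prepare x)
    k = length x
    block-pos : Pre₂.blockLength x ≡ suc (Pre₂.blockLength x ∸ 1)
    block-pos = sym (ℕ.m+[n∸m]≡n (ℕ.≤-trans (ℕ.≤-trans (s≤s z≤n) (eval<cellPoly h k)) (ℕ.≤-trans (ℕ.≤-reflexive (sym (cellCount-instrsOf false h k))) (ℕ.m≤m+n _ _))))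
    sweep : ∀ fl ms′ {m} → length ms′ ≡ suc m → EvP Yv (length ms′ + (1 + (length ms′ + clauseCost (length ms′)))) 1 (just ∀Q)
              (vz (swp fl) ([] ◂ hd r ∷ tl r) (ext lend ∷ [] ◂ hd (Pre₂.marks ms′ ++ ts) ∷ tl (Pre₂.marks ms′ ++ ts)))
              (∀ cs → length cs ≡ length ms′ → ∀ i → ClauseHolds (flags fl x cs) cs i)
    sweep fl (m ∷ ms′) e = sweeping (m ∷ ms′) fl x [] _ (ext lend ∷ []) {K = λ f cs → ∀ i → ClauseHolds f cs i}
      (λ i → trans (rd-nf □ r i) (input i)) (λ i → refl)
      (λ { (c ∷ cs) r′ len nc → returning (m ∷ ms′) _ c cs r′ len nc blanks })

-- Arithmetic of bit strings

val : Str → ℕ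
val []      = 0
val (b ∷ u) = b→ℕ b + 2 * val u

zeros : ℕ → Str
zeros N = replicate N false

isZero : Str → Bool
isZero []      = true
isZero (b ∷ u) = not b ∧ isZero u

unary : ℕ → ℕ → Str
unary zero    σ       = []
unary (suc N) zero    = false ∷ unary N zero
unary (suc N) (suc σ) = true ∷ unary N σ

length-transduce : ∀ k c u → length (transduce k c u) ≡ length u
length-transduce k c []      = refl
length-transduce k c (b ∷ u) = cong suc (length-transduce k _ u)

app-id : ∀ u → app idK u ≡ u
app-id []      = refl
app-id (b ∷ u) = cong (b ∷_) (app-id u)

app-zero : ∀ u → app zeroK u ≡ zeros (length u)
app-zero []      = refl
app-zero (b ∷ u) = cong (false ∷_) (app-zero u)

private
  dec-false : ∀ u → transduce decK false u ≡ u
  dec-false []      = refl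
  dec-false (b ∷ u) = cong (b ∷_) (dec-false u)

  inc-false : ∀ u → transduce incK false u ≡ u
  inc-false []      = refl
  inc-false (b ∷ u) = cong (b ∷_) (inc-false u)

  upred-false : ∀ u → transduce upredK false u ≡ u
  upred-false []      = refl
  upred-false (b ∷ u) = cong (b ∷_) (upred-false u)

  usucc-false : ∀ u → transduce usuccK false u ≡ u
  usucc-false []      = refl
  usucc-false (b ∷ u) = cong (b ∷_) (usucc-false u)

dec-inc : ∀ u → app decK (app incK u) ≡ u
dec-inc []          = refl
dec-inc (true ∷ u)  = cong (true ∷_) (dec-inc u)
dec-inc (false ∷ u) = cong (false ∷_) (trans (dec-false _) (inc-false u))

val-dec : ∀ u → isZero u ≡ false → val u ≡ suc (val (app decK u))
val-dec (true ∷ u)  e = cong (λ z → suc (2 * val z)) (sym (dec-false u))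
val-dec (false ∷ u) e = trans (cong (2 *_) (val-dec u e)) (lem (val (app decK u)))
  where
  lem : ∀ n → 2 * suc n ≡ suc (1 + 2 * n)
  lem = solve-∀

val-zero : ∀ u → isZero u ≡ true → val u ≡ 0 × u ≡ zeros (length u)
val-zero []          e = refl , refl
val-zero (false ∷ u) e = cong (2 *_) (proj₁ (val-zero u e)) , cong (false ∷_) (proj₂ (val-zero u e))

isZero-zeros : ∀ N → isZero (zeros N) ≡ true
isZero-zeros zero    = refl
isZero-zeros (suc N) = isZero-zeros N

val-inc : ∀ u → suc (val u) < 2 ^ length u → val (app incK u) ≡ suc (val u)
val-inc []          (s≤s ())
val-inc (false ∷ u) lt = cong (λ z → suc (2 * val z)) (inc-false u)
val-inc (true ∷ u)  lt = trans (cong (2 *_) (val-inc u (ℕ.*-cancelˡ-< 2 _ _ (ℕ.≤-trans (ℕ.≤-reflexive (cong suc (lem (val u)))) lt)))) (lem (val u))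
  where
  lem : ∀ n → 2 * suc n ≡ suc (1 + 2 * n)
  lem = solve-∀

val-injective : ∀ u v → length u ≡ length v → val u ≡ val v → u ≡ v
val-injective []      []      l e = refl
val-injective (b ∷ u) (c ∷ v) l e with parity b c e
  where
  odd≢even : ∀ m n → suc (2 * m) ≢ 2 * n
  odd≢even zero    (suc n) e with () ← trans (ℕ.suc-injective e) (ℕ.+-suc n (n + 0))
  odd≢even (suc m) (suc n) e = odd≢even m n (ℕ.suc-injective (ℕ.suc-injective (trans (cong suc (sym (lem m))) (trans e (lem n)))))
    where
    lem : ∀ n → 2 * suc n ≡ suc (suc (2 * n))
    lem = solve-∀
  parity : ∀ b c → b→ℕ b + 2 * val u ≡ b→ℕ c + 2 * val v → b ≡ c × 2 * val u ≡ 2 * val v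
  parity true  true  e = refl , ℕ.suc-injective e
  parity false false e = refl , e
  parity true  false e = ⊥-elim (odd≢even (val u) (val v) e)
  parity false true  e = ⊥-elim (odd≢even (val v) (val u) (sym e))
... | refl , e′ = cong (b ∷_) (val-injective u v (ℕ.suc-injective l) (ℕ.*-cancelˡ-≡ _ _ 2 e′))

bitsOf : ℕ → ℕ → Str
bitsOf N zero    = zeros N
bitsOf N (suc k) = app incK (bitsOf N k)

length-bitsOf : ∀ N k → length (bitsOf N k) ≡ N
length-bitsOf N zero    = length-replicate N
length-bitsOf N (suc k) = trans (length-transduce incK true (bitsOf N k)) (length-bitsOf N k)

val-bitsOf : ∀ N k → k < 2 ^ N → val (bitsOf N k) ≡ k
val-bitsOf N zero    lt = proj₁ (val-zero (zeros N) (isZero-zeros N))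
val-bitsOf N (suc k) lt = trans
  (val-inc (bitsOf N k) (ℕ.≤-trans (ℕ.≤-reflexive (cong (λ z → suc (suc z)) ih)) (ℕ.≤-trans lt (ℕ.≤-reflexive (cong (2 ^_) (sym (length-bitsOf N k)))))))
  (cong suc ih)
  where
  ih : val (bitsOf N k) ≡ k
  ih = val-bitsOf N k (ℕ.<-trans (ℕ.n<1+n k) lt)

val< : ∀ u → val u < 2 ^ length u
val< []      = s≤s z≤n
val< (b ∷ u) = ℕ.≤-trans (s≤s (ℕ.+-monoˡ-≤ (2 * val u) (b≤ b))) (ℕ.≤-trans (ℕ.≤-reflexive (lem (val u))) (ℕ.*-monoʳ-≤ 2 (val< u)))
  where
  b≤ : ∀ b → b→ℕ b ≤ 1
  b≤ true  = ℕ.≤-refl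
  b≤ false = z≤n
  lem : ∀ n → suc (1 + 2 * n) ≡ 2 * suc n
  lem = solve-∀

bitsOf-val : ∀ N u → length u ≡ N → bitsOf N (val u) ≡ u
bitsOf-val N u refl = val-injective _ _ (length-bitsOf N (val u)) (val-bitsOf N (val u) (val< u))

isZero-bitsOf : ∀ N k → suc k < 2 ^ N → isZero (bitsOf N (suc k)) ≡ false
isZero-bitsOf N k lt with isZero (bitsOf N (suc k)) in e
... | false = refl
... | true with () ← trans (sym (proj₁ (val-zero (bitsOf N (suc k)) e))) (val-bitsOf N (suc k) lt)

upred-trues : ∀ u k → trues u ≡ suc k → trues (app upredK u) ≡ k
upred-trues (true ∷ u)  k e = trans (cong trues (upred-false u)) (ℕ.suc-injective e)
upred-trues (false ∷ u) k e = upred-trues u k e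

isZero-trues : ∀ u → isZero u ≡ true → trues u ≡ 0
isZero-trues []          e = refl
isZero-trues (false ∷ u) e = isZero-trues u e

nonZero-trues : ∀ u → isZero u ≡ false → Σ ℕ λ k → trues u ≡ suc k
nonZero-trues (true ∷ u)  e = trues u , refl
nonZero-trues (false ∷ u) e = nonZero-trues u e

usucc-unary : ∀ N σ → σ < N → app usuccK (unary N σ) ≡ unary N (suc σ)
usucc-unary (suc N) zero    lt       = cong (true ∷_) (usucc-false _)
usucc-unary (suc N) (suc σ) (s≤s lt) = cong (true ∷_) (usucc-unary N σ lt)

unary-zero : ∀ N → unary N 0 ≡ zeros N
unary-zero zero    = refl
unary-zero (suc N) = cong (false ∷_) (unary-zero N)

length-unary : ∀ N σ → length (unary N σ) ≡ N
length-unary zero    σ       = refl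
length-unary (suc N) zero    = cong suc (length-unary N zero)
length-unary (suc N) (suc σ) = cong suc (length-unary N σ)

payOr : Maybe Bool → Str → Str → Maybe Bool
payOr p x []          = p
payOr p x (true ∷ τ)  = nth x 0
payOr p x (false ∷ τ) = payOr p (tl x) τ

unweave : ℕ → Str → Str × Str × Str × Str
unweave (suc n) (a ∷ b ∷ c ∷ y) = let u , v , w , z = unweave n y in a ∷ u , b ∷ v , c ∷ w , z
unweave _       y               = [] , [] , [] , y

unweave-weave : ∀ u v w {z} → length v ≡ length u → length w ≡ length u → unweave (length u) (weave u v w ++ z) ≡ (u , v , w , z)
unweave-weave []      []      []      lv lw = refl
unweave-weave (a ∷ u) (b ∷ v) (c ∷ w) lv lw =
  cong (λ (u , v , w , z) → a ∷ u , b ∷ v , c ∷ w , z) (unweave-weave u v w (ℕ.suc-injective lv) (ℕ.suc-injective lw))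

nth-lookup : ∀ {A : Set} (as : List A) i → nth as (toℕ i) ≡ just (lookup as i)
nth-lookup (a ∷ as) zero    = refl
nth-lookup (a ∷ as) (suc i) = nth-lookup as i

tupleAux-ones : ∀ Bs k i y → tupleAux Bs i (replicate k true ++ false ∷ y) ≡ tupleAux Bs (k + i) (false ∷ y)
tupleAux-ones Bs zero    i y = refl
tupleAux-ones Bs (suc k) i y = trans (tupleAux-ones Bs k (suc i) y) (cong (λ j → tupleAux Bs j (false ∷ y)) (ℕ.+-suc k i))

lookupL-last : ∀ Bs C y → lookupL (Bs ++ C ∷ []) (length Bs) y ≡ C y
lookupL-last []       C y = refl
lookupL-last (B ∷ Bs) C y = lookupL-last Bs C y

lookupL-init : ∀ Bs C i y → i < length Bs → lookupL (Bs ++ C ∷ []) i y ≡ lookupL Bs i y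
lookupL-init (B ∷ Bs) C zero    y lt       = refl
lookupL-init (B ∷ Bs) C (suc i) y (s≤s lt) = lookupL-init Bs C i y lt

times3 : Str → Str → Str → List (Bool × Bool × Bool)
times3 (a ∷ u) (b ∷ v) (c ∷ w) = (a , b , c) ∷ times3 u v w
times3 _       _       _       = []

t₁ t₂ t₃ : List (Bool × Bool × Bool) → Str
t₁ = map proj₁
t₂ = map (proj₁ ∘ proj₂)
t₃ = map (proj₂ ∘ proj₂)

times3-proj : ∀ u v w → length v ≡ length u → length w ≡ length u →
              t₁ (times3 u v w) ≡ u × t₂ (times3 u v w) ≡ v × t₃ (times3 u v w) ≡ w × length (times3 u v w) ≡ length u
times3-proj []      []      []      lv lw = refl , refl , refl , refl
times3-proj (a ∷ u) (b ∷ v) (c ∷ w) lv lw with times3-proj u v w (ℕ.suc-injective lv) (ℕ.suc-injective lw)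
... | p , q , r , l = cong (a ∷_) p , cong (b ∷_) q , cong (c ∷_) r , cong suc l

-- The meaning of questions

module Questions (M : AOTM) where
  open Clauses M

  flags-md : ∀ md zt zd pay x cs → flags (md , zt , zd , pay) x cs ≡
             (md , zt ∧ isZero (t₁ cs) , zd ∧ isZero (t₂ cs) , (if zt then payOr pay x (t₁ cs) else pay))
  flags-md md true  true  pay x [] = refl
  flags-md md true  false pay x [] = refl
  flags-md md false true  pay x [] = refl
  flags-md md false false pay x [] = refl
  flags-md md zt zd pay x ((t , d , s) ∷ cs) = trans (flags-md md (zt ∧ not t) (zd ∧ not d) (if zt ∧ t then nth x 0 else pay) (tl x) cs)
    (cong₂ (λ a b → md , a , b) (Bool.∧-assoc zt (not t) _) (cong₂ _,_ (Bool.∧-assoc zd (not d) _) (pays zt t)))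
    where
    pays : ∀ zt t → (if zt ∧ not t then payOr (if zt ∧ t then nth x 0 else pay) (tl x) (t₁ cs) else (if zt ∧ t then nth x 0 else pay)) ≡
                    (if zt then payOr pay x (t ∷ t₁ cs) else pay)
    pays true  true  = refl
    pays true  false = refl
    pays false t     = refl

  flagsOf≡ : ∀ md x cs → flagsOf md x cs ≡ (md , isZero (t₁ cs) , isZero (t₂ cs) , payOr nothing x (t₁ cs))
  flagsOf≡ md x cs = flags-md md true true nothing x cs

  bodyBits-weave : ∀ k₁ k₂ k₃ c₁ c₂ c₃ cs → bodyBits (k₁ , k₂ , k₃) (c₁ , c₂ , c₃) cs ≡
                   weave (transduce k₁ c₁ (t₁ cs)) (transduce k₂ c₂ (t₂ cs)) (transduce k₃ c₃ (t₃ cs))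
  bodyBits-weave k₁ k₂ k₃ c₁ c₂ c₃ [] = refl
  bodyBits-weave k₁ k₂ k₃ c₁ c₂ c₃ ((t , d , s) ∷ cs) = cong (λ z → _ ∷ _ ∷ _ ∷ z) (bodyBits-weave k₁ k₂ k₃ _ _ _ cs)

  body : Str → Str → Str → Tag → Str
  body t d s tag = weave t d s ++ replicate (tagNo tag) true

  claimBody : Tr → Tr → Tr → Tag → List Bits → Str
  claimBody kt kd ks tag cs = body (app kt (t₁ cs)) (app kd (t₂ cs)) (app ks (t₃ cs)) tag

  private
    prefix-true : ∀ cs → prefixBits true cs ≡ replicate (length cs) true
    prefix-true []       = refl
    prefix-true (c ∷ cs) = cong (true ∷_) (prefix-true cs)

    prefix-false : ∀ cs → prefixBits false cs ≡ t₃ cs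
    prefix-false []       = refl
    prefix-false (c ∷ cs) = cong (_ ∷_) (prefix-false cs)

  claim-value : ∀ Bs C cs kt kd ks tag → length Bs ≡ length cs →
    tupleOracle (Bs ++ C ∷ []) (question (true , kt , kd , ks , tag) cs) ≡ C (claimBody kt kd ks tag cs)
  claim-value Bs C cs kt kd ks tag e rewrite prefix-true cs | bodyBits-weave kt kd ks true true true cs =
    trans (tupleAux-ones (Bs ++ C ∷ []) (length cs) 1 _)
      (trans (cong (λ j → tupleAux (Bs ++ C ∷ []) j (false ∷ claimBody kt kd ks tag cs)) (ℕ.+-comm (length cs) 1))
        (trans (cong (λ j → lookupL (Bs ++ C ∷ []) j (claimBody kt kd ks tag cs)) (sym e)) (lookupL-last Bs C _)))

  -- The stage string is queried in full, so the index is followed by the unused zeros.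
  choiceString : ℕ → ℕ → Str → Tn → Str
  choiceString N σ t e = zeros (N ∸ suc σ) ++ false ∷ body t (zeros N) (zeros N) (choice e)

  choiceBit : List Lang → ℕ → ℕ → Str → Tn → Bool
  choiceBit Bs N σ t e = lookupL Bs σ (choiceString N σ t e)

  private
    unary-split : ∀ N σ → σ < N → unary N σ ≡ replicate σ true ++ false ∷ zeros (N ∸ suc σ)
    unary-split (suc N) zero    lt       = cong (false ∷_) (unary-zero N)
    unary-split (suc N) (suc σ) (s≤s lt) = cong (true ∷_) (unary-split N σ lt)

  choice-value : ∀ Bs C cs σ e → length Bs ≡ length cs → σ < length cs → t₃ cs ≡ unary (length cs) σ →
    tupleOracle (Bs ++ C ∷ []) (question (choiceA e) cs) ≡ choiceBit Bs (length cs) σ (app decK (t₁ cs)) e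
  choice-value Bs C cs σ e len lt eq
    rewrite prefix-false cs | bodyBits-weave decK zeroK zeroK true true true cs | app-zero (t₂ cs) | app-zero (t₃ cs)
          | length-map (proj₁ ∘ proj₂) cs | length-map (proj₂ ∘ proj₂) cs | eq | unary-split (length cs) σ lt =
    trans (cong (λ z → tupleAux (Bs ++ C ∷ []) 1 z) (++-assoc (replicate σ true) (false ∷ zeros (length cs ∸ suc σ)) _))
      (trans (tupleAux-ones (Bs ++ C ∷ []) σ 1 _)
      (trans (cong (λ j → tupleAux (Bs ++ C ∷ []) j (false ∷ zeros (length cs ∸ suc σ) ++ false ∷ body (app decK (t₁ cs)) (zeros (length cs)) (zeros (length cs)) (choice e))) (ℕ.+-comm σ 1))
        (lookupL-init Bs C σ _ (ℕ.≤-trans lt (ℕ.≤-reflexive (sym len))))))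

  tagAt : ℕ → Maybe Tag
  tagAt zero    = nothing
  tagAt (suc n) = nth (elems fin-Tag) n

  tagAt-No : ∀ t → tagAt (tagNo t) ≡ just t
  tagAt-No t = trans (nth-lookup (elems fin-Tag) (code fin-Tag t)) (cong just (decode-code fin-Tag t))

  evalMaybe : (Tag → Bool) → Maybe Tag → Bool
  evalMaybe f nothing  = false
  evalMaybe f (just t) = f t

  -- The inverse of `body`, with the tag recovered from the number of trailing 1s, so that an oracle
  -- can be specified by its facts.
  fromFacts : ℕ → (Str → Str → Str → Tag → Bool) → Lang
  fromFacts N F y = let t , d , s , z = unweave N y in evalMaybe (F t d s) (tagAt (length z))

  fromFacts-body : ∀ F t d s tag → length d ≡ length t → length s ≡ length t →
                   fromFacts (length t) F (body t d s tag) ≡ F t d s tag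
  fromFacts-body F t d s tag ld ls = trans
    (cong (λ (t , d , s , z) → evalMaybe (F t d s) (tagAt (length z))) (unweave-weave t d s {replicate (tagNo tag) true} ld ls))
    (cong (evalMaybe (F t d s)) (trans (cong tagAt (length-replicate (tagNo tag))) (tagAt-No tag)))

  module _ (f : Atom → Bool) where
    -- Atoms are decidable, so an implication becomes a disjunction: a failing premise supplies the
    -- literal, and if none fails the conclusion does.
    literals-complete : ∀ ps cs → ((∀ a b → (a , b) ∈ ps → f a ≡ b) → Σ Atom λ c → c ∈ cs × f c ≡ true) →
                        Σ Lit λ ℓ → ℓ ∈ literals (ps , cs) × f (proj₁ ℓ) ≡ proj₂ ℓ
    literals-complete [] cs h with h (λ _ _ ())
    ... | c , c∈ , e = (c , true) , ∈-map⁺ (_, true) c∈ , e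
    literals-complete ((a , b) ∷ ps) cs h with f a in fa | b
    ... | true  | false = (a , true) , here refl , fa
    ... | false | true  = (a , false) , here refl , fa
    ... | true  | true  = let ℓ , i , e = literals-complete ps cs (λ g → h λ { _ _ (here refl) → fa ; a b (there j) → g a b j }) in ℓ , there i , e
    ... | false | false = let ℓ , i , e = literals-complete ps cs (λ g → h λ { _ _ (here refl) → fa ; a b (there j) → g a b j }) in ℓ , there i , e

    literals-sound : ∀ ps cs → (Σ Lit λ ℓ → ℓ ∈ literals (ps , cs) × f (proj₁ ℓ) ≡ proj₂ ℓ) →
                     (∀ a b → (a , b) ∈ ps → f a ≡ b) → Σ Atom λ c → c ∈ cs × f c ≡ true
    literals-sound [] cs (ℓ , i , e) h with ∈-map⁻ (_, true) i
    ... | c , c∈ , refl = c , c∈ , e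
    literals-sound ((a , b) ∷ ps) cs (ℓ , here refl , e) h = ⊥-elim (contra b (h a b (here refl)) e)
      where
      contra : ∀ b → f a ≡ b → f a ≡ not b → ⊥
      contra true  p q with () ← trans (sym p) q
      contra false p q with () ← trans (sym p) q
    literals-sound ((a , b) ∷ ps) cs (ℓ , there i , e) h = literals-sound ps cs (ℓ , i , e) (λ a b j → h a b (there j))

-- Actions and their choice literals

module Actions (M : AOTM) where
  open AOTM M using (δ; kind)
  open Clauses M

  Satisfied : (Tn → Bool) → List (Tn × Bool) → Set
  Satisfied α ls = ∀ e b → (e , b) ∈ ls → α e ≡ b

  private
    sat-∷ : ∀ {α e b ls} → α e ≡ b → Satisfied α ls → Satisfied α ((e , b) ∷ ls)
    sat-∷ p s _ _ (here refl) = p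
    sat-∷ p s e b (there i)   = s e b i

    sat-tl : ∀ {α l ls} → Satisfied α (l ∷ ls) → Satisfied α ls
    sat-tl s e b i = s e b (there i)

    consM-just : ∀ {l m ls} → consM l m ≡ just ls → Σ (List (Tn × Bool)) λ ks → m ≡ just ks × ls ≡ l ∷ ks
    consM-just {m = just ks} refl = ks , refl , refl

    path-sound : ∀ α b x e es {ls} → path b x e es ≡ just ls → Satisfied α ls → pick α e es ≡ take b x
    path-sound α b x e [] p s with eqT x e in eq
    path-sound α b x e [] refl s | true = cong₂ take
      (trans (cong not (s e (not b) (here refl))) (Bool.not-involutive b)) (sym (eqF-sound fin-Tn x e eq))
    path-sound α true x e (e′ ∷ es) p s with consM-just {m = path true x e′ es} p
    ... | ks , q , refl rewrite s e false (here refl) = path-sound α true x e′ es q (sat-tl s)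
    path-sound α false x e (e′ ∷ es) p s with eqT x e in eq
    path-sound α false x e (e′ ∷ es) refl s | true rewrite s e true (here refl) = cong (take false) (sym (eqF-sound fin-Tn x e eq))
    path-sound α false x e (e′ ∷ es) p s | false with consM-just {m = path false x e′ es} p
    ... | ks , q , refl rewrite s e false (here refl) = path-sound α false x e′ es q (sat-tl s)

    chosen : ∀ α e es {x} → pick α e es ≡ take false x → α x ≡ true
    chosen α e [] p with α e in eq
    chosen α e [] refl | true = eq
    chosen α e (e′ ∷ es) p with α e in eq
    chosen α e (e′ ∷ es) refl | true = eq
    ... | false = chosen α e′ es p

    path-complete : ∀ α b x e es → pick α e es ≡ take b x → Σ (List (Tn × Bool)) λ ls → path b x e es ≡ just ls × Satisfied α ls
    path-complete α b x e [] refl rewrite eqF-refl fin-Tn e = _ , refl , sat-∷ (sym (Bool.not-involutive (α e))) (λ _ _ ())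
    path-complete α b x e (e′ ∷ es) p with α e in eq
    path-complete α b x e (e′ ∷ es) refl | true rewrite eqF-refl fin-Tn e = _ , refl , sat-∷ eq (λ _ _ ())
    path-complete α true x e (e′ ∷ es) p | false with path-complete α true x e′ es p
    ... | ls , q , s rewrite q = _ , refl , sat-∷ eq s
    path-complete α false x e (e′ ∷ es) p | false with eqT x e in eq′
    ... | true with () ← trans (sym eq) (trans (cong α (sym (eqF-sound fin-Tn x e eq′))) (chosen α e′ es p))
    ... | false with path-complete α false x e′ es p
    ...   | ls , q , s rewrite q = _ , refl , sat-∷ eq s

    pick-take : ∀ α e es → Σ Bool λ b → Σ Tn λ x → pick α e es ≡ take b x
    pick-take α e [] = _ , _ , refl
    pick-take α e (e′ ∷ es) with α e
    ... | true  = _ , _ , refl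
    ... | false = pick-take α e′ es

  -- With `required-complete`: for given choice bits exactly one action has its required literals
  -- satisfied. This lets definite clauses describe a function.
  required-sound : ∀ α act ρ {ls} → required act ρ ≡ just ls → Satisfied α ls → actOf α ρ ≡ act
  required-sound α act ρ@(q , pl , a , b) p s = go act (kind q) p
    where
    branch : ∀ act v es {ls} → reqBranch act v es ≡ just ls → Satisfied α ls → actBranch α v es ≡ act
    branch swap       false es       p s = refl
    branch stay       true  []       p s = refl
    branch (take c x) true  (e ∷ es) p s = path-sound α c x e es p s
    go : ∀ act k → reqKind act k ρ ≡ just _ → actKind α k ρ ≡ act
    go act  (quant Q) p = branch act (sameQ Q pl) (δ q a b) p s
    go call query     p = refl
    go stay accept    p = refl
    go stay reject    p = refl

  required-complete : ∀ α ρ → Σ (List (Tn × Bool)) λ ls → required (actOf α ρ) ρ ≡ just ls × Satisfied α ls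
  required-complete α ρ@(q , pl , a , b) = go (kind q)
    where
    branch : ∀ v es → Σ (List (Tn × Bool)) λ ls → reqBranch (actBranch α v es) v es ≡ just ls × Satisfied α ls
    branch false es = [] , refl , λ _ _ ()
    branch true [] = [] , refl , λ _ _ ()
    branch true (e ∷ es) with pick-take α e es
    ... | c , x , p with path-complete α c x e es p
    ...   | ls , q , s rewrite p = ls , q , s
    go : ∀ k → Σ (List (Tn × Bool)) λ ls → reqKind (actKind α k ρ) k ρ ≡ just ls × Satisfied α ls
    go (quant Q) = branch (sameQ Q pl) (δ q a b)
    go query     = [] , refl , λ _ _ ()
    go accept    = [] , refl , λ _ _ ()
    go reject    = [] , refl , λ _ _ ()

-- The least model of the clauses

module Tableau (M : AOTM) (x : Str) (N : ℕ) (Bs : List Lang) (len : length Bs ≡ N) where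
  open AOTM M using () renaming (start to startᴹ)
  open Clauses M
  open Questions M
  open Actions M

  payAt : Str → Maybe Bool
  payAt = payOr nothing x

  -- The symbol at depth d after as many loading steps as t has ones.
  loadAt : ℕ → Str → Str → Sy
  loadAt zero    t d = zero
  loadAt (suc k) t d = if isZero d then paySym (payAt t) else loadAt k (app upredK t) (app decK d)

  loaded : Str → Str → Sy
  loaded t d = loadAt (trues t) t d

  record SR : Set where
    constructor sr
    field
      rho   : Rho
      stage : ℕ
      cell  : Str → V

  open SR

  αAt : ℕ → ℕ → Tn → Bool
  αAt σ j = choiceBit Bs N σ (bitsOf N j)

  bump : Act → ℕ → ℕ
  bump swap σ = suc σ
  bump _    σ = σ

  stepRow : Act → SR → SR
  stepRow act (sr ρ σ F) = sr (rowUpd act ρ (F (zeros N))) (bump act σ)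
    (λ d → cellUpd act (F (zeros N)) (isZero d) (F (app decK d)) (F d) (F (app incK d)))

  full1 : Str
  full1 = app decK (zeros N)

  -- The run as the clauses see it, with depths modulo 2^N and the error at the wrap-around
  -- included. It is compared with the machine separately, so that the arguments about the clauses
  -- are exact.
  rowAt : ℕ → SR
  -- The head stands on cell 0, so depth `d` on its right is input cell d + 1.
  rowAt zero    = sr (startᴹ , ∃Q , loaded full1 (zeros N) , zero) 0 (λ d → (nothing , loaded full1 (app incK d)) , (nothing , zero))
  rowAt (suc j) = stepRow (actOf (αAt (stage (rowAt j)) j) (rho (rowAt j))) (rowAt j)

  actAt : ℕ → Act
  actAt j = actOf (αAt (stage (rowAt j)) j) (rho (rowAt j))

  -- Stage strings are unary of length `N`, and there are `N` stage oracles. The bound will come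
  -- from the alternation bound of the machine.
  Staged : Set
  Staged = ∀ j → stage (rowAt j) < N

  fact : Str → Str → Str → Tag → Bool
  fact t d s (load a)   = eqF (fin-Fin _) (loaded t d) a
  fact t d s (depth v)  = eqF fin-V (cell (rowAt (val t)) d) v
  fact t d s (row ρ)    = eqF fin-Rho (rho (rowAt (val t))) ρ ∧ strEq s (unary N (stage (rowAt (val t))))
  fact t d s (choice e) = false

  truth : Lang
  truth = fromFacts N fact

  private
    loaded-zero : ∀ t d → isZero t ≡ true → loaded t d ≡ zero
    loaded-zero t d e rewrite isZero-trues t e = refl

    loaded-push : ∀ t d → isZero t ≡ false → isZero d ≡ true → loaded t d ≡ paySym (payAt t)
    loaded-push t d e z with nonZero-trues t e
    ... | k , p rewrite p | z = refl

    loaded-shift : ∀ t d → isZero t ≡ false → isZero d ≡ false → loaded t d ≡ loaded (app upredK t) (app decK d)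
    loaded-shift t d e z with nonZero-trues t e
    ... | k , p rewrite upred-trues t k p | p | z = refl

    stageTr-unary : ∀ act {σ} → σ < N → app (stageTr act) (unary N σ) ≡ unary N (bump act σ)
    stageTr-unary stay       lt = app-id _
    stageTr-unary call       lt = app-id _
    stageTr-unary swap       lt = usucc-unary N _ lt
    stageTr-unary (take _ _) lt = app-id _

    ∧-true : ∀ {a b} → a ∧ b ≡ true → a ≡ true × b ≡ true
    ∧-true {true} {true} refl = refl , refl

  module _ (cs : List Bits) (lcs : length cs ≡ N) where
    private
      t = t₁ cs
      d = t₂ cs
      s = t₃ cs

      lt : length t ≡ N
      lt = trans (length-map proj₁ cs) lcs
      ld : length d ≡ N
      ld = trans (length-map (proj₁ ∘ proj₂) cs) lcs
      ls : length s ≡ N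
      ls = trans (length-map (proj₂ ∘ proj₂) cs) lcs

      t≡zeros : isZero t ≡ true → t ≡ zeros N
      t≡zeros z = trans (proj₂ (val-zero t z)) (cong zeros lt)

    prevTime : isZero t ≡ false → Σ ℕ λ j → val t ≡ suc j × val (app decK t) ≡ j × app decK t ≡ bitsOf N j
    prevTime z = val (app decK t) , val-dec t z , refl ,
      sym (bitsOf-val N (app decK t) (trans (length-transduce decK true t) lt))

    module WithOracle (C : Lang) where
      ask : Atom → Bool
      ask a = tupleOracle (Bs ++ C ∷ []) (question a cs)

      ask-claim : ∀ kt kd ks tag → ask (true , kt , kd , ks , tag) ≡ C (body (app kt t) (app kd d) (app ks s) tag)
      ask-claim kt kd ks tag = claim-value Bs C cs kt kd ks tag (trans len (sym lcs))

      ask-choice : ∀ σ e → σ < N → s ≡ unary N σ → ask (choiceA e) ≡ choiceBit Bs N σ (app decK t) e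
      ask-choice σ e σ< e≡ = trans (choice-value Bs C cs σ e (trans len (sym lcs)) (ℕ.≤-trans σ< (ℕ.≤-reflexive (sym lcs)))
        (trans e≡ (cong (λ n → unary n σ) (sym lcs)))) (cong (λ n → choiceBit Bs n σ (app decK t) e) lcs)

    open WithOracle truth

    private
      ask-fact : ∀ kt kd ks tag → ask (true , kt , kd , ks , tag) ≡ fact (app kt t) (app kd d) (app ks s) tag
      ask-fact kt kd ks tag = trans (ask-claim kt kd ks tag)
        (trans (cong (λ n → fromFacts n fact (body (app kt t) (app kd d) (app ks s) tag)) (sym (trans (length-transduce kt true t) lt)))
          (fromFacts-body fact (app kt t) (app kd d) (app ks s) tag
            (trans (length-transduce kd true d) (trans ld (sym (trans (length-transduce kt true t) lt))))
            (trans (length-transduce ks true s) (trans ls (sym (trans (length-transduce kt true t) lt))))))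

      one : ∀ {c} → ask c ≡ true → Σ Atom λ c′ → c′ ∈ c ∷ [] × ask c′ ≡ true
      one e = _ , here refl , e

      load-intro : ∀ {a} → loaded t d ≡ a → ask (loadA idK idK a) ≡ true
      load-intro {a} e = trans (ask-fact idK idK zeroK (load a)) (trans (cong₂ (λ t d → eqF (fin-Fin _) (loaded t d) a) (app-id t) (app-id d))
        (trans (cong (λ z → eqF (fin-Fin _) z a) e) (eqF-refl (fin-Fin _) a)))

      load-elim : ∀ kt kd {a} → ask (loadA kt kd a) ≡ true → loaded (app kt t) (app kd d) ≡ a
      load-elim kt kd {a} e = eqF-sound (fin-Fin _) _ a (trans (sym (ask-fact kt kd zeroK (load a))) e)

      depth-intro : ∀ {v} → cell (rowAt (val t)) d ≡ v → ask (depthA idK idK v) ≡ true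
      depth-intro {v} e = trans (ask-fact idK idK zeroK (depth v)) (trans (cong₂ (λ t d → eqF fin-V (cell (rowAt (val t)) d) v) (app-id t) (app-id d))
        (trans (cong (λ z → eqF fin-V z v) e) (eqF-refl fin-V v)))

      depth-elim : ∀ kt kd {v} → ask (depthA kt kd v) ≡ true → cell (rowAt (val (app kt t))) (app kd d) ≡ v
      depth-elim kt kd {v} e = eqF-sound fin-V _ v (trans (sym (ask-fact kt kd zeroK (depth v))) e)

      row-intro : ∀ ks {ρ} → rho (rowAt (val t)) ≡ ρ → app ks s ≡ unary N (stage (rowAt (val t))) → ask (rowA idK ks ρ) ≡ true
      row-intro ks {ρ} e u = trans (ask-fact idK zeroK ks (row ρ))
        (trans (cong (λ t → eqF fin-Rho (rho (rowAt (val t))) ρ ∧ strEq (app ks s) (unary N (stage (rowAt (val t))))) (app-id t))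
          (cong₂ _∧_ (trans (cong (λ z → eqF fin-Rho z ρ) e) (eqF-refl fin-Rho ρ)) (trans (cong (λ z → strEq z (unary N (stage (rowAt (val t))))) u) (strEq-refl (unary N (stage (rowAt (val t))))))))

      row-elim : ∀ kt {ρ} → ask (rowA kt idK ρ) ≡ true → rho (rowAt (val (app kt t))) ≡ ρ × s ≡ unary N (stage (rowAt (val (app kt t))))
      row-elim kt {ρ} e with ∧-true (trans (sym (ask-fact kt zeroK idK (row ρ))) e)
      ... | p , q = eqF-sound fin-Rho _ ρ p , trans (sym (app-id s)) (strEq-sound (app idK s) _ q)

      zeros≡ : app zeroK d ≡ zeros N
      zeros≡ = trans (app-zero d) (cong zeros ld)

    module _ (staged : Staged) (safe : ∀ j → j < 2 ^ N → rejecting (rho (rowAt j)) ≡ false) where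
      private
        record Acted (ρ : Rho) (v₀ : V) (act : Act) : Set where
          field
            j      : ℕ
            now≡   : val t ≡ suc j
            prev≡  : val (app decK t) ≡ j
            rho≡   : rho (rowAt j) ≡ ρ
            head≡  : cell (rowAt j) (zeros N) ≡ v₀
            act≡   : actAt j ≡ act
            stage≡ : s ≡ unary N (stage (rowAt j))

        acted : ∀ {ρ v₀ act ls} → isZero t ≡ false → required act ρ ≡ just ls →
                (∀ a b → (a , b) ∈ premises ρ v₀ ls → ask a ≡ b) → Acted ρ v₀ act
        acted {ρ} {v₀} {act} {ls} z req h with prevTime z
        ... | j , nw , prev , bits with row-elim decK (h _ _ (here refl))
        ...   | p , q = record
          { j = j ; now≡ = nw ; prev≡ = prev
          ; rho≡ = trans (cong (λ k → rho (rowAt k)) (sym prev)) p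
          ; head≡ = trans (cong₂ (λ k d → cell (rowAt k) d) (sym prev) (sym zeros≡)) (depth-elim decK zeroK (h _ _ (there (here refl))))
          ; act≡ = trans (cong (actOf (αAt (stage (rowAt j)) j)) (trans (cong (λ k → rho (rowAt k)) (sym prev)) p))
                     (required-sound (αAt (stage (rowAt j)) j) act ρ req
                       (λ e b i → trans (sym (trans (ask-choice (stage (rowAt j)) e (staged j) st) (cong (λ u → choiceBit Bs N (stage (rowAt j)) u e) bits)))
                                        (h (choiceA e) b (there (there (∈-map⁺ (λ (e , b) → choiceA e , b) i))))))
          ; stage≡ = st }
          where
          st : s ≡ unary N (stage (rowAt j))
          st = trans q (cong (λ k → unary N (stage (rowAt k))) prev)

        unsafe : ∀ ρ → rejecting ρ ≡ true → ask (rowA idK idK ρ) ≡ true → ⊥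
        unsafe ρ rej e with () ← trans (sym rej) (trans (cong rejecting (sym (proj₁ (row-elim idK e))))
          (safe _ (ℕ.≤-trans (val< (app idK t)) (ℕ.≤-reflexive (cong (2 ^_) (trans (length-transduce idK true t) lt))))))

        clauses-hold : ∀ md zt zd → isZero t ≡ zt → isZero d ≡ zd → ∀ i ps c → clause (md , zt , zd , payAt t) i ≡ just (ps , c) →
                       (∀ a b → (a , b) ∈ ps → ask a ≡ b) → Σ Atom λ a → a ∈ c × ask a ≡ true
        clauses-hold true true _ zt zd uInit _ _ refl h = one (load-intro (loaded-zero t d zt))
        clauses-hold true false true zt zd uPush _ _ refl h = one (load-intro (loaded-push t d zt zd))
        clauses-hold true false false zt zd (uShift a) _ _ refl h =
          one (load-intro (trans (loaded-shift t d zt zd) (load-elim upredK decK (h _ _ (here refl)))))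
        clauses-hold false true _ zt zd (bRow a) _ _ refl h = one (row-intro zeroK
          (trans (cong (λ k → rho (rowAt k)) (proj₁ (val-zero t zt))) (cong (λ a → startᴹ , ∃Q , a , zero)
            (trans (cong₂ loaded (cong (app decK) (sym (t≡zeros zt))) (sym zeros≡)) (load-elim decK zeroK (h _ _ (here refl))))))
          (trans (app-zero s) (trans (cong zeros ls) (trans (sym (unary-zero N)) (cong (λ k → unary N (stage (rowAt k))) (sym (proj₁ (val-zero t zt))))))))
        clauses-hold false true _ zt zd (bCell a) _ _ refl h = one (depth-intro
          (trans (cong (λ k → cell (rowAt k) d) (proj₁ (val-zero t zt))) (cong (λ a → (nothing , a) , (nothing , zero))
            (trans (cong (λ u → loaded u (app incK d)) (cong (app decK) (sym (t≡zeros zt)))) (load-elim decK incK (h _ _ (here refl)))))))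
        clauses-hold false false _ zt zd (rowI ρ v₀ act) ps c e h with required act ρ in req
        clauses-hold false false _ zt zd (rowI ρ v₀ act) _ _ refl h | just ls′ = one (row-intro (stageTr act)
          (trans (cong (λ k → rho (rowAt k)) now≡) (trans (cong₂ (λ a v → rowUpd a (rho (rowAt j)) v) act≡ head≡) (cong (λ r → rowUpd act r v₀) rho≡)))
          (trans (trans (cong (app (stageTr act)) stage≡) (stageTr-unary act (staged j))) (cong (unary N) (trans (cong (λ a → bump a (stage (rowAt j))) (sym act≡)) (cong (λ k → stage (rowAt k)) (sym now≡))))))
          where open Acted (acted {ρ} {v₀} {act} zt req h)
        clauses-hold false false z zt zd (cellI ρ v₀ act p c n) _ _ e h with required act ρ in req
        clauses-hold false false z zt zd (cellI ρ v₀ act p c n) _ _ refl h | just ls′ = one (depth-intro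
          (trans (cong (λ k → cell (rowAt k) d) now≡)
            (trans (cong₂ (λ a v → cellUpd a v (isZero d) (cell (rowAt j) (app decK d)) (cell (rowAt j) d) (cell (rowAt j) (app incK d))) act≡ head≡)
            (trans (cong (λ z → cellUpd act v₀ z _ _ _) zd)
              (cong₃ (cellUpd act v₀ z) (at decK (h _ _ (here refl))) (trans (cong (cell (rowAt j)) (sym (app-id d))) (at idK (h _ _ (there (here refl)))))
                (at incK (h _ _ (there (there (here refl))))))))))
          where
          open Acted (acted {ρ} {v₀} {act} zt req (λ a b i → h a b (there (there (there i)))))
          at : ∀ k {v} → ask (depthA decK k v) ≡ true → cell (rowAt j) (app k d) ≡ v
          at k e = trans (cong (λ i → cell (rowAt i) (app k d)) (sym prev≡)) (depth-elim decK k e)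
          cong₃ : ∀ {A B : Set} (f : A → A → A → B) {a a′ b b′ c c′} → a ≡ a′ → b ≡ b′ → c ≡ c′ → f a b c ≡ f a′ b′ c′
          cong₃ f refl refl refl = refl
        clauses-hold false true _ zt zd (rejI ρ) ps c e h with rejecting ρ in rej
        clauses-hold false true _ zt zd (rejI ρ) _ _ refl h | true = ⊥-elim (unsafe ρ rej (h _ _ (here refl)))
        clauses-hold false false _ zt zd (rejI ρ) ps c e h with rejecting ρ in rej
        clauses-hold false false _ zt zd (rejI ρ) _ _ refl h | true = ⊥-elim (unsafe ρ rej (h _ _ (here refl)))

      closed-at : ∀ md i cl → clause (flagsOf md x cs) i ≡ just cl →
                  Σ Lit λ ℓ → ℓ ∈ literals cl × Holds (tupleOracle (Bs ++ truth ∷ [])) cs ℓ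
      closed-at md i (ps , c) e = literals-complete ask ps c
        (clauses-hold md _ _ refl refl i ps c (trans (cong (λ f → clause f i) (sym (flagsOf≡ md x cs))) e))

  -- The run obeys each definite clause because one and the same step function defines both. Safety
  -- is what the clauses without conclusion demand.
  truth-closed : Staged → (∀ j → j < 2 ^ N → rejecting (rho (rowAt j)) ≡ false) → Closed N x (tupleOracle (Bs ++ truth ∷ []))
  truth-closed staged safe md cs lcs i cl e = closed-at cs lcs staged safe md i cl e

  module Forced (staged : Staged) (C : Lang) (closed : Closed N x (tupleOracle (Bs ++ C ∷ []))) where

    private
      module At (t d s : Str) (lt : length t ≡ N) (ld : length d ≡ N) (ls : length s ≡ N) where
        cs : List Bits
        cs = times3 t d s

        proj : t₁ cs ≡ t × t₂ cs ≡ d × t₃ cs ≡ s × length cs ≡ length t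
        proj = times3-proj t d s (trans ld (sym lt)) (trans ls (sym lt))

        lcs : length cs ≡ N
        lcs = trans (proj₂ (proj₂ (proj₂ proj))) lt

        open WithOracle cs lcs C public

        claim : ∀ kt kd ks tag → ask (true , kt , kd , ks , tag) ≡ C (body (app kt t) (app kd d) (app ks s) tag)
        claim kt kd ks tag with proj
        ... | p , q , r , _ = trans (ask-claim kt kd ks tag)
          (trans (cong (λ z → C (body (app kt z) (app kd (t₂ cs)) (app ks (t₃ cs)) tag)) p)
            (cong₂ (λ y z → C (body (app kt t) (app kd y) (app ks z) tag)) q r))

        choice≡ : ∀ σ e → σ < N → s ≡ unary N σ → ask (choiceA e) ≡ choiceBit Bs N σ (app decK t) e
        choice≡ σ e lt eq = trans (ask-choice σ e lt (trans (proj₁ (proj₂ (proj₂ proj))) eq)) (cong (λ z → choiceBit Bs N σ (app decK z) e) (proj₁ proj))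

        derive : ∀ md i {zt zd ps c} → isZero t ≡ zt → isZero d ≡ zd → clause (md , zt , zd , payAt t) i ≡ just (ps , c) →
                 (∀ a b → (a , b) ∈ ps → ask a ≡ b) → Σ Atom λ a → a ∈ c × ask a ≡ true
        derive md i {zt} {zd} {ps} {c} ez ed e h = literals-sound ask ps c (closed md cs lcs i (ps , c) (trans (cong (λ f → clause f i) fl) e)) h
          where
          fl : flagsOf md x cs ≡ (md , zt , zd , payAt t)
          fl = trans (flagsOf≡ md x cs) (cong₂ (λ a r → md , a , r) (trans (cong isZero (proj₁ proj)) ez)
            (cong₂ _,_ (trans (cong isZero (proj₁ (proj₂ proj))) ed) (cong payAt (proj₁ proj))))

        fact₁ : ∀ kt kd ks tag → (Σ Atom λ a → a ∈ (true , kt , kd , ks , tag) ∷ [] × ask a ≡ true) → C (body (app kt t) (app kd d) (app ks s) tag) ≡ true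
        fact₁ kt kd ks tag (_ , here refl , e) = trans (sym (claim kt kd ks tag)) e

      lz : length (zeros N) ≡ N
      lz = length-replicate N

      zero-str : ∀ {u} → length u ≡ N → app zeroK u ≡ zeros N
      zero-str {u} e = trans (app-zero u) (cong zeros e)

      lapp : ∀ k u → length u ≡ N → length (app k u) ≡ N
      lapp k u e = trans (length-transduce k true u) e

      body≡ : ∀ {t t′ d d′ s s′ tag tag′} → t ≡ t′ → d ≡ d′ → s ≡ s′ → tag ≡ tag′ → C (body t d s tag) ≡ true → C (body t′ d′ s′ tag′) ≡ true
      body≡ refl refl refl refl e = e

    -- Induction on the number of 1s in the loading time, which `upredK` lowers by one.
    loadClaim : ∀ k t d → trues t ≡ k → length t ≡ N → length d ≡ N → C (body t d (zeros N) (load (loaded t d))) ≡ true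
    loadClaim k t d tk lt ld = go k tk (isZero t) (isZero d) refl refl
      where
      open At t d (zeros N) lt ld lz
      out : ∀ {a} → loaded t d ≡ a → (Σ Atom λ c → c ∈ loadA idK idK a ∷ [] × _ ≡ true) → C (body t d (zeros N) (load (loaded t d))) ≡ true
      out {a} e c = body≡ (app-id t) (app-id d) (zero-str lz) (cong load (sym e)) (fact₁ idK idK zeroK (load a) c)
      go : ∀ k → trues t ≡ k → ∀ zt zd → isZero t ≡ zt → isZero d ≡ zd → C (body t d (zeros N) (load (loaded t d))) ≡ true
      go k tk true zd ez ed = out (loaded-zero t d ez) (derive true uInit ez ed refl (λ _ _ ()))
      go k tk false true ez ed = out (loaded-push t d ez ed) (derive true uPush ez ed refl (λ _ _ ()))
      go zero tk false false ez ed with () ← trans (sym tk) (proj₂ (nonZero-trues t ez))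
      go (suc k) tk false false ez ed = out (loaded-shift t d ez ed) (derive true (uShift (loaded (app upredK t) (app decK d))) ez ed refl
        λ { _ _ (here refl) → trans (claim upredK decK zeroK _) (body≡ refl refl (sym (zero-str lz)) refl
              (loadClaim k (app upredK t) (app decK d) (upred-trues t k tk) (lapp upredK t lt) (lapp decK d ld))) })

    DepthClaim RowClaim : ℕ → Set
    DepthClaim j = ∀ d → length d ≡ N → C (body (bitsOf N j) d (zeros N) (depth (cell (rowAt j) d))) ≡ true
    RowClaim j   = C (body (bitsOf N j) (zeros N) (unary N (stage (rowAt j))) (row (rho (rowAt j)))) ≡ true

    private
      z₀ : isZero (zeros N) ≡ true
      z₀ = isZero-zeros N

      loadedFull : ∀ d → length d ≡ N → C (body full1 d (zeros N) (load (loaded full1 d))) ≡ true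
      loadedFull d ld = loadClaim _ full1 d refl (lapp decK (zeros N) lz) ld

      first-depth : DepthClaim 0
      first-depth d ld = body≡ (app-id (zeros N)) (app-id d) (zero-str lz) refl (fact₁ idK idK zeroK _
        (derive false (bCell (loaded full1 (app incK d))) z₀ refl refl
          λ { _ _ (here refl) → trans (claim decK incK zeroK _) (body≡ refl refl (sym (zero-str lz)) refl (loadedFull (app incK d) (lapp incK d ld))) }))
        where open At (zeros N) d (zeros N) lz ld lz

      first-row : RowClaim 0
      first-row = body≡ (app-id (zeros N)) (zero-str lz) (trans (zero-str lz) (sym (unary-zero N))) refl (fact₁ idK zeroK zeroK _
        (derive false (bRow (loaded full1 (zeros N))) z₀ refl refl
          λ { _ _ (here refl) → trans (claim decK zeroK zeroK _) (body≡ refl (sym (zero-str lz)) (sym (zero-str lz)) refl (loadedFull (zeros N) lz)) }))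
        where open At (zeros N) (zeros N) (zeros N) lz lz lz

      module Next (j : ℕ) (lt : suc j < 2 ^ N) (dc : DepthClaim j) (rc : RowClaim j) (d : Str) (ld : length d ≡ N) where
        σ = stage (rowAt j)
        ρ = rho (rowAt j)
        F = cell (rowAt j)
        act = actAt j
        t = bitsOf N (suc j)

        open At t d (unary N σ) (length-bitsOf N (suc j)) ld (length-unary N σ) public

        prev : app decK t ≡ bitsOf N j
        prev = dec-inc (bitsOf N j)

        nz : isZero t ≡ false
        nz = isZero-bitsOf N j lt

        req : Σ (List (Tn × Bool)) λ ls → required act ρ ≡ just ls × Satisfied (αAt σ j) ls
        req = required-complete (αAt σ j) ρ

        depth-premise : ∀ k {u} → app k d ≡ u → length u ≡ N →
                        C (body (app decK t) (app k d) (app zeroK (unary N σ)) (depth (F u))) ≡ true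
        depth-premise k {u} e lu = body≡ (sym prev) (sym e) (sym (zero-str (length-unary N σ))) refl (dc u lu)

        row-premise : ask (rowA decK idK ρ) ≡ true
        row-premise = trans (claim decK zeroK idK (row ρ)) (body≡ (sym prev) (sym (zero-str ld)) (sym (app-id (unary N σ))) refl rc)

        base-premises : ∀ a b → (a , b) ∈ premises ρ (F (zeros N)) (proj₁ req) → ask a ≡ b
        base-premises _ _ (here refl)         = row-premise
        base-premises _ _ (there (here refl)) = trans (claim decK zeroK zeroK _) (depth-premise zeroK (zero-str ld) lz)
        base-premises _ _ (there (there i)) with ∈-map⁻ (λ (e , b) → choiceA e , b) i
        ... | (e , b) , i′ , refl = trans (choice≡ σ e (staged j) refl)
          (trans (cong (λ u → choiceBit Bs N σ u e) prev) (proj₂ (proj₂ req) e b i′))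

        depth′ : C (body t d (zeros N) (depth (cell (rowAt (suc j)) d))) ≡ true
        depth′ = body≡ (app-id t) (app-id d) (zero-str (length-unary N σ)) refl (fact₁ idK idK zeroK _
          (derive false (cellI ρ (F (zeros N)) act (F (app decK d)) (F d) (F (app incK d))) nz refl
            (cong (λ m → withReq m λ ls → (depthA decK decK (F (app decK d)) , true) ∷ (depthA decK idK (F d) , true) ∷ (depthA decK incK (F (app incK d)) , true) ∷ premises ρ (F (zeros N)) ls ,
                         depthA idK idK (cellUpd act (F (zeros N)) (isZero d) (F (app decK d)) (F d) (F (app incK d))) ∷ []) (proj₁ (proj₂ req)))
            λ { _ _ (here refl) → trans (claim decK decK zeroK _) (depth-premise decK refl (lapp decK d ld))
              ; _ _ (there (here refl)) → trans (claim decK idK zeroK _) (depth-premise idK (app-id d) ld)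
              ; _ _ (there (there (here refl))) → trans (claim decK incK zeroK _) (depth-premise incK refl (lapp incK d ld))
              ; a b (there (there (there i))) → base-premises a b i }))

        row′ : C (body t (zeros N) (unary N (bump act σ)) (row (rho (rowAt (suc j))))) ≡ true
        row′ = body≡ (app-id t) (zero-str ld) (stageTr-unary act (staged j)) refl (fact₁ idK zeroK (stageTr act) _
          (derive false (rowI ρ (F (zeros N)) act) nz refl
            (cong (λ m → withReq m λ ls → premises ρ (F (zeros N)) ls , rowA idK (stageTr act) (rowUpd act ρ (F (zeros N))) ∷ []) (proj₁ (proj₂ req)))
            base-premises))

    -- An oracle that satisfies the clauses may claim too much but never too little: each true fact
    -- is forced by those of the time before. A rejecting row would therefore be claimed as well,
    -- against its clause.
    claims : ∀ j → j < 2 ^ N → DepthClaim j × RowClaim j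
    claims zero    lt = first-depth , first-row
    claims (suc j) lt with claims j (ℕ.<-trans (ℕ.n<1+n j) lt)
    ... | dc , rc = (λ d ld → Next.depth′ j lt dc rc d ld) , Next.row′ j lt dc rc (zeros N) lz

    safe : ∀ j → j < 2 ^ N → rejecting (rho (rowAt j)) ≡ false
    safe j lt with rejecting (rho (rowAt j)) in rej
    ... | false = refl
    ... | true with contradictory
      where
      open At (bitsOf N j) (zeros N) (unary N (stage (rowAt j))) (length-bitsOf N j) lz (length-unary N (stage (rowAt j)))
      premise : ask (rowA idK idK (rho (rowAt j))) ≡ true
      premise = trans (claim idK zeroK idK _) (body≡ (sym (app-id _)) (sym (zero-str lz)) (sym (app-id _)) refl (proj₂ (claims j lt)))
      eq : ∀ z → clause (false , z , isZero (zeros N) , payAt (bitsOf N j)) (rejI (rho (rowAt j))) ≡ just ((rowA idK idK (rho (rowAt j)) , true) ∷ [] , [])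
      eq true  rewrite rej = refl
      eq false rewrite rej = refl
      contradictory : Σ Atom λ a → a ∈ [] × ask a ≡ true
      contradictory = derive false (rejI (rho (rowAt j))) refl refl (eq (isZero (bitsOf N j))) λ { _ _ (here refl) → premise }
    ...   | _ , () , _

-- The least model follows the machine

module Agreement (M : AOTM) where
  open AOTM M using (δ; kind) renaming (start to startᴹ; qno to qnoᴹ)
  open Clauses M
  open Questions M
  open Actions M
  private
    module Z = Machine (asMachine M)

  rdS : List Sy → ℕ → Sy
  rdS = rdOr zero

  stackAt : Tape Sy → ℕ → Maybe Sy × Sy
  stackAt (l ◂ r) k = nth l k , rdS r (suc k)

  cellZ : Z.ZConf → ℕ → V
  cellZ (zc q w o) k = stackAt w k , stackAt o k

  rhoZ : Quant → Z.ZConf → Rho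
  rhoZ pl (zc q w o) = q , pl , Z.read w , Z.read o

  perform : Act → Z.ZConf → Z.ZConf
  perform call z       = Z.zreply emptyOracle z
  perform (take _ e) z = Z.zstep z e
  perform _ z          = z

  passTo : Act → Quant → Quant
  passTo swap pl = dual pl
  passTo _    pl = pl

  private
    head-put : ∀ m a l r → headAfter m a (nth l 0) (rdS r 1) ≡ Z.read (put a m (l ◂ r))
    head-put L a []      r = refl
    head-put L a (b ∷ l) r = refl
    head-put S a l       r = refl
    head-put R a l       r = sym (rd-tl zero r 0)

    stack-0 : ∀ m a l r p → tapeUpd m a (nth l 0) true p (stackAt (l ◂ r) 0) (stackAt (l ◂ r) 1) ≡ stackAt (put a m (l ◂ r)) 0
    stack-0 L a []      r p = cong (nothing ,_) (sym (rd-tl zero r 0))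
    stack-0 L a (b ∷ l) r p = refl
    stack-0 S a l       r p = cong (nth l 0 ,_) (sym (rd-tl zero r 0))
    stack-0 R a l       r p = cong (just a ,_) (sym (rd-tl zero r 1))

    stack-suc : ∀ m a l r k → tapeUpd m a (nth l 0) false (stackAt (l ◂ r) k) (stackAt (l ◂ r) (suc k)) (stackAt (l ◂ r) (suc (suc k))) ≡
                              stackAt (put a m (l ◂ r)) (suc k)
    stack-suc L a []      r k = cong (nothing ,_) (sym (rd-tl zero r (suc k)))
    stack-suc L a (b ∷ l) r k = cong (nth l (suc k) ,_) (sym (rd-tl zero r k))
    stack-suc S a l       r k = cong (nth l (suc k) ,_) (sym (rd-tl zero r (suc k)))
    stack-suc R a l       r k = cong (nth l k ,_) (sym (rd-tl zero r (suc (suc k))))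

  rho-perform : ∀ act pl z → rowUpd act (rhoZ pl z) (cellZ z 0) ≡ rhoZ (passTo act pl) (perform act z)
  rho-perform stay pl z = refl
  rho-perform swap pl z = refl
  rho-perform call pl z = refl
  rho-perform (take _ (q , a , m , b , m′)) pl (zc _ (l ◂ r) (l′ ◂ r′)) =
    cong₂ (λ u v → q , pl , u , v) (head-put m a l r) (head-put m′ b l′ r′)

  cell-0 : ∀ act z p → cellUpd act (cellZ z 0) true p (cellZ z 0) (cellZ z 1) ≡ cellZ (perform act z) 0
  cell-0 stay z p = refl
  cell-0 swap z p = refl
  cell-0 call z p = refl
  cell-0 (take _ (q , a , m , b , m′)) (zc _ (l ◂ r) (l′ ◂ r′)) p = cong₂ _,_ (stack-0 m a l r _) (stack-0 m′ b l′ r′ _)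

  cell-suc : ∀ act z k → cellUpd act (cellZ z 0) false (cellZ z k) (cellZ z (suc k)) (cellZ z (suc (suc k))) ≡ cellZ (perform act z) (suc k)
  cell-suc stay z k = refl
  cell-suc swap z k = refl
  cell-suc call z k = refl
  cell-suc (take _ (q , a , m , b , m′)) (zc _ (l ◂ r) (l′ ◂ r′)) k = cong₂ _,_ (stack-suc m a l r k) (stack-suc m′ b l′ r′ k)

  choices : ℕ → Lang → ℕ → ℕ → Tn → Bool
  choices N B σ j e = B (choiceString N σ (bitsOf N j) e)

  -- The play, from time j on, in which the current stage has number σ and player pl and the
  -- listed oracles govern this stage and the following ones.
  data Play (N : ℕ) : ℕ → ℕ → ℕ → List Lang → Quant → Z.ZConf → Bool → Set where
    halted  : ∀ {b σ j B Bs pl z} → actOf (choices N B σ j) (rhoZ pl z) ≡ stay → Play N b σ j (B ∷ Bs) pl z (not (rejecting (rhoZ pl z)))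
    swapped : ∀ {b σ j B Bs pl z v} → actOf (choices N B σ j) (rhoZ pl z) ≡ swap → Play N b (suc σ) (suc j) Bs (dual pl) z v →
              Play N (suc b) σ j (B ∷ Bs) pl z v
    moved   : ∀ {b σ j B Bs pl z v act} → actOf (choices N B σ j) (rhoZ pl z) ≡ act → act ≢ swap → act ≢ stay →
              Play N b σ (suc j) (B ∷ Bs) pl (perform act z) v → Play N (suc b) σ j (B ∷ Bs) pl z v

  private
    rejecting-stay : ∀ α ρ → rejecting ρ ≡ true → actOf α ρ ≡ stay
    rejecting-stay α ρ@(q , pl , a , b) e = go (kind q) e
      where
      branch : ∀ Q v es → rejBranch Q v es ≡ true → actBranch α v es ≡ stay
      branch ∃Q true [] e = refl
      go : ∀ k → rejKind k ρ ≡ true → actKind α k ρ ≡ stay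
      go (quant Q) e = branch Q (sameQ Q pl) (δ q a b) e
      go reject    e = refl

    pick≢stay : ∀ α e es → pick α e es ≢ stay
    pick≢stay α e [] ()
    pick≢stay α e (e′ ∷ es) p with α e
    ... | false = pick≢stay α e′ es p

    stay-any : ∀ α β ρ → actOf α ρ ≡ stay → actOf β ρ ≡ stay
    stay-any α β ρ@(q , pl , a , b) e = go (kind q) e
      where
      branch : ∀ v es → actBranch α v es ≡ stay → actBranch β v es ≡ stay
      branch true []       p = refl
      branch true (e ∷ es) p = ⊥-elim (pick≢stay α e es p)
      go : ∀ k → actKind α k ρ ≡ stay → actKind β k ρ ≡ stay
      go (quant Q) e = branch (sameQ Q pl) (δ q a b) e
      go accept e = refl
      go reject e = refl

  not-rejecting : ∀ α ρ → actOf α ρ ≢ stay → rejecting ρ ≡ false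
  not-rejecting α ρ ne with rejecting ρ in e
  ... | false = refl
  ... | true  = ⊥-elim (ne (rejecting-stay α ρ e))

  module _ (x : Str) (N : ℕ) (Bs : List Lang) (len : length Bs ≡ N) where
    open Tableau M x N Bs len
    open SR

    -- At time `j` only depths k with k + j + 1 < 2^N are trusted: every step may bring the error of
    -- the wrap-around one depth closer. The cells at the heads belong to `rho` and are always
    -- right.
    record Agree (j σ : ℕ) (pl : Quant) (z : Z.ZConf) : Set where
      constructor agree
      field
        rho≡   : rho (rowAt j) ≡ rhoZ pl z
        stage≡ : stage (rowAt j) ≡ σ
        cells≡ : ∀ k → k + suc j < 2 ^ N → cell (rowAt j) (bitsOf N k) ≡ cellZ z k

    -- Depth k after the step looks at depth k + 1 before it, which accounts for the one depth lost.
    agree-step : ∀ {j σ pl z act} → Agree j σ pl z → suc (suc j) < 2 ^ N → actAt j ≡ act →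
                 Agree (suc j) (bump act σ) (passTo act pl) (perform act z)
    agree-step {j} {σ} {pl} {z} {act} (agree rh st ce) lt refl = agree
      (trans (cong₂ (rowUpd act) rh v₀) (rho-perform act pl z)) (cong (bump act) st) cell′
      where
      F = cell (rowAt j)
      v₀ : F (zeros N) ≡ cellZ z 0
      v₀ = ce 0 (ℕ.<-trans (ℕ.n<1+n (suc j)) lt)
      cell′ : ∀ k → k + suc (suc j) < 2 ^ N → cell (rowAt (suc j)) (bitsOf N k) ≡ cellZ (perform act z) k
      cell′ zero l = trans (cong (λ u → cellUpd act (F (zeros N)) u (F (app decK (zeros N))) (F (zeros N)) (F (app incK (zeros N)))) (isZero-zeros N))
        (trans (cong₂ (λ u v → cellUpd act u true (F (app decK (zeros N))) u v) v₀ (ce 1 lt)) (cell-0 act z _))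
      cell′ (suc k) l = trans (cong₂ (λ u v → cellUpd act (F (zeros N)) u v (F (bitsOf N (suc k))) (F (bitsOf N (suc (suc k)))))
          (isZero-bitsOf N k (ℕ.≤-trans (s≤s (ℕ.m≤m+n (suc k) (suc (suc j)))) l)) (trans (cong F (dec-inc (bitsOf N k))) (ce k l₀)))
        (trans (cong (λ u → cellUpd act u false (cellZ z k) (F (bitsOf N (suc k))) (F (bitsOf N (suc (suc k))))) v₀)
        (trans (cong₂ (cellUpd act (cellZ z 0) false (cellZ z k)) (ce (suc k) l₁) (ce (suc (suc k)) l₂)) (cell-suc act z k)))
        where
        l₂ : suc (suc k) + suc j < 2 ^ N
        l₂ = ℕ.≤-trans (ℕ.≤-reflexive (cong (λ u → suc (suc u)) (sym (ℕ.+-suc k (suc j))))) l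
        l₁ : suc k + suc j < 2 ^ N
        l₁ = ℕ.<-trans (ℕ.n<1+n _) l₂
        l₀ : k + suc j < 2 ^ N
        l₀ = ℕ.<-trans (ℕ.n<1+n _) l₁

    dropL : ℕ → List Lang → List Lang
    dropL zero    Cs = Cs
    dropL (suc n) Cs = dropL n (tl Cs)

    private
      drop-[] : ∀ σ → dropL σ [] ≡ []
      drop-[] zero    = refl
      drop-[] (suc σ) = drop-[] σ

      lookup-drop : ∀ σ Cs {B Ds} → dropL σ Cs ≡ B ∷ Ds → lookupL Cs σ ≡ B
      lookup-drop zero    (C ∷ Cs) refl = refl
      lookup-drop (suc σ) []       e with () ← trans (sym (drop-[] σ)) e
      lookup-drop (suc σ) (C ∷ Cs) e = lookup-drop σ Cs e

      drop-< : ∀ σ Cs {B Ds} → dropL σ Cs ≡ B ∷ Ds → σ < length Cs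
      drop-< zero    (C ∷ Cs) e = s≤s z≤n
      drop-< (suc σ) []       e with () ← trans (sym (drop-[] σ)) e
      drop-< (suc σ) (C ∷ Cs) e = s≤s (drop-< σ Cs e)

      drop-suc : ∀ σ Cs {B Ds} → dropL σ Cs ≡ B ∷ Ds → dropL (suc σ) Cs ≡ Ds
      drop-suc zero    (C ∷ Cs) refl = refl
      drop-suc (suc σ) Cs       e    = drop-suc σ (tl Cs) e

    -- A halted row is repeated forever. So acceptance means that no later row rejects, and
    -- rejection shows at a time that strings of length `N` can name.
    Verdict : Bool → ℕ → Set
    Verdict true  j = ∀ i → rejecting (rho (rowAt (j + i))) ≡ false
    Verdict false j = Σ ℕ λ i → i < 2 ^ N × rejecting (rho (rowAt i)) ≡ true

    private
      stays : ∀ j → actAt j ≡ stay → ∀ i → rho (rowAt (j + i)) ≡ rho (rowAt j) × stage (rowAt (j + i)) ≡ stage (rowAt j)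
      stays j e zero rewrite ℕ.+-identityʳ j = refl , refl
      stays j e (suc i) rewrite ℕ.+-suc j i with stays j e i
      ... | p , q = trans (cong (λ a → rowUpd a (rho (rowAt (j + i))) (cell (rowAt (j + i)) (zeros N))) st) p ,
                    trans (cong (λ a → bump a (stage (rowAt (j + i)))) st) q
        where
        st : actAt (j + i) ≡ stay
        st = trans (cong (actOf (αAt (stage (rowAt (j + i))) (j + i))) p) (stay-any _ _ (rho (rowAt j)) e)

      verdict-step : ∀ v j → rejecting (rho (rowAt j)) ≡ false → Verdict v (suc j) → Verdict v j
      verdict-step true j e h zero rewrite ℕ.+-identityʳ j = e
      verdict-step true j e h (suc i) rewrite ℕ.+-suc j i = h i
      verdict-step false j e h = h

      same-act : ∀ {σ j B Cs pl z} → Agree j σ pl z → dropL σ Bs ≡ B ∷ Cs → actAt j ≡ actOf (choices N B σ j) (rhoZ pl z)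
      same-act {σ} {j} (agree rh refl ce) dr =
        trans (cong (λ L → actOf (λ e → L (choiceString N σ (bitsOf N j) e)) (rho (rowAt j))) (lookup-drop σ Bs dr)) (cong (actOf _) rh)

      stage-< : ∀ {σ j B Cs pl z} → Agree j σ pl z → dropL σ Bs ≡ B ∷ Cs → stage (rowAt j) < N
      stage-< (agree rh refl ce) dr = ℕ.≤-trans (drop-< _ Bs dr) (ℕ.≤-reflexive len)

      stage-step : ∀ j → stage (rowAt j) < N → (∀ i → stage (rowAt (suc j + i)) < N) → ∀ i → stage (rowAt (j + i)) < N
      stage-step j e h zero rewrite ℕ.+-identityʳ j = e
      stage-step j e h (suc i) rewrite ℕ.+-suc j i = h i

      room : ∀ {j b} → j + suc (suc b) < 2 ^ N → suc j + suc b < 2 ^ N × suc (suc j) < 2 ^ N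
      room {j} {b} lt = l , ℕ.≤-trans (s≤s (ℕ.≤-trans (ℕ.m≤m+n (suc (suc j)) b) (ℕ.≤-reflexive (cong suc (sym (ℕ.+-suc j b)))))) l
        where
        l : suc j + suc b < 2 ^ N
        l = ℕ.≤-trans (ℕ.≤-reflexive (cong suc (sym (ℕ.+-suc j (suc b))))) lt

    -- `j + suc b` bounds the time at which the play can end. Keeping it below 2^N leaves the tops
    -- of the stacks in the trusted range throughout the play.
    play-verdict : ∀ {b σ j Cs pl z v} → Play N b σ j Cs pl z v → Agree j σ pl z → dropL σ Bs ≡ Cs → j + suc b < 2 ^ N →
                   Verdict v j × (∀ i → stage (rowAt (j + i)) < N)
    play-verdict {b} {σ} {j} {v = v} (halted {B = B} {pl = pl} {z = z} st) ag dr lt = verdict _ refl ,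
      λ i → ℕ.≤-trans (ℕ.≤-reflexive (cong suc (proj₂ (stays j at i)))) (stage-< ag dr)
      where
      at : actAt j ≡ stay
      at = trans (same-act ag dr) st
      verdict : ∀ v → rejecting (rhoZ pl z) ≡ v → Verdict (not (rejecting (rhoZ pl z))) j
      verdict true  e = subst (λ v → Verdict (not v) j) (sym e)
        (j , ℕ.≤-trans (s≤s (ℕ.m≤m+n j (suc b))) lt , trans (cong rejecting (Agree.rho≡ ag)) e)
      verdict false e = subst (λ v → Verdict (not v) j) (sym e) λ i → trans (cong rejecting (trans (proj₁ (stays j at i)) (Agree.rho≡ ag))) e
    play-verdict {σ = σ} {j} {v = v} (swapped {B = B} {pl = pl} {z = z} sw p) ag dr lt
      with play-verdict p (agree-step ag (proj₂ (room lt)) (trans (same-act ag dr) sw)) (drop-suc σ Bs dr) (proj₁ (room lt))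
    ... | ver , stg = verdict-step v j (trans (cong rejecting (Agree.rho≡ ag)) (not-rejecting (choices N B σ j) _ (λ e → swap≢stay (trans (sym sw) e)))) ver ,
      stage-step j (stage-< ag dr) stg
      where
      swap≢stay : swap ≢ stay
      swap≢stay ()
    play-verdict {σ = σ} {j} {v = v} (moved {B = B} {pl = pl} {z = z} {act = act} e ns nst p) ag dr lt
      with play-verdict p (subst₂ (λ s q → Agree (suc j) s q (perform act z)) (bump≡ act ns) (pass≡ act ns)
             (agree-step ag (proj₂ (room lt)) (trans (same-act ag dr) e))) dr (proj₁ (room lt))
      where
      bump≡ : ∀ act → act ≢ swap → bump act σ ≡ σ
      bump≡ stay ns = refl
      bump≡ call ns = refl
      bump≡ swap ns = ⊥-elim (ns refl)
      bump≡ (take _ _) ns = refl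
      pass≡ : ∀ act → act ≢ swap → passTo act pl ≡ pl
      pass≡ stay ns = refl
      pass≡ call ns = refl
      pass≡ swap ns = ⊥-elim (ns refl)
      pass≡ (take _ _) ns = refl
    ... | ver , stg = verdict-step v j (trans (cong rejecting (Agree.rho≡ ag)) (not-rejecting (choices N B σ j) _ (λ e′ → nst (trans (sym e) e′)))) ver ,
      stage-step j (stage-< ag dr) stg

    private
      symAt : ℕ → Sy
      symAt k = paySym (nth x k)

      rd-sym : ∀ (x : Str) k → rdS (map encBit x) k ≡ paySym (nth x k)
      rd-sym []      k       = refl
      rd-sym (b ∷ x) zero    = refl
      rd-sym (b ∷ x) (suc k) = rd-sym x k

      nth-beyond : ∀ (x : Str) k → length x ≤ k → nth x k ≡ nothing
      nth-beyond []      k       le       = refl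
      nth-beyond (b ∷ x) (suc k) (s≤s le) = nth-beyond x k le

      -- The loading times that occur in the run: `m` symbols have been pushed, and the first 1
      -- stands at the one pushed last.
      clock : ℕ → ℕ → Str
      clock i m = replicate i false ++ replicate m true

      upred-clock : ∀ i m → app upredK (clock i (suc m)) ≡ clock (suc i) m
      upred-clock zero    m = cong (false ∷_) (upred-false (replicate m true))
      upred-clock (suc i) m = cong (false ∷_) (upred-clock i m)

      pay-clock : ∀ x i m → payOr nothing x (clock i (suc m)) ≡ nth x i
      pay-clock x       zero    m = refl
      pay-clock []      (suc i) m = pay-clock [] i m
      pay-clock (b ∷ x) (suc i) m = pay-clock x i m

      loadAt-clock : length x ≤ N → ∀ m i k → i + m ≡ N → k < 2 ^ N → loadAt m (clock i m) (bitsOf N k) ≡ symAt (i + k)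
      loadAt-clock le zero i k e lt = cong paySym (sym (nth-beyond x (i + k)
        (ℕ.≤-trans le (ℕ.≤-trans (ℕ.≤-reflexive (trans (sym e) (ℕ.+-identityʳ i))) (ℕ.m≤m+n i k)))))
      loadAt-clock le (suc m) i zero e lt rewrite isZero-zeros N | ℕ.+-identityʳ i = cong paySym (pay-clock x i m)
      loadAt-clock le (suc m) i (suc k) e lt rewrite isZero-bitsOf N k lt =
        trans (cong₂ (loadAt m) (upred-clock i m) (dec-inc (bitsOf N k)))
          (trans (loadAt-clock le m (suc i) k (trans (sym (ℕ.+-suc i m)) e) (ℕ.<-trans (ℕ.n<1+n k) lt)) (cong symAt (sym (ℕ.+-suc i k))))

      full1≡ : full1 ≡ clock 0 N
      full1≡ = go N
        where
        go : ∀ n → app decK (zeros n) ≡ replicate n true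
        go zero    = refl
        go (suc n) = cong (true ∷_) (go n)

      trues-ones : ∀ n → trues (replicate n true) ≡ n
      trues-ones zero    = refl
      trues-ones (suc n) = cong suc (trues-ones n)

    loaded-input : length x ≤ N → ∀ k → k < 2 ^ N → loaded full1 (bitsOf N k) ≡ rdS (map encBit x) k
    loaded-input le k lt = trans (cong (λ t → loaded t (bitsOf N k)) full1≡)
      (trans (cong (λ m → loadAt m (clock 0 N) (bitsOf N k)) (trues-ones N)) (trans (loadAt-clock le N 0 k refl lt) (sym (rd-sym x k))))

    agree-start : length x ≤ N → Agree 0 0 ∃Q (startConf M x)
    agree-start le = agree (cong (λ a → startᴹ , ∃Q , a , zero) (loaded-input le 0 (1≤2^ N))) refl
      (λ k lt → cong (λ a → (nothing , a) , (nothing , zero)) (loaded-input le (suc k) (ℕ.≤-trans (ℕ.≤-reflexive (cong suc (ℕ.+-comm 1 k))) lt)))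

-- Prefixes of oracle quantifiers

qp-const : ∀ q n {P : List Lang → Set} → (∀ Bs → P Bs) → QPrefix q n P
qp-const q  zero    h = h []
qp-const ∃Q (suc n) h = (λ _ → false) , qp-const ∀Q n (λ Bs → h _)
qp-const ∀Q (suc n) h = λ B → qp-const ∃Q n (λ Bs → h _)

qp-map : ∀ q n {P P′ : List Lang → Set} → (∀ Bs → length Bs ≡ n → P Bs → P′ Bs) → QPrefix q n P → QPrefix q n P′
qp-map q  zero    h p       = h [] refl p
qp-map ∃Q (suc n) h (B , p) = B , qp-map ∀Q n (λ Bs e → h (B ∷ Bs) (cong suc e)) p
qp-map ∀Q (suc n) h p       = λ B → qp-map ∃Q n (λ Bs e → h (B ∷ Bs) (cong suc e)) (p B)

-- Played against each other, the two strategies produce one list of oracles with both properties.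
qp-clash : ∀ q n {P P′ : List Lang → Set} → (∀ Bs → length Bs ≡ n → P Bs → P′ Bs → ⊥) → QPrefix q n P → QPrefix (dual q) n P′ → ⊥
qp-clash q  zero    h p       p′       = h [] refl p p′
qp-clash ∃Q (suc n) h (B , p) p′       = qp-clash ∀Q n (λ Bs e → h (B ∷ Bs) (cong suc e)) p (p′ B)
qp-clash ∀Q (suc n) h p       (B , p′) = qp-clash ∃Q n (λ Bs e → h (B ∷ Bs) (cong suc e)) (p B) p′

-- After an even number of quantifiers beginning with ∃ the next one is ∃ again.
qp-last : ∀ m {P : List Lang → Set} → QPrefix ∃Q (m * 2 + 1) P ⇔ QPrefix ∃Q (m * 2) (λ Bs → Σ Lang λ C → P (Bs ++ C ∷ []))
qp-last zero    = mk⇔ id id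
qp-last (suc m) = mk⇔
  (λ (B , p) → B , λ B′ → Equivalence.to (qp-last m) (p B′))
  (λ (B , p) → B , λ B′ → Equivalence.from (qp-last m) (p B′))

-- The player who wants the value to be v, seen from the player to move.
who : Bool → Quant → Quant
who true  q = q
who false q = dual q

-- Alternation as a game between oracles

module Game (M : AOTM) (N : ℕ) where
  open AOTM M using (δ; kind)
  open Clauses M
  open Questions M
  open Agreement M
  private
    module Z = Machine (asMachine M)
    Y₀ : Sys
    Y₀ = Z.zsys emptyOracle

  -- A question contains its time, which `val` recovers, so any sequence of transitions can be
  -- played by an oracle.
  strategyOracle : ∀ σ (s : ℕ → Tn) → Σ Lang λ B → ∀ i → i < 2 ^ N → ∀ e → choices N B σ i e ≡ eqT e (s i)
  strategyOracle σ s = B , spec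
    where
    F : Str → Str → Str → Tag → Bool
    F t _ _ (choice e) = eqT e (s (val t))
    F t _ _ _          = false
    dropS : ℕ → Str → Str
    dropS zero    y = y
    dropS (suc n) y = dropS n (tl y)
    B : Lang
    -- Removes the zeros left over from the stage string and the 0 that separates them from the
    -- body.
    B y = fromFacts N F (dropS (suc (N ∸ suc σ)) y)
    drop-zeros : ∀ k y → dropS (suc k) (zeros k ++ false ∷ y) ≡ y
    drop-zeros zero    y = refl
    drop-zeros (suc k) y = drop-zeros k y
    spec : ∀ i → i < 2 ^ N → ∀ e → choices N B σ i e ≡ eqT e (s i)
    spec i lt e = trans (cong (fromFacts N F) (drop-zeros (N ∸ suc σ) _))
      (trans (cong (λ n → fromFacts n F (body (bitsOf N i) (zeros N) (zeros N) (choice e))) (sym (length-bitsOf N i)))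
        (trans (fromFacts-body F (bitsOf N i) (zeros N) (zeros N) (choice e) lz lz) (cong (λ k → eqT e (s k)) (val-bitsOf N i lt))))
      where
      lz : length (zeros N) ≡ length (bitsOf N i)
      lz = trans (length-replicate N) (sym (length-bitsOf N i))

  private
    someSuccessor : ∀ pl v {t j} (f : Tn → Z.ZConf) es {bs} → who v pl ≡ ∃Q → Pointwise (Ev Y₀ t j (just pl)) (map f es) bs → foldQ pl bs ≡ v →
                    Σ Tn λ e → e ∈ es × Ev Y₀ t j (just pl) (f e) v
    someSuccessor ∃Q true f (e ∷ es) {true ∷ bs}  w (r ∷ rs) p = e , here refl , r
    someSuccessor ∃Q true f (e ∷ es) {false ∷ bs} w (r ∷ rs) p with someSuccessor ∃Q true f es w rs p
    ... | x , i , ev = x , there i , ev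
    someSuccessor ∀Q false f (e ∷ es) {false ∷ bs} w (r ∷ rs) p = e , here refl , r
    someSuccessor ∀Q false f (e ∷ es) {true ∷ bs}  w (r ∷ rs) p with someSuccessor ∀Q false f es w rs p
    ... | x , i , ev = x , there i , ev
    someSuccessor ∃Q true  f [] w [] ()
    someSuccessor ∀Q false f [] w [] ()

    allSuccessors : ∀ pl v {t j} (f : Tn → Z.ZConf) es {bs} → who v pl ≡ ∀Q → Pointwise (Ev Y₀ t j (just pl)) (map f es) bs → foldQ pl bs ≡ v →
                    ∀ e → e ∈ es → Ev Y₀ t j (just pl) (f e) v
    allSuccessors ∃Q false f (_ ∷ es) {false ∷ bs} w (r ∷ rs) p e (here refl) = r
    allSuccessors ∃Q false f (_ ∷ es) {false ∷ bs} w (r ∷ rs) p e (there i)   = allSuccessors ∃Q false f es w rs p e i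
    allSuccessors ∀Q true  f (_ ∷ es) {true ∷ bs}  w (r ∷ rs) p e (here refl) = r
    allSuccessors ∀Q true  f (_ ∷ es) {true ∷ bs}  w (r ∷ rs) p e (there i)   = allSuccessors ∀Q true f es w rs p e i

    pick-chosen : ∀ α x e es → x ∈ e ∷ es → (∀ e → α e ≡ eqT e x) → pick α e es ≡ take false x
    pick-chosen α x e [] (here refl) h rewrite h x | eqF-refl fin-Tn x = refl
    pick-chosen α x e (e′ ∷ es) i h with eqT e x in eq
    ... | true  rewrite trans (h e) eq = cong (take false) (eqF-sound fin-Tn e x eq)
    pick-chosen α x e (e′ ∷ es) (here refl) h | false with () ← trans (sym (eqF-refl fin-Tn x)) eq
    pick-chosen α x e (e′ ∷ es) (there i)   h | false rewrite trans (h e) eq = pick-chosen α x e′ es i h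

    pick-member : ∀ α e es → Σ Bool λ c → Σ Tn λ x → x ∈ e ∷ es × pick α e es ≡ take c x
    pick-member α e [] = _ , e , here refl , refl
    pick-member α e (e′ ∷ es) with α e
    ... | true  = false , e , here refl , refl
    ... | false with pick-member α e′ es
    ...   | c , x , i , p = c , x , there i , p

    same-quant : ∀ q pl → q ≡ pl ⊎ q ≡ dual pl
    same-quant ∃Q ∃Q = inj₁ refl
    same-quant ∃Q ∀Q = inj₂ refl
    same-quant ∀Q ∃Q = inj₂ refl
    same-quant ∀Q ∀Q = inj₁ refl

    sameQ-dual : ∀ pl → sameQ (dual pl) pl ≡ false
    sameQ-dual ∃Q = refl
    sameQ-dual ∀Q = refl

    switch-dual : ∀ pl → switch (just pl) (dual pl) ≡ 1
    switch-dual ∃Q = refl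
    switch-dual ∀Q = refl

    who-dual : ∀ v pl → who v (dual pl) ≡ dual (who v pl)
    who-dual true  pl = refl
    who-dual false pl = refl

    successors : Z.ZConf → List Tn
    successors (zc s w o) = δ s (Z.read w) (Z.read o)

    act-branch : ∀ α pl q z {w es} → kind (Zip.stz z) ≡ quant q → sameQ q pl ≡ w → successors z ≡ es → actOf α (rhoZ pl z) ≡ actBranch α w es
    act-branch α pl q (zc s w o) e refl refl rewrite e = refl

    rej-branch : ∀ pl q z {w es} → kind (Zip.stz z) ≡ quant q → sameQ q pl ≡ w → successors z ≡ es → rejecting (rhoZ pl z) ≡ rejBranch q w es
    rej-branch pl q (zc s w o) e refl refl rewrite e = refl

    act-kind : ∀ α pl z {k} → kind (Zip.stz z) ≡ k → actOf α (rhoZ pl z) ≡ actKind α k (rhoZ pl z)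
    act-kind α pl (zc s w o) refl = refl

    rej-kind : ∀ pl z {k} → kind (Zip.stz z) ≡ k → rejecting (rhoZ pl z) ≡ rejKind k (rhoZ pl z)
    rej-kind pl (zc s w o) refl = refl

    halt : ∀ {b σ j B Bs pl z v} → actOf (choices N B σ j) (rhoZ pl z) ≡ stay → rejecting (rhoZ pl z) ≡ not v → Play N b σ j (B ∷ Bs) pl z v
    halt {v = v} a r = subst (Play N _ _ _ _ _ _) (trans (cong not r) (Bool.not-involutive v)) (halted a)

    stuck : ∀ α pl z {v} → kind (Zip.stz z) ≡ quant pl → successors z ≡ [] → foldQ pl [] ≡ v →
            actOf α (rhoZ pl z) ≡ stay × rejecting (rhoZ pl z) ≡ not v
    stuck α pl z e es refl = act-branch α pl pl z e (eqF-refl fin-Quant pl) es ,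
      trans (rej-branch pl pl z e (eqF-refl fin-Quant pl) es) (go pl)
      where
      go : ∀ pl → rejBranch pl true [] ≡ not (foldQ pl [])
      go ∃Q = refl
      go ∀Q = refl

    swapped-act : ∀ α pl z → kind (Zip.stz z) ≡ quant (dual pl) → actOf α (rhoZ pl z) ≡ swap
    swapped-act α pl z e = act-branch α pl (dual pl) z e (sameQ-dual pl) refl

    room-suc : ∀ {j b} → suc (suc b + j) ≤ 2 ^ N → suc (b + suc j) ≤ 2 ^ N
    room-suc {j} {b} lt = ℕ.≤-trans (ℕ.≤-reflexive (cong suc (ℕ.+-suc b j))) lt

  -- Induction on the remaining stages `n` and, within a stage, on the run. `k < n` ensures that a
  -- stage is left for every alternation. A swap takes a time step of its own, whence `t + n`.
  win : ∀ n t {k pl z v} → Ev Y₀ t k (just pl) z v → k < n → ∀ σ j → t + n + j < 2 ^ N →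
        QPrefix (who v pl) n (λ Bs → Play N (t + n) σ j Bs pl z v)
  private
    -- While the winning player is in charge, one run is followed up to the end of the stage. Its
    -- transitions are collected first, and a single oracle is made of them afterwards; so `B` is
    -- constrained from time `j` on only, and `update` can prefix one more transition.
    chooser : ∀ n t {k pl z v} → who v pl ≡ ∃Q → Ev Y₀ t k (just pl) z v → k < suc n → ∀ σ j → t + suc n + j < 2 ^ N →
      Σ (ℕ → Tn) λ s → ∀ B → (∀ i → j ≤ i → i < 2 ^ N → ∀ e → choices N B σ i e ≡ eqT e (s i)) →
        QPrefix ∀Q n (λ Bs → Play N (t + suc n) σ j (B ∷ Bs) pl z v)
    -- All successors have the right value, so the transition picked by whatever oracle the opponent
    -- fixed is a good one.
    responder : ∀ n t {k pl z v} → who v pl ≡ ∀Q → Ev Y₀ t k (just pl) z v → k < suc n → ∀ σ j → t + suc n + j < 2 ^ N →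
      ∀ B → QPrefix ∃Q n (λ Bs → Play N (t + suc n) σ j (B ∷ Bs) pl z v)

    anyTn : Tn
    anyTn = AOTM.start M , zero , S , zero , S

    swapping : ∀ n t {k j pl z v bs B σ i} → kind (Zip.stz z) ≡ quant (dual pl) → switch (just pl) (dual pl) + j ≤ k → k < suc n →
      Pointwise (Ev Y₀ t j (just (dual pl))) (Z.znext z) bs → foldQ (dual pl) bs ≡ v → suc t + suc n + i < 2 ^ N →
      QPrefix (who v (dual pl)) n (λ Bs → Play N (suc t + suc n) σ i (B ∷ Bs) pl z v)
    swapping n t {k} {j} {pl} {z} {v} {B = B} {σ} {i} e j≤ k< rs f lt =
      subst (λ b → QPrefix (who v (dual pl)) n (λ Bs → Play N b σ i (B ∷ Bs) pl z v)) (sym (ℕ.+-suc (suc t) n))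
        (qp-map _ n (λ Bs _ → swapped (swapped-act _ pl z e))
          (win n (suc t) (ev-branch (dual pl) e (ℕ.≤-reflexive (cong (_+ j) (switch-self (dual pl)))) rs f)
            (ℕ.≤-trans (ℕ.≤-reflexive (cong (_+ j) (sym (switch-dual pl)))) (ℕ.≤-trans j≤ (ℕ.≤-pred k<)))
            (suc σ) (suc i) (room-suc {i} {suc t + n} (ℕ.≤-trans (ℕ.≤-reflexive (cong (λ b → suc (b + i)) (sym (ℕ.+-suc (suc t) n)))) lt))))

    update : ℕ → Tn → (ℕ → Tn) → ℕ → Tn
    update j e s i with i ℕ.≟ j
    ... | yes _ = e
    ... | no  _ = s i

    update-same : ∀ j e s → update j e s j ≡ e
    update-same j e s with j ℕ.≟ j
    ... | yes _ = refl
    ... | no ¬e = ⊥-elim (¬e refl)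

    update-later : ∀ j e s i → j < i → update j e s i ≡ s i
    update-later j e s i lt with i ℕ.≟ j
    ... | yes refl = ⊥-elim (ℕ.<-irrefl refl lt)
    ... | no _     = refl

    below : ∀ {b j} → b + j < 2 ^ N → j < 2 ^ N
    below {b} {j} lt = ℕ.≤-trans (s≤s (ℕ.m≤n+m j b)) lt

    chooser n t {pl = pl} {z} w (ev-accept e) k< σ j lt = (λ _ → anyTn) , λ B h → qp-const ∀Q n (λ Bs → halt (act-kind _ pl z e) (rej-kind pl z e))
    chooser n t {pl = pl} {z} w (ev-reject e) k< σ j lt = (λ _ → anyTn) , λ B h → qp-const ∀Q n (λ Bs → halt (act-kind _ pl z e) (rej-kind pl z e))
    chooser n (suc t) {pl = pl} {z} w (ev-query e r) k< σ j lt with chooser n t w r k< σ (suc j) (room-suc lt)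
    ... | s , h = s , λ B hB → qp-map ∀Q n (λ Bs _ → moved (act-kind _ pl z e) (λ ()) (λ ())) (h B (λ i le → hB i (ℕ.<⇒≤ le)))
    chooser n (suc t) {pl = pl} {z} {v} w (ev-branch q e j≤ rs f) k< σ j lt with same-quant q pl
    chooser n (suc t) {pl = pl} {z} {v} w (ev-branch q e j≤ rs f) k< σ j lt | inj₂ refl = (λ _ → anyTn) , λ B h →
      subst (λ p → QPrefix p n (λ Bs → Play N (suc t + suc n) σ j (B ∷ Bs) pl z v)) (trans (who-dual v pl) (cong dual w)) (swapping n t e j≤ k< rs f lt)
    chooser n (suc t) {k} {pl} {z@(zc _ wt ot)} {v} w (ev-branch {j = j₀} q e j≤ rs f) k< σ j lt | inj₁ refl
      with someSuccessor pl v (Z.zstep z) (successors z) w rs f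
    ... | x , x∈ , r with chooser n t w r (ℕ.≤-trans (s≤s (ℕ.≤-trans (ℕ.m≤n+m j₀ (switch (just pl) pl)) j≤)) k<) σ (suc j) (room-suc lt)
    ...   | s , h = update j x s , λ B hB → qp-map ∀Q n (λ Bs _ → moved (taken B hB) (λ ()) (λ ()))
            (h B (λ i le lt′ e′ → trans (hB i (ℕ.<⇒≤ le) lt′ e′) (cong (eqT e′) (update-later j x s i le))))
      where
      taken : ∀ B → (∀ i → j ≤ i → i < 2 ^ N → ∀ e → choices N B σ i e ≡ eqT e (update j x s i)) → actOf (choices N B σ j) (rhoZ pl z) ≡ take false x
      taken B hB = go (successors z) refl x∈
        where
        go : ∀ es → successors z ≡ es → x ∈ es → actOf (choices N B σ j) (rhoZ pl z) ≡ take false x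
        go (e₁ ∷ es) eq i = trans (act-branch _ pl pl z e (eqF-refl fin-Quant pl) eq)
          (pick-chosen (choices N B σ j) x e₁ es i (λ e′ → trans (hB j ℕ.≤-refl (below {suc t + suc n} lt) e′) (cong (eqT e′) (update-same j x s))))

    responder n t {pl = pl} {z} w (ev-accept e) k< σ j lt B = qp-const ∃Q n (λ Bs → halt (act-kind _ pl z e) (rej-kind pl z e))
    responder n t {pl = pl} {z} w (ev-reject e) k< σ j lt B = qp-const ∃Q n (λ Bs → halt (act-kind _ pl z e) (rej-kind pl z e))
    responder n (suc t) {pl = pl} {z} w (ev-query e r) k< σ j lt B =
      qp-map ∃Q n (λ Bs _ → moved (act-kind _ pl z e) (λ ()) (λ ())) (responder n t w r k< σ (suc j) (room-suc lt) B)
    responder n (suc t) {pl = pl} {z} {v} w (ev-branch q e j≤ rs f) k< σ j lt B with same-quant q pl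
    responder n (suc t) {pl = pl} {z} {v} w (ev-branch q e j≤ rs f) k< σ j lt B | inj₂ refl =
      subst (λ p → QPrefix p n (λ Bs → Play N (suc t + suc n) σ j (B ∷ Bs) pl z v)) (trans (who-dual v pl) (cong dual w)) (swapping n t e j≤ k< rs f lt)
    responder n (suc t) {k} {pl} {z@(zc _ wt ot)} {v} w (ev-branch {j = j₀} {bs = bs} q e j≤ rs f) k< σ j lt B | inj₁ refl = go (successors z) refl
      where
      go : ∀ es → successors z ≡ es → QPrefix ∃Q n (λ Bs → Play N (suc t + suc n) σ j (B ∷ Bs) pl z v)
      go [] eq = qp-const ∃Q n (λ Bs → let a , r = stuck _ pl z e eq (trans (cong (foldQ pl) (sym (empty (subst (λ es → Pointwise (Ev Y₀ t j₀ (just pl)) (map (Z.zstep z) es) bs) eq rs)))) f) in halt a r)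
        where
        empty : ∀ {bs} → Pointwise (Ev Y₀ t j₀ (just pl)) [] bs → bs ≡ []
        empty [] = refl
      go (e₁ ∷ es) eq with pick-member (choices N B σ j) e₁ es
      ... | c , x , x∈ , p = qp-map ∃Q n (λ Bs _ → moved (trans (act-branch _ pl pl z e (eqF-refl fin-Quant pl) eq) p) (λ ()) (λ ()))
        (responder n t w (allSuccessors pl v (Z.zstep z) (successors z) w rs f x (subst (x ∈_) (sym eq) x∈))
          (ℕ.≤-trans (s≤s (ℕ.≤-trans (ℕ.m≤n+m j₀ (switch (just pl) pl)) j≤)) k<) σ (suc j) (room-suc lt) B)
  win (suc n) t {pl = pl} {z} {v} ev k< σ j lt = go (who v pl) refl
    where
    go : ∀ q → who v pl ≡ q → QPrefix q (suc n) (λ Bs → Play N (t + suc n) σ j Bs pl z v)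
    go ∃Q w with chooser n t w ev k< σ j lt
    ... | s , h with strategyOracle σ s
    ...   | B , hB = B , h B (λ i _ → hB i)
    go ∀Q w = responder n t w ev k< σ j lt

-- From left to right: assembly and bounds

module Forward (A : Lang) (M : AOTM) (p q : Poly)
  (spec : ∀ x → (Run.halts M emptyOracle (2 ^ eval p (length x)) (Run.initial M x) ≡ true)
              × (Run.alts M emptyOracle (2 ^ eval p (length x)) nothing (Run.initial M x) ≤ eval q (length x))
              × (A x ≡ Run.accepts M emptyOracle (2 ^ eval p (length x)) x)) where

  -- The summands make the block long enough for the input, the time and the alternations. The 3
  -- gives 3 ≤ 2^c, used to fit the time and all swaps below 2^N = 2^c * 2^c.
  h-bound : PolyBounded (λ n → n + eval p n + eval q n + 3)
  h-bound = pb-id pb+ pb-eval p pb+ pb-eval q pb+ pb-const 3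

  h : Poly
  h = proj₁ h-bound

  c N : ℕ → ℕ
  c n = eval (cellPoly h) n
  N n = c n * 2

  open Verifier M h
  open Core verCore using (program)
  open Program program using (compile; compile-encodes; initial-compiled)
  open Agreement M

  fits : ∀ n → suc (2 ^ eval p n + N n) < 2 ^ N n × n ≤ N n × suc (eval q n) < N n
  fits n = ℕ.≤-trans (s≤s (s≤s (ℕ.+-monoˡ-≤ (N n) (ℕ.^-monoʳ-≤ 2 p≤)))) square ,
    ℕ.≤-trans (ℕ.≤-trans (ℕ.m≤m+n n _) (ℕ.≤-trans (ℕ.≤-reflexive (lem₁ n (eval p n) (eval q n))) c≥)) c≤N ,
    ℕ.≤-trans (ℕ.≤-trans (ℕ.m≤m+n _ _) (ℕ.≤-trans (ℕ.≤-reflexive (lem₂ n (eval p n) (eval q n))) c≥)) c≤N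
    where
    c≥ : suc (n + eval p n + eval q n + 3) ≤ c n
    c≥ = ℕ.≤-trans (s≤s (proj₂ h-bound n)) (eval<cellPoly h n)
    c≤N : c n ≤ N n
    c≤N = ℕ.m≤m*n (c n) 2
    lem₁ : ∀ a b d → a + suc (b + d + 3) ≡ suc (a + b + d + 3)
    lem₁ = solve-∀
    lem₂ : ∀ a b d → suc (suc d) + (a + b + 2) ≡ suc (a + b + d + 3)
    lem₂ = solve-∀
    lem₃ : ∀ a b d → b + suc (a + d + 3) ≡ suc (a + b + d + 3)
    lem₃ = solve-∀
    p≤ : eval p n ≤ c n
    p≤ = ℕ.≤-trans (ℕ.m≤m+n _ _) (ℕ.≤-trans (ℕ.≤-reflexive (lem₃ n (eval p n) (eval q n))) c≥)
    square : suc (suc (2 ^ c n + N n)) ≤ 2 ^ N n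
    square = ℕ.≤-trans (ℕ.≤-reflexive (lem₄ (2 ^ c n) (c n)))
      (ℕ.≤-trans (ℕ.+-monoʳ-≤ (2 ^ c n) (ℕ.*-monoˡ-≤ 2 (n<2^n (c n))))
      (ℕ.≤-trans (ℕ.≤-reflexive (lem₅ (2 ^ c n)))
      (ℕ.≤-trans (ℕ.*-monoˡ-≤ (2 ^ c n) (ℕ.≤-trans (ℕ.≤-trans (ℕ.m≤n+m 3 (suc (n + eval p n + eval q n))) c≥) (ℕ.<⇒≤ (n<2^n (c n)))))
        (ℕ.≤-reflexive (trans (sym (ℕ.^-distribˡ-+-* 2 (c n) (c n))) (cong (2 ^_) (lem₆ (c n))))))))
      where
      lem₄ : ∀ a b → suc (suc (a + b * 2)) ≡ a + suc b * 2
      lem₄ = solve-∀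
      lem₅ : ∀ a → a + a * 2 ≡ 3 * a
      lem₅ = solve-∀
      lem₆ : ∀ a → a + a ≡ a * 2
      lem₆ = solve-∀

  cost : ℕ → ℕ
  cost n = 3 + (N n * (2 * N n + 3 * n + 8) + (1 + (N n + 1))) +
           (1 + (N n + (1 + (N n + (2 + (1 + (N n + (1 + (N n + (N n * 3 + (1 + (Clauses.tagSize M + 1)))))) + 2))))))

  time-bound : PolyBounded cost
  time-bound = pb-const 3 pb+ (pbN pb* (pb-const 2 pb* pbN pb+ pb-const 3 pb* pb-id pb+ pb-const 8) pb+ (pb-const 1 pb+ (pbN pb+ pb-const 1))) pb+
    (pb-const 1 pb+ (pbN pb+ (pb-const 1 pb+ (pbN pb+ (pb-const 2 pb+
      (pb-const 1 pb+ (pbN pb+ (pb-const 1 pb+ (pbN pb+ (pbN pb* pb-const 3 pb+ pb-const (1 + (Clauses.tagSize M + 1)))))) pb+ pb-const 2))))))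
    where
    pbN : PolyBounded N
    pbN = pb-eval (cellPoly h) pb* pb-const 2

  f : Poly
  f = addP (scaleP 2 (cellPoly h)) (1 ∷ [])

  f≡ : ∀ n → eval f n ≡ N n + 1
  f≡ n = trans (eval-addP (scaleP 2 (cellPoly h)) (1 ∷ []) n)
    (cong₂ _+_ (trans (eval-scaleP 2 (cellPoly h) n) (ℕ.*-comm 2 (c n))) (cong suc (ℕ.*-zeroʳ n)))

  module Input (x : Str) where
    n : ℕ
    n = length x

    block≡ : cellCount n IH + cellCount n IH ≡ N n
    block≡ = trans (cong₂ _+_ (cellCount-instrsOf false h n) (cellCount-instrsOf false h n)) (lem (c n))
      where
      lem : ∀ a → a + a ≡ a * 2
      lem = solve-∀

    decided : ∀ O → Σ Bool λ v → Ev (concrete compile O) (eval (proj₁ time-bound) n) 2 nothing (Run.initial compile x) v ×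
                    Reflects (Clauses.Closed M (N n) x O) v
    decided O with Verification.verified M h O x
    ... | v , ev , rf = v ,
      forward (bisim compile-encodes O) (initial-compiled O x)
        (ev-mono (ℕ.≤-trans (ℕ.≤-reflexive (cong (λ k → 3 + (k * (2 * k + 3 * n + 8) + (1 + (k + 1))) + Verification.verCost M h O x k) block≡)) (proj₂ time-bound n)) ℕ.≤-refl ev) ,
      subst (λ k → Reflects (Clauses.Closed M k x O) v) block≡ rf

    accepted : ∀ O → (Run.accepts compile O (eval (proj₁ time-bound) n) x ≡ true) ⇔ Clauses.Closed M (N n) x O
    accepted O with decided O
    ... | v , ev , rf = subst (λ a → (a ≡ true) ⇔ Clauses.Closed M (N n) x O) (sym (ev⇒acc compile O ev)) (reflects-true rf)

    T : ℕ
    T = 2 ^ eval p n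

    value : Bool
    value = Run.accepts M emptyOracle T x

    won : QPrefix (who value ∃Q) (N n) (λ Bs → Play (N n) (T + N n) 0 0 Bs ∃Q (startConf M x) value)
    -- The first stage always belongs to the existential player. `ev-prev` pays for the alternation
    -- when `M` begins universally.
    won = Game.win M (N n) (N n) T (ev-prev (halts⇒run M emptyOracle T x (proj₁ (spec x))))
      (ℕ.≤-trans (s≤s (s≤s (proj₁ (proj₂ (spec x))))) (proj₂ (proj₂ (fits n)))) 0 0
      (ℕ.≤-trans (s≤s (ℕ.≤-trans (ℕ.≤-reflexive (ℕ.+-identityʳ _)) (ℕ.n≤1+n _))) (proj₁ (fits n)))

    module _ (Bs : List Lang) (len : length Bs ≡ N n) where
      open Tableau M x (N n) Bs len
      open SR

      verdict : ∀ {v} → Play (N n) (T + N n) 0 0 Bs ∃Q (startConf M x) v → Verdict x (N n) Bs len v 0 × Staged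
      verdict pl = play-verdict x (N n) Bs len pl (agree-start x (N n) Bs len (proj₁ (proj₂ (fits n)))) refl (proj₁ (fits n))

      true-closed : Play (N n) (T + N n) 0 0 Bs ∃Q (startConf M x) true → Σ Lang λ C → Clauses.Closed M (N n) x (tupleOracle (Bs ++ C ∷ []))
      true-closed pl = truth , truth-closed (proj₂ (verdict pl)) (λ j _ → proj₁ (verdict pl) j)

      false-open : Play (N n) (T + N n) 0 0 Bs ∃Q (startConf M x) false → (Σ Lang λ C → Clauses.Closed M (N n) x (tupleOracle (Bs ++ C ∷ []))) → ⊥
      false-open pl (C , cl) with proj₁ (verdict pl)
      ... | i , lt , rej with () ← trans (sym (Forced.safe (proj₂ (verdict pl)) C cl i lt)) rej

    Win : Set
    Win = QPrefix ∃Q (N n) (λ Bs → Σ Lang λ C → Clauses.Closed M (N n) x (tupleOracle (Bs ++ C ∷ [])))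

    -- The player favoured by `value` has a strategy. If that is the universal one, a strategy for
    -- `Win` would clash with it, since no oracle of facts survives a rejecting play.
    win⇔ : (value ≡ true) ⇔ Win
    win⇔ = go value won
      where
      go : ∀ v → QPrefix (who v ∃Q) (N n) (λ Bs → Play (N n) (T + N n) 0 0 Bs ∃Q (startConf M x) v) → (v ≡ true) ⇔ Win
      go true  w = mk⇔ (λ _ → qp-map ∃Q (N n) true-closed w) (λ _ → refl)
      go false w = mk⇔ (λ ()) (λ win → ⊥-elim (qp-clash ∃Q (N n) (λ Bs len s pl → false-open Bs len pl s) win w))

    Prefix : ℕ → Set
    Prefix k = QPrefix ∃Q k (λ Bs → Run.accepts compile (tupleOracle Bs) (eval (proj₁ time-bound) n) x ≡ true)

    prefix⇔ : Win ⇔ Prefix (eval f n)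
    prefix⇔ = mk⇔
      (λ w → subst Prefix (sym (f≡ n)) (Equivalence.from (qp-last (c n))
        (qp-map ∃Q (N n) (λ Bs _ (C , cl) → C , Equivalence.from (accepted _) cl) w)))
      (λ a → qp-map ∃Q (N n) (λ Bs _ (C , cl) → C , Equivalence.to (accepted _) cl)
        (Equivalence.to (qp-last (c n)) (subst Prefix (f≡ n) a)))

    correct : (A x ≡ true) ⇔ Prefix (eval f n)
    correct = subst (λ a → (a ≡ true) ⇔ Prefix (eval f n)) (sym (proj₂ (proj₂ (spec x)))) (win⇔ ⇔∘ prefix⇔)

  polyTime : PolyTimeAOTM compile (proj₁ time-bound)
  polyTime O x = ev⇒halts compile O (proj₁ (proj₂ (Input.decided x O)))

theorem6 : (A : Lang) →
    AEXPTIMEpoly A ⇔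
    (Σ Poly λ f → Σ AOTM λ M → Σ Poly λ p → Σ Quant λ q₁ →
    PolyTimeAOTM M p ×
    (∀ (x : Str) →
    (A x ≡ true) ⇔
    QPrefix q₁ (eval f (length x))
    (λ Bs → Run.accepts M (tupleOracle Bs) (eval p (length x)) x ≡ true)))
theorem6 A = mk⇔
  (λ (M , p , q , spec) → let open Forward A M p q spec in
    f , Program.compile (Core.program (Verifier.verCore M h)) , proj₁ time-bound , ∃Q , polyTime , Input.correct)
  (λ (f , M , p , q₁ , poly , spec) → Backward.result A f M p q₁ poly spec)
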